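{- Let $G'$ be a natural unit interval graph on $[n']$ and let $\varphi'$ be a nice involution for $G'$. Let $a\ge 2$, $\epsilon\in\{0,1\}$, and $G=K_a^\epsilon+G'$. Then there is a nice involution $\varphi$ for $G$ whose set of fixed points is exactly the set of simple forest triples $\mathcal F=((T_t,\alpha^{(t)},r_t))_{t=1}^m$ of $G$ such that: $\mathcal F$ is an atom; $\mathcal F|_{\ge a}$ is fixed by $\varphi'$; $\mathrm{seg}_{[a]}(\mathcal F)\le 2$; and, letting $(T_i,\alpha^{(i)},r_i)$ be the tree triple with $a\in V(T_i)$, if $1\notin V(T_i)$ then $r_i\ge a-\epsilon$, and if $1\in V(T_i)$ then $|V(T_i)|\ge a$.
   Context: Natural unit interval graph: $G=([n],E)$ with, for $1\le i<j<k\le n$, $\{i,k\}\in E$ implying $\{i,j\},\{j,k\}\in E$. $K_a^0$ is the complete graph on $[a]$ and $K_a^1$ is the complete graph on $[a]$ with the edge $\{1,a\}$ removed. The sum of graphs $G_1=([n_1],E_1)$, $G_2=([n_2],E_2)$ is $G_1+G_2=([n_1+n_2-1],E_1\cup\{\{i+n_1-1,j+n_1-1\}:\{i,j\}\in E_2\})$ (vertex $n_1$ of $G_1$ glued to vertex $1$ of $G_2$). For a natural unit interval graph $G$: a decreasing subtree is a subgraph $T$ which is a tree (nonempty vertex set) in which every vertex other than the largest has exactly one larger neighbour in $T$; $\mathrm{list}(T)$ is the permutation of $V(T)$ read by starting at the smallest vertex of $T$ and repeatedly reading the smallest unread vertex of $T$ adjacent in $T$ to an already read vertex. A tree triple is $(T,\alpha,r)$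 with $T$ a decreasing subtree, $\alpha$ a composition of $|V(T)|$, $1\le r\le\alpha_1$. A forest triple is a sequence $\mathcal F=((T_t,\alpha^{(t)},r_t))_{t=1}^m$ of tree triples with the $V(T_t)$ partitioning the vertex set and $\min V(T_1)<\dots<\min V(T_m)$; $\mathrm{type}$ = sorted concatenation of the $\alpha^{(t)}$; $\mathrm{sign}=(-1)^{\sum_t(\ell(\alpha^{(t)})-1)}$; $\mathrm{weight}=\mathrm{inv}_G(\mathrm{list}(T_1)\cdots\mathrm{list}(T_m))+\sum_t(r_t-1)$, where $\mathrm{inv}_G(\sigma)=|\{(i,j):i<j,\sigma_i>\sigma_j,\{\sigma_j,\sigma_i\}\in E\}|$. $\alpha^{(1)}_1(\mathcal F)$ is the first part of $\alpha^{(1)}$. $\mathcal F$ is simple if $r_1=1$, an atom if every $\alpha^{(t)}$ has one part. A nice involution for $G$ is a map $\varphi$ on simple forest triples of $G$ with $\varphi\circ\varphi=\mathrm{id}$, preserving type, weight and $\alpha^{(1)}_1$, all of whose fixed points are atoms, and with $\mathrm{sign}(\varphi(\mathcal F))=-\mathrm{sign}(\mathcal F)$ whenever $\varphi(\mathcal F)\neq\mathcal F$. Restriction: let $G=G_1+G_2$ with $G_1$ on $[n_1]$, and let $\mathcal F=((T_t,\alpha^{(t)},r_t))_{t=1}^m$ be a simple forest triple of $G$. Let $i$ be such that $n_1\in V(T_i)$, $\sigma=\mathrm{list}(T_i)$, $k=|V(T_i)\cap[n_1]|$, and $\mathrm{seg}_{[n_1]}(T_i)=j$ the index with $\alpha^{(i)}_1+\dots+\alpha^{(i)}_{j-1}<k\le\alpha^{(i)}_1+\dots+\alpha^{(i)}_j$.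 Let $i'\ge i$ be maximal with $V(T_{i'})\cap[n_1]\ne\emptyset$. Define $\mathrm{seg}_{[n_1]}(\mathcal F)=\mathrm{seg}_{[n_1]}(T_i)+\sum_{1\le t\le i',t\ne i}\ell(\alpha^{(t)})$. Define the tree triple $\mathcal T_i|_{\ge n_1}=(n_1\,\sigma_{k+1}\cdots\sigma_{|V(T_i)|},\ (\alpha^{(i)}_1+\dots+\alpha^{(i)}_j-k+1)\,\alpha^{(i)}_{j+1}\cdots\alpha^{(i)}_{\ell},\ 1)$ (the first entries of $\sigma$ are exactly the $k$ vertices $\le n_1$), and the simple forest triple of $G_2$: $\mathcal F|_{\ge n_1}=(\mathcal T_i|_{\ge n_1}-(n_1-1),\ \mathcal T_{i'+1}-(n_1-1),\dots,\mathcal T_m-(n_1-1))$, where $\mathcal T-x$ subtracts $x$ from every vertex label of the tree (equivalently of its list). In the claim this is applied with $G_1=K_a^\epsilon$, $n_1=a$, $G_2=G'$. -}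

module Defs where

open import Data.Bool using (Bool; true; false; _∧_; _∨_; not; if_then_else_)
open import Data.Nat using (ℕ; zero; suc; _+_; _∸_; _≤_; _<_; _⊔_; _≤ᵇ_; _<ᵇ_; _≡ᵇ_)
open import Data.Nat.Properties using (≤-decTotalOrder)
open import Data.Fin using (Fin)
open import Data.List using (List; []; _∷_; _++_; [_]; length; map; concat; foldr;
  filterᵇ; take; drop; applyUpTo; lookup; removeAt)
open import Data.Bool.ListAction using (any)
open import Data.Nat.ListAction using (sum)
open import Data.List.Membership.Propositional using (_∈_)
open import Data.List.Relation.Unary.All using (All)
open import Data.List.Relation.Unary.Linked using (Linked)
open import Data.List.Relation.Binary.Permutation.Propositional using (_↭_)
open import Data.Product using (Σ; _×_; _,_; proj₁; proj₂)
open import Data.Sum using (_⊎_)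
open import Data.Unit using (⊤)
open import Data.Integer using (ℤ; +_; -_)
open import Relation.Binary.PropositionalEquality using (_≡_; _≢_)
open import Relation.Nullary using (¬_)
import Data.List.Sort

-- Graphs on [n] = {1,…,n}.  The edge set is given by a Boolean
-- adjacency function E (E i j ≡ true iff {i,j} is an edge).

record Graph : Set where
  constructor mkGraph
  field
    n : ℕ
    E : ℕ → ℕ → Bool
open Graph public

record IsNUIG (G : Graph) : Set where
  field
    irrefl : ∀ i → E G i i ≡ false
    sym    : ∀ i j → E G i j ≡ E G j i
    range  : ∀ i j → E G i j ≡ true → (1 ≤ i × i ≤ n G) × (1 ≤ j × j ≤ n G)
    nui    : ∀ i j k → i < j → j < k → E G i k ≡ true →
               (E G i j ≡ true) × (E G j k ≡ true)

inRange : ℕ → ℕ → Bool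
inRange a u = (1 ≤ᵇ u) ∧ (u ≤ᵇ a)

-- K_a^0 (ε = 0) and K_a^1 (ε = 1, edge {1,a} removed); ε ≥ 1 treated as 1
K : ℕ → ℕ → Graph
K a ε = mkGraph a (λ u v → inRange a u ∧ inRange a v ∧ not (u ≡ᵇ v)
                      ∧ not ((1 ≤ᵇ ε) ∧ (((u ≡ᵇ 1) ∧ (v ≡ᵇ a)) ∨ ((u ≡ᵇ a) ∧ (v ≡ᵇ 1)))))

-- the sum G₁ + G₂ (vertex n₁ of G₁ glued to vertex 1 of G₂)
_⊕_ : Graph → Graph → Graph
G₁ ⊕ G₂ = mkGraph (n G₁ + n G₂ ∸ 1)
  (λ u v → E G₁ u v ∨ ((n G₁ ≤ᵇ u) ∧ (n G₁ ≤ᵇ v)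
                         ∧ E G₂ (u ∸ n G₁ + 1) (v ∸ n G₁ + 1)))

-- Tree triples.  A subgraph T is encoded canonically by its vertex
-- set V (strictly increasing list) and edge set Ed (list of pairs
-- (u,v) with u < v, strictly increasing lexicographically).

record TreeTriple : Set where
  constructor tt
  field
    V  : List ℕ
    Ed : List (ℕ × ℕ)
    α  : List ℕ
    r  : ℕ
open TreeTriple public

Forest : Set
Forest = List TreeTriple

_<ₑ_ : ℕ × ℕ → ℕ × ℕ → Set
(u , v) <ₑ (u' , v') = (u < u') ⊎ ((u ≡ u') × (v < v'))

memB : ℕ → List ℕ → Bool
memB x = any (λ y → x ≡ᵇ y)

adjT : List (ℕ × ℕ) → ℕ → ℕ → Bool
adjT Ed u v = any (λ e → ((proj₁ e ≡ᵇ u) ∧ (proj₂ e ≡ᵇ v)) ∨ ((proj₁ e ≡ᵇ v) ∧ (proj₂ e ≡ᵇ u))) Ed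

data Reach (Ed : List (ℕ × ℕ)) : ℕ → ℕ → Set where
  here : ∀ {u} → Reach Ed u u
  step : ∀ {u w v} → adjT Ed u w ≡ true → Reach Ed w v → Reach Ed u v

maxL : List ℕ → ℕ
maxL = foldr _⊔_ 0

headD : ℕ → List ℕ → ℕ
headD d []      = d
headD d (x ∷ _) = x

largerNbrs : List ℕ → List (ℕ × ℕ) → ℕ → List ℕ
largerNbrs Vs Ed v = filterᵇ (λ w → (v <ᵇ w) ∧ adjT Ed v w) Vs

record IsDecSubtree (G : Graph) (Vs : List ℕ) (Ed : List (ℕ × ℕ)) : Set where
  field
    nonempty  : 1 ≤ length Vs
    V-canon   : Linked _<_ Vs
    Ed-orient : All (λ e → proj₁ e < proj₂ e) Ed
    Ed-canon  : Linked _<ₑ_ Ed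
    subgraph  : All (λ e → (proj₁ e ∈ Vs) × (proj₂ e ∈ Vs) × (E G (proj₁ e) (proj₂ e) ≡ true)) Ed
    connected : ∀ u v → u ∈ Vs → v ∈ Vs → Reach Ed u v
    acyclic   : ∀ (k : Fin (length Ed)) →
                  ¬ Reach (removeAt Ed k) (proj₁ (lookup Ed k)) (proj₂ (lookup Ed k))
    decreasing : ∀ v → v ∈ Vs → v ≢ maxL Vs → length (largerNbrs Vs Ed v) ≡ 1

IsComposition : List ℕ → ℕ → Set
IsComposition α k = All (1 ≤_) α × sum α ≡ k

IsTreeTriple : Graph → TreeTriple → Set
IsTreeTriple G t = IsDecSubtree G (V t) (Ed t) × IsComposition (α t) (length (V t))
                   × (1 ≤ r t × r t ≤ headD 0 (α t))

IsForestTriple : Graph → Forest → Set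
IsForestTriple G F = All (IsTreeTriple G) F
                   × (concat (map V F) ↭ applyUpTo suc (n G))
                   × Linked _<_ (map (λ t → headD 0 (V t)) F)

Simple : Forest → Set
Simple []      = ⊤
Simple (t ∷ _) = r t ≡ 1

SimpleFT : Graph → Forest → Set
SimpleFT G F = IsForestTriple G F × Simple F

Atom : Forest → Set
Atom = All (λ t → length (α t) ≡ 1)

-- list(T): start at the smallest vertex, repeatedly read the smallest
-- unread vertex adjacent in T to an already read vertex.

nextV : List ℕ → List (ℕ × ℕ) → List ℕ → List ℕ
nextV Vs Ed rd = filterᵇ (λ v → not (memB v rd) ∧ any (λ u → adjT Ed u v) rd) Vs

readT : ℕ → List ℕ → List (ℕ × ℕ) → List ℕ → List ℕ
readT zero    Vs Ed rd = rd
readT (suc f) Vs Ed rd with nextV Vs Ed rd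
... | []    = rd
... | v ∷ _ = readT f Vs Ed (rd ++ [ v ])

minL : List ℕ → List ℕ
minL [] = []
minL (x ∷ xs) = [ foldr Data.Nat._⊓_ x xs ]

listT : TreeTriple → List ℕ
listT t = readT (length (V t)) (V t) (Ed t) (minL (V t))

invG : Graph → List ℕ → ℕ
invG G []       = 0
invG G (x ∷ xs) = length (filterᵇ (λ y → (y <ᵇ x) ∧ E G y x) xs) + invG G xs

open module SortNat = Data.List.Sort ≤-decTotalOrder using (sort)

type : Forest → List ℕ
type F = sort (concat (map α F))

sgn : ℕ → ℤ
sgn zero    = + 1
sgn (suc k) = - sgn k

sign : Forest → ℤ
sign F = sgn (sum (map (λ t → length (α t) ∸ 1) F))

weight : Graph → Forest → ℕ
weight G F = invG G (concat (map listT F)) + sum (map (λ t → r t ∸ 1) F)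

α11 : Forest → ℕ
α11 []      = 0
α11 (t ∷ _) = headD 0 (α t)

-- nice involution (a map on raw forests; only its values on simple
-- forest triples of G matter)
record NiceInvolution (G : Graph) (φ : Forest → Forest) : Set where
  field
    closed : ∀ F → SimpleFT G F → SimpleFT G (φ F)
    invol  : ∀ F → SimpleFT G F → φ (φ F) ≡ F
    pres-type   : ∀ F → SimpleFT G F → type (φ F) ≡ type F
    pres-weight : ∀ F → SimpleFT G F → weight G (φ F) ≡ weight G F
    pres-α11    : ∀ F → SimpleFT G F → α11 (φ F) ≡ α11 F
    fixed-atom  : ∀ F → SimpleFT G F → φ F ≡ F → Atom F
    sign-rev    : ∀ F → SimpleFT G F → φ F ≢ F → sign (φ F) ≡ - sign F

-- Restriction F|_{≥ n₁} and seg_{[n₁]}(F)   (indices below are 0-based)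

emptyT : TreeTriple
emptyT = tt [] [] [] 0

getT : Forest → ℕ → TreeTriple
getT []      _       = emptyT
getT (t ∷ F) zero    = t
getT (t ∷ F) (suc i) = getT F i

idxOf : ℕ → Forest → ℕ
idxOf v []      = 0
idxOf v (t ∷ F) = if memB v (V t) then 0 else suc (idxOf v F)

meets : ℕ → TreeTriple → Bool
meets n₁ t = any (λ x → (1 ≤ᵇ x) ∧ (x ≤ᵇ n₁)) (V t)

-- largest index (0-based) of a tree in the list meeting [n₁] (0 if none)
lastMeet : ℕ → Forest → ℕ
lastMeet n₁ []      = 0
lastMeet n₁ (t ∷ F) = if any (meets n₁) F then suc (lastMeet n₁ F) else 0

idx' : ℕ → Forest → ℕ
idx' n₁ F = idxOf n₁ F + lastMeet n₁ (drop (idxOf n₁ F) F)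

kOf : ℕ → TreeTriple → ℕ
kOf n₁ t = length (filterᵇ (λ x → (1 ≤ᵇ x) ∧ (x ≤ᵇ n₁)) (V t))

-- j with α₁+…+α_{j-1} < k ≤ α₁+…+α_j   (1-based)
segIdx : ℕ → List ℕ → ℕ
segIdx k []       = 0
segIdx k (a ∷ as) = if k ≤ᵇ a then 1 else suc (segIdx (k ∸ a) as)

restAlpha : ℕ → List ℕ → List ℕ
restAlpha k []       = []
restAlpha k (a ∷ as) = if k ≤ᵇ a then (a ∸ k + 1) ∷ as else restAlpha (k ∸ a) as

segT : ℕ → TreeTriple → ℕ
segT n₁ t = segIdx (kOf n₁ t) (α t)

segF : ℕ → Forest → ℕ
segF n₁ F = segT n₁ (getT F i)
          + sum (map (λ t → length (α t)) (take i F))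
          + sum (map (λ t → length (α t)) (take (i' ∸ i) (drop (suc i) F)))
  where i  = idxOf n₁ F
        i' = idx' n₁ F

shiftT : ℕ → TreeTriple → TreeTriple
shiftT x t = tt (map (_∸ x) (V t)) (map (λ e → (proj₁ e ∸ x , proj₂ e ∸ x)) (Ed t)) (α t) (r t)

restrictT : ℕ → TreeTriple → TreeTriple
restrictT n₁ t = tt (filterᵇ (n₁ ≤ᵇ_) (V t))
                    (filterᵇ (λ e → (n₁ ≤ᵇ proj₁ e) ∧ (n₁ ≤ᵇ proj₂ e)) (Ed t))
                    (restAlpha (kOf n₁ t) (α t)) 1

restrict : ℕ → Forest → Forest
restrict n₁ F = shiftT (n₁ ∸ 1) (restrictT n₁ (getT F (idxOf n₁ F)))
              ∷ map (shiftT (n₁ ∸ 1)) (drop (suc (idx' n₁ F)) F)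

FixedCond : ℕ → ℕ → (Forest → Forest) → Forest → Set
FixedCond a ε φ' F =
    Atom F
  × φ' (restrict a F) ≡ restrict a F
  × segF a F ≤ 2
  × (memB 1 (V Ti) ≡ false → a ∸ ε ≤ r Ti)
  × (memB 1 (V Ti) ≡ true → a ≤ length (V Ti))
  where Ti = getT F (idxOf a F)

{-# OPTIONS --safe #-}
-- A simple forest triple F of K a ε ⊕ G' is the same as a pair consisting of its restriction R = F|≥a and a
-- "skeleton" x recording the trees meeting [a].  Decreasing trees on a complete graph correspond, by their
-- reading words, to the words starting with their least letter; the concatenated reading words, with a removed,
-- form a permutation of [a-1], which x stores as a Lehmer code.  The weight of F becomes the weight of R plus the
-- sum of all entries of x, and on compositions x sees only the part b with which R begins.
--
-- If φ' moves R, then φ applies φ' to R, which keeps b.  If R is fixed, φ acts on x alone.  Trees following the tree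
-- that contains a are merged or split at their last composition part until at most one, an atom, remains; a tree
-- preceding it is set aside, recursively, until what follows it is fixed.  The fixed configurations are recoded by
-- a bijection between two unions of rectangles (Out below), after which the remaining
-- configurations depend only on a composition and two or three integers (Shape), and cancel by the four moves Step.
module Submission where

open import Defs
open import Data.Bool using (Bool; true; false; _∧_; _∨_; not; if_then_else_; T)
open import Data.Nat using (ℕ; zero; suc; _+_; _∸_; _≤_; _<_; _⊔_; _⊓_; _≤ᵇ_; _<ᵇ_; _≡ᵇ_; z≤n; s≤s; _≤?_; _<?_; _≟_)
open import Data.Nat.Properties
open import Data.Fin using (Fin; zero; suc)
open import Data.List.Base using (List; []; _∷_; _++_; length; map; concat; foldr; filterᵇ; take; drop; reverse; lookup; removeAt; applyUpTo)
open import Data.List.Properties hiding (sum-++)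
open import Data.Bool.ListAction using (any)
open import Data.Nat.ListAction using (sum)
open import Data.Nat.ListAction.Properties using (sum-++; sum-↭)
open import Data.List.Membership.Propositional using (_∈_; _∉_)
open import Data.List.Membership.Propositional.Properties using (∈-++⁺ˡ; ∈-++⁺ʳ; ∈-++⁻; ∈-map⁺; ∈-map⁻; ∈-∃++; ∈-insert)
open import Data.List.Relation.Unary.Any using (here; there)
open import Data.List.Relation.Unary.All as All using (All; []; _∷_)
import Data.List.Relation.Unary.All.Properties as Allₚ
open import Data.List.Relation.Unary.AllPairs as AllPairs using (AllPairs; []; _∷_)
import Data.List.Relation.Unary.AllPairs.Properties as AllPairsₚ
open import Data.List.Relation.Unary.Linked as Linked using (Linked; []; [-]; _∷_)
import Data.List.Relation.Unary.Linked.Properties as Linkedₚ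
open import Data.List.Relation.Binary.Permutation.Propositional using (_↭_; ↭-refl; ↭-sym; ↭-trans; ↭-prep; ↭-swap; ↭-reflexive)
import Data.List.Relation.Binary.Permutation.Propositional.Properties as Perm
open import Data.Product using (Σ; ∃; _×_; _,_; proj₁; proj₂)
open import Data.Sum using (_⊎_; inj₁; inj₂; [_,_]′)
open import Data.Empty using (⊥; ⊥-elim)
open import Data.Unit using (⊤) renaming (tt to unit)
open import Function using (_∘_; id; case_of_)
open import Relation.Binary.Definitions using (tri<; tri≈; tri>)
open import Relation.Nullary using (¬_; Dec; yes; no)
open import Relation.Binary.PropositionalEquality using (_≡_; _≢_; refl; sym; trans; cong; cong₂; subst; subst₂)
open import Data.List.Sort ≤-decTotalOrder using (sort; sort-↭; sort-↗)
open import Data.List.Membership.DecPropositional _≟_ using (_∈?_)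
open import Data.Integer using (-_)
open import Data.Integer.Properties using (neg-involutive)
import Data.Product.Properties as Productₚ
open import Relation.Nullary.Decidable using (map′; _×-dec_)
open import Relation.Binary.Definitions using (DecidableEquality)
open import Data.Nat.Solver using (module +-*-Solver)
open +-*-Solver using (solve; _:+_; _:=_; con)

-- Blocks, codes and the merging of trailing trees

-- When two trees merge, the second word no longer has to start with its least letter, so one more
-- Lehmer digit becomes free. The `r` of an atom (one less than r_t) has just the range of that
-- digit. This is why codes are stored, and why only an atom is merged: with more parts `r` would
-- range over the first part only. The tree containing `a` resists this scheme, since its last part
-- reaches into `G'` and must stay at least `b`. On `m` letters, with `c < b` and `c + c' = m + b`,
-- the survivors have either `r < c'` and `c ≤ t < m`, or `r < c` and `m ≤ t < c'`; both numbers
-- enter the weight through `r + t`. The two areas add up to c'(m - c) + c(c' - m) = m(c' - c), the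
-- area of `c ≤ t < c'` times `m` values of a head digit. After this recoding a survivor carries a
-- complete Lehmer code of its `m` letters, which continues the code of the tree before it, so it
-- can be treated much like a trailing atom. The missing edge {1,a} restricts the first tree only;
-- hence the recursion runs with `ε = 0`.

balance : ∀ {x y p q : ℕ} → p ≡ q → x + q ≡ y + p → x ≡ y
balance {x} {y} {p} refl e = +-cancelʳ-≡ p x y e

-- These three lemmas check certificates for linear arithmetic: the hypotheses are added up to
-- `p ≡ q` or `p ≤ q`, `k` is the slack that remains, and the ring solver supplies the final
-- identity.
balance-slack : ∀ {x y p q} k → p ≤ q → x + q + k ≡ y + p → x ≤ y
balance-slack {x} {y} {p} {q} k le e = +-cancelʳ-≤ p x y (≤-trans (+-monoʳ-≤ x le) (≤-trans (m≤m+n (x + q) k) (≤-reflexive e)))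

balance-≤ : ∀ {x y p q} → p ≤ q → x + q ≡ y + p → x ≤ y
balance-≤ {x} {y} {p} {q} le e = +-cancelʳ-≤ p x y (≤-trans (+-monoʳ-≤ x le) (≤-reflexive e))

-- Contradictions are derived in the form `1 ≤ 0`, so that the same certificates produce them.
absurd : {X : Set} → 1 ≤ 0 → X
absurd ()

split-unique : ∀ {A : Set} (as bs : List A) {cs ds} → length cs ≡ length ds →
               as ++ cs ≡ bs ++ ds → as ≡ bs × cs ≡ ds
split-unique [] [] l e = refl , e
split-unique [] (b ∷ bs) {ds = ds} l refl = absurd (balance-slack (length bs) (+-mono-≤ (≤-reflexive (sym (length-++ bs {ds}))) (≤-reflexive l)) (solve 3 (λ i j k → con 1 :+ (k :+ j) :+ i := con 0 :+ (i :+ j :+ (con 1 :+ k))) refl (length bs) (length ds) (length (bs ++ ds))))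
split-unique (a ∷ as) [] {cs} l refl = absurd (balance-slack (length as) (+-mono-≤ (≤-reflexive (sym (length-++ as {cs}))) (≤-reflexive (sym l))) (solve 3 (λ i j k → con 1 :+ (k :+ j) :+ i := con 0 :+ (i :+ j :+ (con 1 :+ k))) refl (length as) (length cs) (length (as ++ cs))))
split-unique (a ∷ as) (b ∷ bs) l e with ∷-injective e
... | refl , e' with split-unique as bs l e'
... | refl , q = refl , q

split-at : ∀ {A : Set} k (xs : List A) → k ≤ length xs →
           ∃ λ as → ∃ λ bs → xs ≡ as ++ bs × length as ≡ k
split-at k xs le = take k xs , drop k xs , sym (take++drop≡id k xs) , trans (length-take k xs) (m≤n⇒m⊓n≡m le)

split-end : ∀ {A : Set} k (xs : List A) → k ≤ length xs →
            ∃ λ as → ∃ λ bs → xs ≡ as ++ bs × length bs ≡ k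
split-end k xs le with split-at (length xs ∸ k) xs (m∸n≤m (length xs) k)
... | as , bs , refl , p = as , bs , refl ,
  balance (cong₂ _+_ (sym p) (cong₂ _+_ (sym (length-++ as {bs})) (sym (m∸n+n≡m le)))) (solve 5 (λ i j k l m → i :+ (l :+ (m :+ (k :+ j))) := j :+ (k :+ (l :+ i :+ m))) refl (length bs) k (length (as ++ bs) ∸ k) (length as) (length (as ++ bs)))

-- m is the number of letters still available when the code is read.
IsCode : ℕ → List ℕ → Set
IsCode m       []       = ⊤
IsCode zero    (c ∷ cs) = ⊥
IsCode (suc m) (c ∷ cs) = c ≤ m × IsCode m cs

code-++⁺ : ∀ {n} cs {ds} → IsCode (length cs + n) cs → IsCode n ds → IsCode (length cs + n) (cs ++ ds)
code-++⁺ []       p       q = q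
code-++⁺ (c ∷ cs) (p , r) q = p , code-++⁺ cs r q

code-++⁻ : ∀ {n} cs {ds} → IsCode (length cs + n) (cs ++ ds) → IsCode (length cs + n) cs × IsCode n ds
code-++⁻ []       q       = _ , q
code-++⁻ (c ∷ cs) (p , q) with code-++⁻ cs q
... | r , s = (p , r) , s

-- Compositions are stored in reverse, so the first part is the last entry.
firstPart : List ℕ → ℕ
firstPart []          = 0
firstPart (x ∷ [])    = x
firstPart (x ∷ y ∷ l) = firstPart (y ∷ l)

record Block : Set where
  constructor blk
  field
    rb    : ℕ
    parts : List ℕ
    code  : List ℕ

WellFormed : ℕ → List ℕ → Set
WellFormed r α = All (1 ≤_) α × r < firstPart α

data ValidTail : ℕ → List Block → Set where
  []  : ValidTail 0 []
  _∷_ : ∀ {n m r α cs ys} →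
        WellFormed r α × sum α ≡ suc (length cs) × IsCode (length cs + n) cs × m ≡ suc (length cs + n) →
        ValidTail n ys → ValidTail m (blk r α cs ∷ ys)

partsOf : List Block → List ℕ
partsOf ys = concat (map Block.parts ys)

cuts : List ℕ → ℕ
cuts α = length α ∸ 1

tailCuts : List Block → ℕ
tailCuts ys = sum (map (λ y → cuts (Block.parts y)) ys)

tailWeight : List Block → ℕ
tailWeight []                 = 0
tailWeight (blk r α cs ∷ ys) = r + sum cs + tailWeight ys

-- Sign reversal in a form symmetric in both arguments, so that a move and its inverse share one
-- proof.
Flip : ℕ → ℕ → Set
Flip i j = (j ≡ suc i) ⊎ (i ≡ suc j)

Flip-sym : ∀ {i j} → Flip i j → Flip j i
Flip-sym (inj₁ e) = inj₂ e
Flip-sym (inj₂ e) = inj₁ e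

Flip-+ˡ : ∀ k {i j} → Flip i j → Flip (k + i) (k + j)
Flip-+ˡ k {i} (inj₁ refl) = inj₁ (+-suc k i)
Flip-+ˡ k {_} {j} (inj₂ refl) = inj₂ (+-suc k j)

-- The parameter `r₂` of the atom lies between 0 and `length ds`, exactly the range of a Lehmer
-- digit in front of `ds`. It becomes the digit of the letter that replaces the forced first letter
-- of the second word, and the inversions gain what the parameter loses.
data Merge : List Block → List Block → Set where
  here  : ∀ {r₁ α cs r₂ c ds} → sum α ≡ suc (length cs) → c ≡ suc (length ds) → 
          Merge (blk r₁ α cs ∷ blk r₂ (c ∷ []) ds ∷ []) (blk r₁ (c ∷ α) (cs ++ r₂ ∷ ds) ∷ [])
  there : ∀ {y ys zs} → Merge ys zs → Merge (y ∷ ys) (y ∷ zs)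

TailMatch : List Block → List Block → Set
TailMatch ys zs = Merge ys zs ⊎ Merge zs ys

-- For a single atom `r ∷ cs` is itself a Lehmer code of all `c` letters, with `r` in the role of
-- the first digit; its sum is the contribution to the weight.
data Reduced : List Block → ℕ → List ℕ → Set where
  none : Reduced [] 0 []
  one  : ∀ {r cs c} → c ≡ suc (length cs) → Reduced (blk r (c ∷ []) cs ∷ []) c (r ∷ cs)

-- Inversion with the target kept as an equation, because the append in the index of `here` blocks
-- direct matching.
merge-target : ∀ {x z} → Merge x z → ∀ {r c α es} → z ≡ blk r (c ∷ α) es ∷ [] →
               ∃ λ cs → ∃ λ r₂ → ∃ λ ds → x ≡ blk r α cs ∷ blk r₂ (c ∷ []) ds ∷ [] × es ≡ cs ++ r₂ ∷ ds ×
                 c ≡ suc (length ds)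
merge-target (here p q) refl = _ , _ , _ , refl , refl , q
merge-target (there ()) refl

merge-det : ∀ {x y z} → Merge x y → Merge x z → y ≡ z
merge-det (here _ _) (here _ _) = refl
merge-det (there p) (there q) = cong (_ ∷_) (merge-det p q)
merge-det (here _ _) (there (there ()))
merge-det (there (there ())) (here _ _)

-- The last part `c` is the length of the suffix contributed by the atom, so the place to cut the
-- merged code is forced.
merge-inj : ∀ {x y z} → Merge x z → Merge y z → x ≡ y
merge-inj (here {cs = cs} p q) w with merge-target w refl
... | cs' , r₂ , ds , refl , e , q' with split-unique cs cs' (trans (sym q) q') e
... | refl , refl = refl
merge-inj (there p) (there q) = cong (_ ∷_) (merge-inj p q)
merge-inj (there ()) (here p q)

-- After a merge the last block has at least two parts, whereas a list that can be merged ends in an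
-- atom. Hence merges never chain, and their symmetric closure is a matching.
merge-disj : ∀ {x y z} → Merge x y → Merge y z → ⊥
merge-disj (here _ _) (there ())
merge-disj (there p) (there q) = merge-disj p q
merge-disj (there (there ())) (here _ _)

merge-reduced : ∀ {x y c es} → TailMatch x y → Reduced x c es → ⊥
merge-reduced (inj₁ ()) none
merge-reduced (inj₁ (there ())) (one _)
merge-reduced (inj₂ p) (one _) with merge-target p refl
merge-reduced (inj₂ (here () _)) (one _) | _ , _ , _ , refl , _

tailMatch-unique : ∀ {x y z} → TailMatch x y → TailMatch x z → y ≡ z
tailMatch-unique (inj₁ p) (inj₁ q) = merge-det p q
tailMatch-unique (inj₁ p) (inj₂ q) = ⊥-elim (merge-disj q p)
tailMatch-unique (inj₂ p) (inj₁ q) = ⊥-elim (merge-disj p q)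
tailMatch-unique (inj₂ p) (inj₂ q) = merge-inj p q

reduced-unique : ∀ {ys c d es fs} → Reduced ys c es → Reduced ys d fs → c ≡ d × es ≡ fs
reduced-unique none none = refl , refl
reduced-unique (one _) (one _) = refl , refl

reduced-inj : ∀ {ys zs c es} → Reduced ys c es → Reduced zs c es → ys ≡ zs
reduced-inj none none = refl
reduced-inj (one _) (one _) = refl

reduced-length : ∀ {ys c es} → Reduced ys c es → length es ≡ c
reduced-length none = refl
reduced-length (one e) = sym e

-- The last block decides: with two or more parts its last part is split off, as an atom with a
-- predecessor it is merged, and as a lone atom it is the reduced case.
tail-total : ∀ {n ys} → ValidTail n ys →
  (∃ λ c → ∃ λ es → Reduced ys c es) ⊎ (∃ λ zs → TailMatch ys zs × ValidTail n zs)
tail-total [] = inj₁ (_ , _ , none)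
tail-total (_∷_ {α = []} ((_ , ()) , _) [])
tail-total (_∷_ {α = c ∷ []} (_ , s , _) []) = inj₁ (_ , _ , one (trans (sym (+-identityʳ c)) s))
tail-total (_∷_ {m = k} {r = r} {α = c ∷ d ∷ α} {cs = cs} ((c≥1 ∷ d≥1 ∷ pos , r<) , s , code , m) [])
  -- The other parts add up to at least 1 and all parts to `1 + length cs`, so the code is long
  -- enough to give up `c` digits.
  with split-end c cs (balance-slack (sum α) (+-mono-≤ (≤-reflexive s) d≥1) (solve 4 (λ i j k l → i :+ (con 1 :+ j :+ k) :+ l := j :+ (i :+ (k :+ l) :+ con 1)) refl c (length cs) d (sum α)))
... | cs₀ , [] , refl , refl = absurd c≥1
-- The first digit of the suffix turns into the parameter of the new tree.
... | cs₀ , r₂ ∷ ds , refl , refl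
  with code-++⁻ cs₀ (subst (λ k → IsCode k (cs₀ ++ r₂ ∷ ds)) (trans (+-identityʳ _) (length-++ cs₀)) code)
... | code₀ , r₂≤ , code₂ = inj₂ (_ , inj₂ (here s' refl) ,
        (((d≥1 ∷ pos , r<) , s' , code₀ , balance (cong₂ _+_ m (length-++ cs₀ {r₂ ∷ ds})) (solve 4 (λ i j k l → i :+ (con 1 :+ (l :+ con 0) :+ (j :+ (con 1 :+ k))) := con 1 :+ (j :+ (con 1 :+ k)) :+ (i :+ l)) refl k (length cs₀) (length ds) (length (cs₀ ++ r₂ ∷ ds)))) ∷
        (((c≥1 ∷ []) , s≤s r₂≤) , +-identityʳ _ , subst (λ k → IsCode k ds) (sym (+-identityʳ _)) code₂ , cong suc (sym (+-identityʳ _))) ∷ []))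
  where
  s' : sum (d ∷ α) ≡ suc (length cs₀)
  s' = balance (cong₂ _+_ s (length-++ cs₀ {r₂ ∷ ds})) (solve 5 (λ i j k l m → i :+ j :+ (con 1 :+ m :+ (k :+ (con 1 :+ l))) := con 1 :+ k :+ (con 1 :+ (l :+ (i :+ j)) :+ m)) refl d (sum α) (length cs₀) (length ds) (length (cs₀ ++ r₂ ∷ ds)))
tail-total (_∷_ {n = k} {r = r} {α = α} {cs = cs} ((pos , r<) , s , code , refl) vs@(_ ∷ _)) with tail-total vs
... | inj₂ (zs , mt , vz) = inj₂ (_ , thereM mt , ((pos , r<) , s , code , refl) ∷ vz)
  where
  thereM : ∀ {y ys zs} → TailMatch ys zs → TailMatch (y ∷ ys) (y ∷ zs)
  thereM (inj₁ p) = inj₁ (there p)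
  thereM (inj₂ p) = inj₂ (there p)
... | inj₁ (c , es , one {r₂} {ds} refl) with vs
... | ((_ , s≤s r₂≤) , _ , code₂ , e) ∷ [] = inj₂ (_ , inj₁ (here s refl) ,
  ((s≤s z≤n ∷ pos , first α r< s) , balance (cong₂ _+_ s (sym (length-++ cs {r₂ ∷ ds}))) (solve 4 (λ i j k l → con 1 :+ (i :+ j) :+ (con 1 :+ l :+ k) := con 1 :+ k :+ (j :+ (l :+ (con 1 :+ i)))) refl (length ds) (sum α) (length (cs ++ r₂ ∷ ds)) (length cs)) ,
   subst (λ k → IsCode k (cs ++ r₂ ∷ ds)) (balance (cong₂ _+_ e (sym (length-++ cs {r₂ ∷ ds}))) (solve 4 (λ i j k l → i :+ j :+ (con 1 :+ (l :+ con 0) :+ k) := k :+ con 0 :+ (j :+ (i :+ (con 1 :+ l)))) refl (length cs) k (length (cs ++ r₂ ∷ ds)) (length ds)))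
     (code-++⁺ cs code (subst (λ k → IsCode k (r₂ ∷ ds)) (sym e) (balance-≤ r₂≤ (solve 2 (λ i j → i :+ j := j :+ con 0 :+ i) refl r₂ (length ds)) , code₂))) , balance (cong₂ _+_ e (sym (length-++ cs {r₂ ∷ ds}))) (solve 4 (λ i j k l → con 1 :+ (i :+ j) :+ (con 1 :+ (l :+ con 0) :+ k) := con 1 :+ (k :+ con 0) :+ (j :+ (i :+ (con 1 :+ l)))) refl (length cs) k (length (cs ++ r₂ ∷ ds)) (length ds))) ∷ [])
  where
  first : ∀ {r c k} α → r < firstPart α → sum α ≡ suc k → r < firstPart (c ∷ α)
  first (_ ∷ _) p _ = p

record Stats (ℓ ℓ' : ℕ) (ps ps' : List ℕ) (w w' : ℕ) : Set where
  constructor stats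
  field
    flip   : Flip ℓ ℓ'
    parts↭ : ps ↭ ps'
    weight≡ : w ≡ w'

Stats-sym : ∀ {ℓ ℓ' ps ps' w w'} → Stats ℓ ℓ' ps ps' w w' → Stats ℓ' ℓ ps' ps w' w
Stats-sym (stats f p w) = stats (Flip-sym f) (↭-sym p) (sym w)

merge-stats : ∀ {ys zs} → Merge ys zs → Stats (tailCuts ys) (tailCuts zs) (partsOf ys) (partsOf zs) (tailWeight ys) (tailWeight zs)
merge-stats (here {r₁} {x ∷ α} {cs} {r₂} {c} {ds} _ _) =
  stats (inj₁ refl) (↭-trans (Perm.++-comm (x ∷ α) (c ∷ [])) (↭-reflexive (sym (++-identityʳ _))))
    (balance (sym (sum-++ cs (r₂ ∷ ds))) (solve 5 (λ i j k l m → i :+ j :+ (k :+ l :+ con 0) :+ m := i :+ m :+ con 0 :+ (j :+ (k :+ l))) refl r₁ (sum cs) r₂ (sum ds) (sum (cs ++ r₂ ∷ ds))))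
merge-stats (there {blk r α cs} p) with merge-stats p
... | stats f p w = stats (Flip-+ˡ (cuts α) f) (Perm.++⁺ˡ α p) (cong (r + sum cs +_) w)

tail-stats : ∀ {ys zs} → TailMatch ys zs → Stats (tailCuts ys) (tailCuts zs) (partsOf ys) (partsOf zs) (tailWeight ys) (tailWeight zs)
tail-stats (inj₁ p) = merge-stats p
tail-stats (inj₂ p) = Stats-sym (merge-stats p)

tail-sym : ∀ {ys zs} → TailMatch ys zs → TailMatch zs ys
tail-sym (inj₁ p) = inj₂ p
tail-sym (inj₂ p) = inj₁ p

-- The composition of a trailing atom on `c` vertices, where 0 means that no tree follows.
positive : ℕ → List ℕ
positive zero    = []
positive (suc c) = suc c ∷ []

reduced-stats : ∀ {ys c es} → Reduced ys c es →
  tailCuts ys ≡ 0 × partsOf ys ≡ positive c × tailWeight ys ≡ sum es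
reduced-stats none = refl , refl , refl
reduced-stats (one {r} {cs} refl) = refl , refl , +-identityʳ (r + sum cs)

-- Cancellation of skeletons

-- The trees meeting [a] in order: a tree avoiding a (before), then the tree containing a (special, or alone if a is its
-- only vertex in [a]) followed by the trees ys.  Here r is r_t - 1, cs is the Lehmer code of the reading word after its
-- first letter and without a, t counts the vertices below a that are read after a, and α is cut off after the part
-- containing a, so that its last part is at least b.
data Skeleton : Set where
  alone : (r : ℕ) → Skeleton
  special : (r : ℕ) (α cs : List ℕ) (t : ℕ) (ys : List Block) → Skeleton
  before : (r : ℕ) (α cs : List ℕ) (x : Skeleton) → Skeleton

-- PA: the tree containing a comes first, with composition α, and is followed by an atom with c vertices (none if c = 0).
-- PB: a tree with composition α is followed by a configuration in the form Out with parameters c, c' and t.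
data Shape : Set where
  PA : (α : List ℕ) (c t : ℕ) → Shape
  PB : (α : List ℕ) (c c' t : ℕ) → Shape

-- Cancellation of shapes by four moves

module Skeletons (b : ℕ) (b≥1 : 1 ≤ b) where

  -- `m` is the number of letters below `a`; the parts add up to `m + b` because the part containing
  -- `a` also covers `a` and the `b - 1` vertices after it. In `vA`, `c ≤ t` since the trailing atom
  -- is read after `a`, and `ε + t < m` since the least letter is read before `a`, followed by
  -- another one if the edge is missing. In `vB` the bounds are those of the recoding rectangle.
  data ValidShape (ε m : ℕ) : Shape → Set where
    vA : ∀ {g l c t} → All (1 ≤_) (g ∷ l) → b ≤ g → sum (g ∷ l) + c ≡ m + b → c ≤ t → ε + t < m →
         ValidShape ε m (PA (g ∷ l) c t)
    vB : ∀ {d l c c' t} → All (1 ≤_) (d ∷ l) → sum (d ∷ l) + c + c' ≡ m + b → c < b → b ≤ c' → c ≤ t → t < c' →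
         ValidShape ε m (PB (d ∷ l) c c' t)

  -- For an atom with `m = a - 1` the bound `c < b` says |V(T_i)| ≥ a, and the bound `m ≤ ε + t`
  -- says r_i ≥ a - ε.
  data Fixed (ε m : ℕ) : Shape → Set where
    fixA : ∀ {g c t} → c < b → Fixed ε m (PA (g ∷ []) c t)
    fixB : ∀ {d c' t} → m ≤ ε + t → Fixed ε m (PB (d ∷ []) 0 c' t)

  -- Each move adds one part to the composition of the first tree, hence changes the sign.
  data Step (ε m : ℕ) : Shape → Shape → Set where
    append : ∀ {g l c t} → b ≤ c → b ≤ g → c ≤ t → Step ε m (PA (g ∷ l) c t) (PA (c ∷ g ∷ l) 0 t)
    insert : ∀ {g e l c t} → 1 ≤ c → c < b → c ≤ t → Step ε m (PA (g ∷ e ∷ l) c t) (PA (g ∷ c ∷ e ∷ l) 0 t)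
    absorb : ∀ {e l c c' t} → 1 ≤ c → c < b → c ≤ t → Step ε m (PB (e ∷ l) c c' t) (PB (c ∷ e ∷ l) 0 c' t)
    join   : ∀ {d l c' t} → t < c' → ε + t < m → (l ≡ [] ⊎ (b ≤ d ⊎ t < d)) →
             Step ε m (PB (d ∷ l) 0 c' t) (PA (c' ∷ d ∷ l) 0 t)

  ShapeMatch : ℕ → ℕ → Shape → Shape → Set
  ShapeMatch ε m P Q = Step ε m P Q ⊎ Step ε m Q P

  module _ {ε m : ℕ} where
    step-det : ∀ {P Q R} → Step ε m P Q → Step ε m P R → Q ≡ R
    step-det (append _ _ _) (append _ _ _) = refl
    step-det (append p _ _) (insert _ q _) = ⊥-elim (<⇒≱ q p)
    step-det (insert _ q _) (append p _ _) = ⊥-elim (<⇒≱ q p)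
    step-det (insert _ _ _) (insert _ _ _) = refl
    step-det (absorb _ _ _) (absorb _ _ _) = refl
    step-det (absorb () _ _) (join _ _ _)
    step-det (join _ _ _) (absorb () _ _)
    step-det (join _ _ _) (join _ _ _) = refl

    -- The side conditions keep the targets apart. `PA (x ∷ y ∷ l) 0 t` comes from `append` if
    -- `y ≥ b` and `x ≤ t`, from `insert` if `y < b`, `y ≤ t` and `l` is nonempty, and from `join`
    -- only otherwise; the targets of `absorb` alone are of the form `PB`.
    step-inj : ∀ {P Q R} → Step ε m P R → Step ε m Q R → P ≡ Q
    step-inj (append _ _ _) (append _ _ _) = refl
    step-inj (append _ p _) (insert _ q _) = ⊥-elim (<⇒≱ q p)
    step-inj (append _ _ p) (join q _ _)   = ⊥-elim (<⇒≱ q p)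
    step-inj (insert _ q _) (append _ p _) = ⊥-elim (<⇒≱ q p)
    step-inj (insert _ _ _) (insert _ _ _) = refl
    step-inj (insert _ p _) (join _ _ (inj₂ (inj₁ q))) = ⊥-elim (<⇒≱ p q)
    step-inj (insert _ _ p) (join _ _ (inj₂ (inj₂ q))) = ⊥-elim (<⇒≱ q p)
    step-inj (absorb _ _ _) (absorb _ _ _) = refl
    step-inj (join q _ _) (append _ _ p)   = ⊥-elim (<⇒≱ q p)
    step-inj (join _ _ (inj₂ (inj₁ q))) (insert _ p _) = ⊥-elim (<⇒≱ p q)
    step-inj (join _ _ (inj₂ (inj₂ q))) (insert _ _ p) = ⊥-elim (<⇒≱ q p)
    step-inj (join _ _ _) (join _ _ _) = refl

    -- Every target has `c = 0`, where `append`, `insert` and `absorb` cannot start. `join` does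
    -- start there, but its last condition excludes the targets of `absorb`.
    step-disj : ∀ {P Q R} → Step ε m P Q → Step ε m Q R → ⊥
    step-disj (append _ _ _) (append p _ _) = absurd (balance-≤ (+-mono-≤ p b≥1) (solve 1 (λ i → con 1 :+ (con 0 :+ i) := con 0 :+ (i :+ con 1)) refl b))
    step-disj (append _ _ _) (insert () _ _)
    step-disj (insert _ _ _) (append p _ _) = absurd (balance-≤ (+-mono-≤ p b≥1) (solve 1 (λ i → con 1 :+ (con 0 :+ i) := con 0 :+ (i :+ con 1)) refl b))
    step-disj (insert _ _ _) (insert () _ _)
    step-disj (absorb _ _ _) (absorb () _ _)
    step-disj (absorb _ p _) (join _ _ (inj₂ (inj₁ q))) = ⊥-elim (<⇒≱ p q)
    step-disj (absorb _ _ p) (join _ _ (inj₂ (inj₂ q))) = ⊥-elim (<⇒≱ q p)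
    step-disj (join _ _ _) (append p _ _) = absurd (balance-≤ (+-mono-≤ p b≥1) (solve 1 (λ i → con 1 :+ (con 0 :+ i) := con 0 :+ (i :+ con 1)) refl b))
    step-disj (join _ _ _) (insert () _ _)

    shapeMatch-unique : ∀ {P Q R} → ShapeMatch ε m P Q → ShapeMatch ε m P R → Q ≡ R
    shapeMatch-unique (inj₁ p) (inj₁ q) = step-det p q
    shapeMatch-unique (inj₁ p) (inj₂ q) = ⊥-elim (step-disj q p)
    shapeMatch-unique (inj₂ p) (inj₁ q) = ⊥-elim (step-disj p q)
    shapeMatch-unique (inj₂ p) (inj₂ q) = step-inj p q

    fixed-unmatched : ∀ {P Q} → Fixed ε m P → ShapeMatch ε m P Q → ⊥
    fixed-unmatched (fixA p) (inj₁ (append q _ _)) = ⊥-elim (<⇒≱ p q)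
    fixed-unmatched (fixB p) (inj₁ (join _ q _)) = ⊥-elim (<⇒≱ q p)
    fixed-unmatched (fixA p) (inj₂ ())
    fixed-unmatched (fixB p) (inj₂ ())

    private
      Outcome : Shape → Set
      Outcome P = Fixed ε m P ⊎ (∃ λ Q → ShapeMatch ε m P Q × ValidShape ε m Q)

    -- A shape with `c > 0` moves forward unless `fixA` holds. With `c = 0` the leading parts tell
    -- which move has the shape as its target, and `join`, in one direction or the other, takes what
    -- is left.
    shape-total : ε ≤ 1 → ∀ {P} → ValidShape ε m P → Outcome P
    shape-total _ (vA {g} {[]} {zero} pos bg s ct tm) = inj₁ (fixA b≥1)
    shape-total _ (vA {g} {d ∷ l} {zero} {t} (g≥1 ∷ d≥1 ∷ pos) bg s ct tm) with b ≤? d | g ≤? t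
    ... | yes bd | yes gt = inj₂ (_ , inj₂ (append bg bd gt) , vA (d≥1 ∷ pos) bd (balance s (solve 5 (λ i j k l m → i :+ j :+ k :+ (l :+ m) := l :+ m :+ (k :+ (i :+ j) :+ con 0)) refl d (sum l) g m b)) gt tm)
    ... | yes bd | no gt = inj₂ (_ , inj₂ (join (≰⇒> gt) tm (inj₂ (inj₁ bd))) ,
                                  vB (d≥1 ∷ pos) (balance s (solve 5 (λ i j k l m → i :+ j :+ con 0 :+ k :+ (l :+ m) := l :+ m :+ (k :+ (i :+ j) :+ con 0)) refl d (sum l) g m b)) b≥1 bg z≤n (≰⇒> gt))
    shape-total _ (vA {g} {d ∷ []} {zero} {t} (g≥1 ∷ d≥1 ∷ pos) bg s ct tm) | no bd | _ =
      inj₂ (_ , inj₂ (join t<g tm (inj₁ refl)) , vB (d≥1 ∷ pos) (balance s (solve 4 (λ i j k l → i :+ con 0 :+ con 0 :+ j :+ (k :+ l) := k :+ l :+ (j :+ (i :+ con 0) :+ con 0)) refl d g m b)) b≥1 bg z≤n t<g)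
      where
      -- Here `g + d = m + b` with `d < b`, so `g > m > t`.
      t<g : t < g
      t<g = balance-slack (ε + 1) (+-mono-≤ (≤-reflexive (sym s)) (+-mono-≤ (≰⇒> bd) tm)) (solve 6 (λ i j k l m n → con 1 :+ i :+ (j :+ (m :+ con 0) :+ con 0 :+ (l :+ k)) :+ (n :+ con 1) := j :+ (k :+ l :+ (con 1 :+ m :+ (con 1 :+ (n :+ i))))) refl t g m b d ε)
    shape-total _ (vA {g} {d ∷ e ∷ l} {zero} {t} (g≥1 ∷ d≥1 ∷ pos) bg s ct tm) | no bd | _ with d ≤? t
    ... | yes dt = inj₂ (_ , inj₂ (insert d≥1 (≰⇒> bd) dt) , vA (g≥1 ∷ pos) bg (balance s (solve 6 (λ i j k l m n → i :+ (j :+ k) :+ l :+ (m :+ n) := m :+ n :+ (i :+ (l :+ (j :+ k)) :+ con 0)) refl g e (sum l) d m b)) dt tm)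
    ... | no dt = inj₂ (_ , inj₂ (join t<g tm (inj₂ (inj₂ (≰⇒> dt)))) , vB (d≥1 ∷ pos) (balance s (solve 6 (λ i j k l m n → i :+ (j :+ k) :+ con 0 :+ l :+ (m :+ n) := m :+ n :+ (l :+ (i :+ (j :+ k)) :+ con 0)) refl d e (sum l) g m b)) b≥1 bg z≤n t<g)
      where
      -- `t < d < b ≤ g`.
      t<g : t < g
      t<g = balance-slack 1 (+-mono-≤ (≰⇒> dt) (+-mono-≤ (≰⇒> bd) bg)) (solve 4 (λ i j k l → con 1 :+ i :+ (k :+ (l :+ j)) :+ con 1 := j :+ (con 1 :+ i :+ (con 1 :+ k :+ l))) refl t g d b)
    shape-total _ (vA {g} {l} {suc c} {t} (g≥1 ∷ pos) bg s ct tm) with b ≤? suc c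
    ... | yes bc = inj₂ (_ , inj₁ (append bc bg ct) , vA (s≤s z≤n ∷ g≥1 ∷ pos) bc (balance s (solve 5 (λ i j k l m → con 1 :+ (i :+ (j :+ k) :+ con 0) :+ (l :+ m) := l :+ m :+ (j :+ k :+ (con 1 :+ i))) refl c g (sum l) m b)) z≤n tm)
    shape-total _ (vA {g} {[]} {suc c} {t} (g≥1 ∷ pos) bg s ct tm) | no bc = inj₁ (fixA (≰⇒> bc))
    shape-total _ (vA {g} {e ∷ l} {suc c} {t} (g≥1 ∷ pos) bg s ct tm) | no bc =
      inj₂ (_ , inj₁ (insert (s≤s z≤n) (≰⇒> bc) ct) , vA (g≥1 ∷ s≤s z≤n ∷ pos) bg (balance s (solve 6 (λ i j k l m n → i :+ (con 1 :+ (j :+ (k :+ l))) :+ con 0 :+ (m :+ n) := m :+ n :+ (i :+ (k :+ l) :+ (con 1 :+ j))) refl g c e (sum l) m b)) z≤n tm)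
    shape-total _ (vB {d} {[]} {zero} {c'} {t} pos s cb bc ct tc) with suc (ε + t) ≤? m
    ... | no tm = inj₁ (fixB (≮⇒≥ tm))
    ... | yes tm = inj₂ (_ , inj₁ (join tc tm (inj₁ refl)) , vA (≤-trans b≥1 bc ∷ pos) bc (balance s (solve 4 (λ i j k l → i :+ (j :+ con 0) :+ con 0 :+ (k :+ l) := k :+ l :+ (j :+ con 0 :+ con 0 :+ i)) refl c' d m b)) z≤n tm)
    shape-total ε≤1 (vB {d} {e ∷ l} {zero} {c'} {t} (d≥1 ∷ e≥1 ∷ pos) s cb bc ct tc) with d <? b | d ≤? t
    ... | yes db | yes dt = inj₂ (_ , inj₂ (absorb d≥1 db dt) , vB (e≥1 ∷ pos) (balance s (solve 6 (λ i j k l m n → i :+ j :+ k :+ l :+ (m :+ n) := m :+ n :+ (k :+ (i :+ j) :+ con 0 :+ l)) refl e (sum l) d c' m b)) db bc dt tc)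
    ... | yes db | no dt = inj₂ (_ , inj₁ (join tc tm (inj₂ (inj₂ (≰⇒> dt)))) ,
                                  vA (≤-trans b≥1 bc ∷ d≥1 ∷ e≥1 ∷ pos) bc (balance s (solve 6 (λ i j k l m n → i :+ (j :+ (k :+ l)) :+ con 0 :+ (m :+ n) := m :+ n :+ (j :+ (k :+ l) :+ con 0 :+ i)) refl c' d e (sum l) m b)) z≤n tm)
      where
      -- `c' ≥ b` leaves at most `m` for the other parts, so `t < d ≤ m - e` and `t ≤ m - 2`; this
      -- is where `ε ≤ 1` enters.
      tm : ε + t < m
      tm = balance-slack (sum l) (+-mono-≤ ε≤1 (+-mono-≤ e≥1 (+-mono-≤ (≤-reflexive s) (+-mono-≤ (≰⇒> dt) bc)))) (solve 8 (λ i j k l m n o p → con 1 :+ (i :+ j) :+ (con 1 :+ (m :+ (k :+ p :+ (l :+ o)))) :+ n := k :+ (i :+ (con 1 :+ (l :+ (m :+ n) :+ con 0 :+ o :+ (con 1 :+ j :+ p))))) refl ε t m d e (sum l) c' b)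
    ... | no db | _ = inj₂ (_ , inj₁ (join tc tm (inj₂ (inj₁ (≮⇒≥ db)))) ,
                                  vA (≤-trans b≥1 bc ∷ d≥1 ∷ e≥1 ∷ pos) bc (balance s (solve 6 (λ i j k l m n → i :+ (j :+ (k :+ l)) :+ con 0 :+ (m :+ n) := m :+ n :+ (j :+ (k :+ l) :+ con 0 :+ i)) refl c' d e (sum l) m b)) z≤n tm)
      where
      -- `d ≥ b` leaves `c' + e ≤ m`, and `t < c'` gives `t ≤ m - 2` again.
      tm : ε + t < m
      tm = balance-slack (sum l) (+-mono-≤ ε≤1 (+-mono-≤ e≥1 (+-mono-≤ (≤-reflexive s) (+-mono-≤ (≮⇒≥ db) tc)))) (solve 8 (λ i j k l m n o p → con 1 :+ (i :+ j) :+ (con 1 :+ (m :+ (k :+ p :+ (l :+ o)))) :+ n := k :+ (i :+ (con 1 :+ (l :+ (m :+ n) :+ con 0 :+ o :+ (p :+ (con 1 :+ j)))))) refl ε t m d e (sum l) c' b)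
    shape-total _ (vB {d} {l} {suc c} {c'} {t} (d≥1 ∷ pos) s cb bc ct tc) =
      inj₂ (_ , inj₁ (absorb (s≤s z≤n) cb ct) , vB (s≤s z≤n ∷ d≥1 ∷ pos) (balance s (solve 6 (λ i j k l m n → con 1 :+ (i :+ (j :+ k) :+ con 0 :+ l) :+ (m :+ n) := m :+ n :+ (j :+ k :+ (con 1 :+ i) :+ l)) refl c d (sum l) c' m b)) b≥1 bc z≤n tc)

  -- Skeletons of a given size and their recoding

  data Valid (ε m : ℕ) : Skeleton → Set where
    vonly : ∀ {r} → r < b → m ≡ 0 → Valid ε m (alone r)
    -- `suc (length cs)` vertices lie below `a`, and `b` counts `a` with the rest of its part. `t`
    -- is at least `n` because the letters of later trees follow `a`; its upper bound drops by `ε`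
    -- because `a` may not be read right after 1.
    vspec : ∀ {n r g l cs t ys} → WellFormed r (g ∷ l) → b ≤ g → sum (g ∷ l) ≡ suc (length cs) + b →
            IsCode (length cs + n) cs → n ≤ t → ε + t ≤ length cs + n → ValidTail n ys →
            m ≡ suc (length cs + n) → Valid ε m (special r (g ∷ l) cs t ys)
    -- The index of `x` is 0 in place of `ε`: vertex 1 lies in the first tree, so the missing edge
    -- {1,a} cannot concern a later one.
    vcons : ∀ {n r d l cs x} → WellFormed r (d ∷ l) → sum (d ∷ l) ≡ suc (length cs) →
            IsCode (length cs + n) cs → Valid 0 n x →
            m ≡ suc (length cs + n) → Valid ε m (before r (d ∷ l) cs x)

  -- The unmatched skeletons, recoded: the special block ends up with the part c', the other block (if any) with the part c,
  -- and the two ranges of the weight are rearranged into the rectangle c ≤ t < c', head ds < length ds.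
  data Out : Skeleton → (c c' t : ℕ) → List ℕ → Set where
    lone  : ∀ {r} → Out (alone r) 0 b r []
    keep  : ∀ {r c c' cs t ys es ds} → Reduced ys c es → c < b → c ≤ r → ds ≡ t ∷ cs ++ es →
            Out (special r (c' ∷ []) cs t ys) c c' r ds
    swap  : ∀ {r c c' cs t ys es ds} → Reduced ys c es → c < b → r < c → ds ≡ r ∷ cs ++ es →
            Out (special r (c' ∷ []) cs t ys) c c' t ds
    first : ∀ {r d c' cs x t es ds} → Out x 0 c' t es → d < b → d ≡ suc (length cs) → length (cs ++ es) < t →
            ds ≡ r ∷ cs ++ es → Out (before r (d ∷ []) cs x) d c' t ds

  -- The `r` of the first tree stays a separate parameter, since at the outermost level simplicity
  -- makes it 0 and no move may change it. Only `Out` folds it into the rectangle.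
  data Form : Skeleton → ℕ → Shape → List ℕ → Set where
    formA : ∀ {r α cs t ys c es ds} → Reduced ys c es → ds ≡ cs ++ es → Form (special r α cs t ys) r (PA α c t) ds
    formB : ∀ {r α cs x c c' t es ds} → Out x c c' t es → ds ≡ cs ++ es → Form (before r α cs x) r (PB α c c' t) ds

  out-unique : ∀ {x c c' t ds d d' u es} → Out x c c' t ds → Out x d d' u es →
               c ≡ d × c' ≡ d' × t ≡ u × ds ≡ es
  out-unique lone lone = refl , refl , refl , refl
  out-unique (keep p _ q refl) (keep p' _ q' refl) with reduced-unique p p'
  ... | refl , refl = refl , refl , refl , refl
  out-unique (keep p _ q refl) (swap p' _ q' refl) with reduced-unique p p'
  ... | refl , refl = ⊥-elim (<⇒≱ q' q)
  out-unique (swap p _ q refl) (keep p' _ q' refl) with reduced-unique p p'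
  ... | refl , refl = ⊥-elim (<⇒≱ q q')
  out-unique (swap p _ q refl) (swap p' _ q' refl) with reduced-unique p p'
  ... | refl , refl = refl , refl , refl , refl
  out-unique (first o _ _ _ refl) (first o' _ _ _ refl) with out-unique o o'
  ... | refl , refl , refl , refl = refl , refl , refl , refl

  form-unique : ∀ {x r P ds s Q es} → Form x r P ds → Form x s Q es → r ≡ s × P ≡ Q × ds ≡ es
  form-unique (formA p refl) (formA q refl) with reduced-unique p q
  ... | refl , refl = refl , refl , refl
  form-unique (formB p refl) (formB q refl) with out-unique p q
  ... | refl , refl , refl , refl = refl , refl , refl

  reduced-size : ∀ {n ys c es} → ValidTail n ys → Reduced ys c es → n ≡ c × IsCode c es
  reduced-size [] none = refl , _
  reduced-size (((_ , r<) , s , code , m) ∷ []) (one {cs = cs} refl) =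
    trans m (cong suc (+-identityʳ _)) , ≤-pred r< , subst (λ k → IsCode k cs) (+-identityʳ _) code

  record ValidOut (m c c' t : ℕ) (ds : List ℕ) : Set where
    constructor vOut
    field
      len   : length ds ≡ m
      total : c + c' ≡ m + b
      c<b   : c < b
      b≤c'  : b ≤ c'
      c≤t   : c ≤ t
      t<c'  : t < c'
      code  : IsCode m ds

  out-valid : ∀ {m x c c' t ds} → Valid 0 m x → Out x c c' t ds → ValidOut m c c' t ds
  out-valid (vonly r< refl) lone = vOut refl refl b≥1 ≤-refl z≤n r< _
  out-valid (vspec {cs = cs} w bg s code nt tm v refl) (keep {c = c} {c' = c'} {es = es} q cb cr refl) with reduced-size v q
  ... | refl , code' = vOut (balance (cong₂ _+_ (length-++ cs {es}) (reduced-length q)) (solve 4 (λ i j k l → con 1 :+ i :+ (j :+ l :+ k) := con 1 :+ (j :+ k) :+ (i :+ l)) refl (length (cs ++ es)) (length cs) c (length es))) (balance s (solve 4 (λ i j k l → i :+ j :+ (con 1 :+ (k :+ l)) := con 1 :+ (k :+ i :+ l) :+ (j :+ con 0)) refl c c' (length cs) b)) cb bg cr (proj₂ w) (tm , code-++⁺ cs code code')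
  out-valid (vspec {cs = cs} w bg s code nt tm v refl) (swap {r = r₁} {c} {c'} {t = t} {es = es} q cb rc refl) with reduced-size v q
  -- Here `t < m` by validity, and `c < b` turns `c + c' = m + b` into `m < c'`.
  ... | refl , code' = vOut (balance (cong₂ _+_ (length-++ cs {es}) (reduced-length q)) (solve 4 (λ i j k l → con 1 :+ i :+ (j :+ l :+ k) := con 1 :+ (j :+ k) :+ (i :+ l)) refl (length (cs ++ es)) (length cs) c (length es))) (balance s (solve 4 (λ i j k l → i :+ j :+ (con 1 :+ (k :+ l)) := con 1 :+ (k :+ i :+ l) :+ (j :+ con 0)) refl c c' (length cs) b)) cb bg nt (balance-slack 1 (+-mono-≤ (≤-reflexive (sym s)) (+-mono-≤ tm cb)) (solve 5 (λ i j k l m → con 1 :+ i :+ (j :+ con 0 :+ (k :+ m :+ l)) :+ con 1 := j :+ (con 1 :+ (k :+ l) :+ (i :+ (con 1 :+ m)))) refl t c' (length cs) b c)) (balance-slack ((length cs) + 1) rc (solve 3 (λ i j k → i :+ k :+ (j :+ con 1) := j :+ k :+ (con 1 :+ i)) refl r₁ (length cs) c) , code-++⁺ cs code code')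
  out-valid (vcons {n = n₁} {cs = cs} w s code v refl) (first {r = r₁} {c' = c'} {t = t} {es = es} o db refl ct refl) with out-valid v o
  ... | vOut len total _ b≤c' _ t<c' code' = vOut (balance (cong₂ _+_ (length-++ cs {es}) len) (solve 4 (λ i j k l → con 1 :+ i :+ (j :+ l :+ k) := con 1 :+ (j :+ k) :+ (i :+ l)) refl (length (cs ++ es)) (length cs) n₁ (length es))) (balance total (solve 4 (λ i j k l → con 1 :+ (i :+ j) :+ (k :+ l) := con 1 :+ (i :+ k :+ l) :+ j) refl (length cs) c' n₁ b)) db b≤c'
          (balance-slack (length es) (+-mono-≤ ct (≤-reflexive (sym (length-++ cs {es})))) (solve 4 (λ i j k l → con 1 :+ i :+ (j :+ k) :+ l := j :+ (con 1 :+ k :+ (i :+ l))) refl (length cs) t (length (cs ++ es)) (length es))) t<c' (balance-slack n₁ (proj₂ w) (solve 3 (λ i j k → i :+ (con 1 :+ j) :+ k := j :+ k :+ (con 1 :+ i)) refl r₁ (length cs) n₁) , code-++⁺ cs code code')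

  -- With `h` the head digit, `keep` occupies `h ≥ c`, `swap` occupies `h < c` and `t < m`, and
  -- `first` occupies `h < c` and `t ≥ m`. Within each region the data can be read off.
  out-inj : ∀ {m x y c c' t ds} → Valid 0 m x → Valid 0 m y → Out x c c' t ds → Out y c c' t ds → x ≡ y
  out-inj v w lone lone = refl
  out-inj v w lone (keep _ _ _ ())
  out-inj v w lone (swap _ _ _ ())
  out-inj v w lone (first _ _ () _ _)
  out-inj v w (keep _ _ _ ()) lone
  out-inj v w (swap _ _ _ ()) lone
  out-inj v w (first _ _ () _ _) lone
  out-inj v w (keep {cs = cs} p _ _ refl) (keep {cs = cs'} q _ _ e) with ∷-injective e
  ... | refl , e' with split-unique cs cs' (trans (reduced-length p) (sym (reduced-length q))) e'
  ... | refl , refl with reduced-inj p q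
  ... | refl = refl
  out-inj v w (swap {cs = cs} p _ _ refl) (swap {cs = cs'} q _ _ e) with ∷-injective e
  ... | refl , e' with split-unique cs cs' (trans (reduced-length p) (sym (reduced-length q))) e'
  ... | refl , refl with reduced-inj p q
  ... | refl = refl
  out-inj (vspec _ _ _ _ nt _ v _) w (keep p _ _ refl) (swap q _ rc e) with ∷-injectiveˡ e | reduced-size v p
  ... | refl | refl , _ = ⊥-elim (<⇒≱ rc nt)
  out-inj v (vspec _ _ _ _ nt _ w _) (swap p _ rc e) (keep q _ _ refl) with ∷-injectiveˡ e | reduced-size w q
  ... | refl | refl , _ = ⊥-elim (<⇒≱ rc nt)
  out-inj (vspec _ _ _ _ nt _ v _) (vcons (_ , r<) _ _ _ _) (keep p _ _ refl) (first o _ d _ e) with ∷-injectiveˡ e | reduced-size v p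
  ... | refl | refl , _ = ⊥-elim (<⇒≱ r< nt)
  out-inj (vcons (_ , r<) _ _ _ _) (vspec _ _ _ _ nt _ v _) (first o _ d _ e) (keep p _ _ refl) with ∷-injectiveˡ e | reduced-size v p
  ... | refl | refl , _ = ⊥-elim (<⇒≱ r< nt)
  out-inj (vspec {cs = cs} _ _ _ _ nt tm v _) _ (swap {c = c} {es = es} p _ _ refl) (first {cs = cs₁} {t = t} {es = es₁} o _ d ct e) with reduced-size v p | cong length (∷-injectiveʳ e)
  ... | refl , _ | le = absurd (balance-≤ (+-mono-≤ tm (+-mono-≤ ct (+-mono-≤ (≤-reflexive le) (+-mono-≤ (≤-reflexive (sym (reduced-length p))) (≤-reflexive (sym (length-++ cs {es}))))))) (solve 6 (λ i j k l m n → con 1 :+ (m :+ l :+ (i :+ (j :+ (n :+ k)))) := con 0 :+ (i :+ (con 1 :+ j :+ (k :+ (l :+ (m :+ n)))))) refl t (length (cs₁ ++ es₁)) (length (cs ++ es)) c (length cs) (length es)))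
  out-inj _ (vspec {cs = cs} _ _ _ _ nt tm v _) (first {cs = cs₁} {t = t} {es = es₁} o _ d ct e) (swap {c = c} {es = es} p _ _ refl) with reduced-size v p | cong length (∷-injectiveʳ e)
  ... | refl , _ | le = absurd (balance-≤ (+-mono-≤ tm (+-mono-≤ ct (+-mono-≤ (≤-reflexive le) (+-mono-≤ (≤-reflexive (sym (reduced-length p))) (≤-reflexive (sym (length-++ cs {es}))))))) (solve 6 (λ i j k l m n → con 1 :+ (m :+ l :+ (i :+ (j :+ (n :+ k)))) := con 0 :+ (i :+ (con 1 :+ j :+ (k :+ (l :+ (m :+ n)))))) refl t (length (cs₁ ++ es₁)) (length (cs ++ es)) c (length cs) (length es)))
  out-inj (vcons _ _ _ v e₁) (vcons _ _ _ w e₂) (first {d = c} {cs = cs} {es = es} o _ d _ refl) (first {cs = cs'} {es = es'} o' _ d' _ e) with ∷-injective e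
  ... | refl , e' with split-unique cs cs' (balance (cong₂ _+_ d (cong₂ _+_ (sym d') (cong₂ _+_ (cong length e') (cong₂ _+_ (sym (length-++ cs {es})) (length-++ cs' {es'}))))) (solve 7 (λ i j k l m n o → i :+ (con 1 :+ n :+ (k :+ (o :+ (m :+ (l :+ j))))) := j :+ (k :+ (con 1 :+ l :+ (m :+ (n :+ i :+ o))))) refl (length es) (length es') c (length cs') (length (cs ++ es)) (length cs) (length (cs' ++ es')))) e'
  ... | refl , refl with +-cancelˡ-≡ (suc (length cs)) _ _ (trans (sym e₁) e₂)
  ... | refl with out-inj v w o o'
  ... | refl = refl

  -- The head of a complete code returns to its role as the parameter `r` of an atom.
  realise-tail : ∀ {c} es → length es ≡ c → IsCode c es → ∃ λ ys → Reduced ys c es × ValidTail c ys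
  realise-tail [] refl _ = _ , none , []
  realise-tail (r ∷ cs) refl (r≤ , code) = _ , one refl ,
    ((s≤s z≤n ∷ [] , s≤s r≤) , +-identityʳ _ , subst (λ k → IsCode k cs) (sym (+-identityʳ _)) code , cong suc (sym (+-identityʳ _))) ∷ []

  private
    realise-out₀ : ∀ {m c' t ds} → ValidOut m 0 c' t ds → ∃ λ x → Out x 0 c' t ds × Valid 0 m x
    realise-out₀ {ds = []} (vOut refl refl _ _ _ t<c' _) = _ , lone , vonly t<c' refl
    realise-out₀ {ds = x ∷ ds} (vOut refl refl _ b≤c' _ t<c' (x≤ , code)) =
      _ , keep none b≥1 z≤n (cong (x ∷_) (sym (++-identityʳ ds))) ,
      vspec (s≤s z≤n ∷ [] , t<c') b≤c' (+-identityʳ _) (subst (λ k → IsCode k ds) (sym (+-identityʳ _)) code)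
            z≤n (subst (x ≤_) (sym (+-identityʳ _)) x≤) [] (cong suc (sym (+-identityʳ _)))

  -- The three regions fill the rectangle: comparing the head digit with `c`, and then `t` with the
  -- number of letters, selects the constructor.
  realise-out : ∀ {m c c' t ds} → ValidOut m c c' t ds → ∃ λ x → Out x c c' t ds × Valid 0 m x
  realise-out {c = zero} v = realise-out₀ v
  realise-out {c = suc c} {c'} {ds = []} (vOut refl s cb bc ct tc code) = absurd (balance-slack c (+-mono-≤ (≤-reflexive s) bc) (solve 3 (λ i j k → con 1 :+ (k :+ j) :+ i := con 0 :+ (con 1 :+ (i :+ j) :+ k)) refl c c' b))
  realise-out {c = suc c} {c'} {t} {x ∷ ds} (vOut refl s cb bc ct tc (x≤ , code)) with suc c ≤? x
  ... | yes cx with split-end (suc c) ds (balance-≤ (+-mono-≤ cx x≤) (solve 3 (λ i j k → con 1 :+ i :+ (k :+ j) := j :+ (con 1 :+ i :+ k)) refl c (length ds) x))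
  ...   | cs , es , refl , len with code-++⁻ cs (subst (λ k → IsCode k (cs ++ es)) (trans (length-++ cs) (cong (length cs +_) len)) code)
  ...     | code₁ , code₂ with realise-tail es len code₂
  ...       | ys , red , vt = _ , keep red cb ct refl ,
      vspec (≤-trans b≥1 bc ∷ [] , tc) bc (balance (cong₂ _+_ s (cong₂ _+_ (length-++ cs {es}) len)) (solve 6 (λ i j k l m n → i :+ con 0 :+ (con 1 :+ (m :+ k) :+ (j :+ n :+ (con 1 :+ l))) := con 1 :+ (j :+ k) :+ (con 1 :+ (l :+ i) :+ (m :+ n))) refl c' (length cs) b c (length (cs ++ es)) (length es))) code₁ cx (balance-≤ (+-mono-≤ x≤ (+-mono-≤ (≤-reflexive (length-++ cs {es})) (≤-reflexive len))) (solve 5 (λ i j k l m → i :+ (l :+ (j :+ m :+ (con 1 :+ k))) := j :+ (con 1 :+ k) :+ (i :+ (l :+ m))) refl x (length cs) c (length (cs ++ es)) (length es))) vt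
            (balance (cong₂ _+_ (length-++ cs {es}) len) (solve 4 (λ i j k l → con 1 :+ i :+ (j :+ l :+ (con 1 :+ k)) := con 1 :+ (j :+ (con 1 :+ k)) :+ (i :+ l)) refl (length (cs ++ es)) (length cs) c (length es)))
  realise-out {c = suc c} {c'} {t} {x ∷ ds} (vOut refl s cb bc ct tc (x≤ , code)) | no cx with t ≤? length ds
  ... | yes tm with split-end (suc c) ds (balance-≤ (+-mono-≤ ct tm) (solve 3 (λ i j k → con 1 :+ i :+ (k :+ j) := j :+ (con 1 :+ i :+ k)) refl c (length ds) t))
  ...   | cs , es , refl , len with code-++⁻ cs (subst (λ k → IsCode k (cs ++ es)) (trans (length-++ cs) (cong (length cs +_) len)) code)
  ...     | code₁ , code₂ with realise-tail es len code₂
  ...       | ys , red , vt = _ , swap red cb (≰⇒> cx) refl ,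
      -- The parameter `x` is legal because it is below the size of the trailing atom, which in turn
      -- is below `b ≤ c'`.
      vspec (≤-trans b≥1 bc ∷ [] , balance-slack 1 (+-mono-≤ (≰⇒> cx) (+-mono-≤ cb bc)) (solve 4 (λ i j k l → con 1 :+ i :+ (con 1 :+ k :+ (l :+ j)) :+ con 1 := j :+ (con 1 :+ i :+ (con 1 :+ (con 1 :+ k) :+ l))) refl x c' c b)) bc (balance (cong₂ _+_ s (cong₂ _+_ (length-++ cs {es}) len)) (solve 6 (λ i j k l m n → i :+ con 0 :+ (con 1 :+ (m :+ k) :+ (j :+ n :+ (con 1 :+ l))) := con 1 :+ (j :+ k) :+ (con 1 :+ (l :+ i) :+ (m :+ n))) refl c' (length cs) b c (length (cs ++ es)) (length es))) code₁ ct
            (balance-≤ (+-mono-≤ tm (+-mono-≤ (≤-reflexive (length-++ cs {es})) (≤-reflexive len))) (solve 5 (λ i j k l m → i :+ (l :+ (j :+ m :+ (con 1 :+ k))) := j :+ (con 1 :+ k) :+ (i :+ (l :+ m))) refl t (length cs) c (length (cs ++ es)) (length es))) vt (balance (cong₂ _+_ (length-++ cs {es}) len) (solve 4 (λ i j k l → con 1 :+ i :+ (j :+ l :+ (con 1 :+ k)) := con 1 :+ (j :+ (con 1 :+ k)) :+ (i :+ l)) refl (length (cs ++ es)) (length cs) c (length es)))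
  realise-out {c = suc c} {c'} {t} {x ∷ ds} (vOut refl s cb bc ct tc (x≤ , code)) | no cx | no tm
    with split-at c ds (balance-≤ (+-mono-≤ (≤-reflexive s) bc) (solve 4 (λ i j k l → i :+ (con 1 :+ (j :+ l) :+ k) := j :+ (con 1 :+ (i :+ k) :+ l)) refl c (length ds) c' b))
  ...   | cs , es , refl , refl with code-++⁻ cs (subst (λ k → IsCode k (cs ++ es)) (length-++ cs) code)
  ...     | code₁ , code₂ with realise-out₀ {c' = c'} {t} {es} (vOut refl (balance (cong₂ _+_ s (length-++ cs {es})) (solve 5 (λ i j k l m → i :+ (con 1 :+ (m :+ k) :+ (l :+ j)) := j :+ k :+ (con 1 :+ (l :+ i) :+ m)) refl c' (length es) b (length cs) (length (cs ++ es)))) b≥1 bc z≤n tc code₂)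
  ...       | y , o , vy = _ , first o cb refl (≰⇒> tm) refl ,
      vcons (s≤s z≤n ∷ [] , ≰⇒> cx) (+-identityʳ _) code₁ vy (balance (length-++ cs {es}) (solve 3 (λ i j k → con 1 :+ i :+ (j :+ k) := con 1 :+ (j :+ k) :+ i) refl (length (cs ++ es)) (length cs) (length es)))

  record ValidForm (ε m r : ℕ) (P : Shape) (ds : List ℕ) : Set where
    constructor vForm
    field
      size  : m ≡ suc (length ds)
      code  : IsCode (length ds) ds
      shape : ValidShape ε m P

  shapeParts : Shape → List ℕ
  shapeParts (PA α c t) = α
  shapeParts (PB α c c' t) = α

  form-valid : ∀ {ε m x r P ds} → Valid ε m x → Form x r P ds → ValidForm ε m r P ds × r < firstPart (shapeParts P)
  form-valid {ε} (vspec {g = g} {l} {cs} w bg s code nt tm v refl) (formA {c = c} {es = es} q refl) with reduced-size v q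
  ... | refl , code' = vForm (balance (cong₂ _+_ (sym (length-++ cs {es})) (sym (reduced-length q))) (solve 4 (λ i j k l → con 1 :+ (i :+ j) :+ (k :+ l) := con 1 :+ k :+ (i :+ l :+ j)) refl (length cs) c (length (cs ++ es)) (length es)))
          (subst (λ k → IsCode k (cs ++ es)) (balance (cong₂ _+_ (sym (length-++ cs {es})) (sym (reduced-length q))) (solve 4 (λ i j k l → i :+ j :+ (k :+ l) := k :+ (i :+ l :+ j)) refl (length cs) c (length (cs ++ es)) (length es))) (code-++⁺ cs code code'))
          (vA (proj₁ w) bg (balance s (solve 5 (λ i j k l m → i :+ j :+ k :+ (con 1 :+ (l :+ m)) := con 1 :+ (l :+ k :+ m) :+ (i :+ j)) refl g (sum l) c (length cs) b)) nt (s≤s tm)) , proj₂ w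
  form-valid (vcons {n = n₁} {d = d} {l} {cs} w s code v refl) (formB {c = c} {c'} {es = es} o refl) with out-valid v o
  ... | vOut len total c<b b≤c' c≤t t<c' code' = vForm (balance (cong₂ _+_ (sym (length-++ cs {es})) (sym len)) (solve 4 (λ i j k l → con 1 :+ (i :+ j) :+ (k :+ l) := con 1 :+ k :+ (i :+ l :+ j)) refl (length cs) n₁ (length (cs ++ es)) (length es)))
          (subst (λ k → IsCode k (cs ++ es)) (balance (cong₂ _+_ (sym (length-++ cs {es})) (sym len)) (solve 4 (λ i j k l → i :+ j :+ (k :+ l) := k :+ (i :+ l :+ j)) refl (length cs) n₁ (length (cs ++ es)) (length es))) (code-++⁺ cs code code'))
          (vB (proj₁ w) (balance (cong₂ _+_ s total) (solve 7 (λ i j k l m n o → i :+ j :+ k :+ l :+ (con 1 :+ m :+ (n :+ o)) := con 1 :+ (m :+ n :+ o) :+ (i :+ j :+ (k :+ l))) refl d (sum l) c c' (length cs) n₁ b)) c<b b≤c' c≤t t<c') , proj₂ w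

  form-inj : ∀ {ε m x y r P ds} → Valid ε m x → Valid ε m y → Form x r P ds → Form y r P ds → x ≡ y
  form-inj v w (formA {cs = cs} p refl) (formA {cs = cs'} q e)
    with split-unique cs cs' (trans (reduced-length p) (sym (reduced-length q))) e
  ... | refl , refl with reduced-inj p q
  ... | refl = refl
  form-inj (vcons {d = d} {l} _ s _ v m) (vcons _ s' _ w m') (formB {cs = cs} {es = es} o refl) (formB {cs = cs'} {es = es'} o' e)
    with split-unique cs cs' (balance (cong₂ _+_ s (cong₂ _+_ (sym s') (cong₂ _+_ (cong length e) (cong₂ _+_ (sym (length-++ cs {es})) (length-++ cs' {es'}))))) (solve 8 (λ i j k l m n o p → i :+ (con 1 :+ o :+ (k :+ l :+ (p :+ (n :+ (m :+ j))))) := j :+ (k :+ l :+ (con 1 :+ m :+ (n :+ (o :+ i :+ p))))) refl (length es) (length es') d (sum l) (length cs') (length (cs ++ es)) (length cs) (length (cs' ++ es')))) e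
  ... | refl , refl with +-cancelˡ-≡ (suc (length cs)) _ _ (trans (sym m) m')
  ... | refl with out-inj v w o o'
  ... | refl = refl

  realise-form : ∀ {ε m r P ds} → ValidForm ε m r P ds → r < firstPart (shapeParts P) → ∃ λ x → Form x r P ds × Valid ε m x
  realise-form {ε} {ds = ds} (vForm refl code (vA {g} {l} {c} {t} pos bg s ct tm)) r<
    with split-end c ds (balance-slack ε (+-mono-≤ ct tm) (solve 4 (λ i j k l → i :+ (l :+ (con 1 :+ j)) :+ k := j :+ (i :+ (con 1 :+ (k :+ l)))) refl c (length ds) ε t))
  ... | cs , es , refl , len with code-++⁻ cs (subst (λ k → IsCode k (cs ++ es)) (trans (length-++ cs) (cong (length cs +_) len)) code)
  ...   | code₁ , code₂ with realise-tail es len code₂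
  ...     | ys , red , vt = _ , formA red refl ,
      vspec (pos , r<) bg (balance (cong₂ _+_ s (cong₂ _+_ (length-++ cs {es}) len)) (solve 7 (λ i j k l m n o → i :+ j :+ (con 1 :+ (n :+ l) :+ (k :+ o :+ m)) := con 1 :+ (k :+ l) :+ (i :+ j :+ m :+ (n :+ o))) refl g (sum l) (length cs) b c (length (cs ++ es)) (length es))) code₁ ct (balance-≤ (+-mono-≤ tm (+-mono-≤ (≤-reflexive (length-++ cs {es})) (≤-reflexive len))) (solve 6 (λ i j k l m n → i :+ j :+ (con 1 :+ m :+ (k :+ n :+ l)) := k :+ l :+ (con 1 :+ (i :+ j) :+ (m :+ n))) refl ε t (length cs) c (length (cs ++ es)) (length es))) vt
            (balance (cong₂ _+_ (length-++ cs {es}) len) (solve 4 (λ i j k l → con 1 :+ i :+ (j :+ l :+ k) := con 1 :+ (j :+ k) :+ (i :+ l)) refl (length (cs ++ es)) (length cs) c (length es)))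
  realise-form {ds = ds} (vForm refl code (vB {d} {l} {c} {c'} {t} (d≥1 ∷ pos) s cb bc ct tc)) r<
    -- The first tree has `sum (d ∷ l)` vertices, the first of which has no digit; the digits left
    -- over belong to the inner configuration.
    with split-at (sum (d ∷ l) ∸ 1) ds (balance-slack c (+-mono-≤ (≤-reflexive s) (+-mono-≤ bc (≤-reflexive (m+[n∸m]≡n (≤-trans d≥1 (m≤m+n d (sum l))))))) (solve 7 (λ i j k l m n o → i :+ (con 1 :+ (j :+ o) :+ (n :+ (k :+ l))) :+ m := j :+ (k :+ l :+ m :+ n :+ (o :+ (con 1 :+ i)))) refl (d + sum l ∸ 1) (length ds) d (sum l) c c' b))
  ... | cs , es , refl , len with code-++⁻ cs (subst (λ k → IsCode k (cs ++ es)) (length-++ cs) code)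
  ...   | code₁ , code₂ with realise-out {c = c} {c'} {t} {es} (vOut refl total cb bc ct tc code₂)
    where
    total : c + c' ≡ length es + b
    total = balance (cong₂ _+_ s (cong₂ _+_ len (cong₂ _+_ (length-++ cs {es}) (m+[n∸m]≡n (≤-trans d≥1 (m≤m+n d (sum l))))))) (solve 9 (λ i j k l m n o p q → i :+ j :+ (con 1 :+ (p :+ l) :+ (q :+ (o :+ k :+ (m :+ n)))) := k :+ l :+ (m :+ n :+ i :+ j :+ (o :+ (p :+ (con 1 :+ q))))) refl c c' (length es) b d (sum l) (length cs) (length (cs ++ es)) (d + sum l ∸ 1))
  ...     | x , o , vx = _ , formB o refl ,
      vcons (d≥1 ∷ pos , r<) (balance (cong₂ _+_ (sym len) (sym (m+[n∸m]≡n (≤-trans d≥1 (m≤m+n d (sum l)))))) (solve 4 (λ i j k l → i :+ j :+ (k :+ (con 1 :+ l)) := con 1 :+ k :+ (l :+ (i :+ j))) refl d (sum l) (length cs) (d + sum l ∸ 1))) code₁ vx (cong suc (length-++ cs))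

  -- The matching on skeletons

  data Match (ε : ℕ) : Skeleton → Skeleton → Set where
    tail : ∀ {r α cs t ys zs} → TailMatch ys zs → Match ε (special r α cs t ys) (special r α cs t zs)
    rest : ∀ {r α cs x y} → Match 0 x y → Match ε (before r α cs x) (before r α cs y)
    form : ∀ {x y r P Q ds} → Form x r P ds → Form y r Q ds → ShapeMatch ε (suc (length ds)) P Q → Match ε x y

  match-sym : ∀ {ε x y} → Match ε x y → Match ε y x
  match-sym (tail p) = tail (tail-sym p)
  match-sym (rest p) = rest (match-sym p)
  match-sym (form p q (inj₁ s)) = form q p (inj₂ s)
  match-sym (form p q (inj₂ s)) = form q p (inj₁ s)

  -- The recoded skeletons are the survivors for `ε = 0`: `tail` and `rest` would need a piece that
  -- is itself matched, and `form` is refused because the shape is `Fixed`.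
  out-unmatched : ∀ {x y c c' t ds} → Out x c c' t ds → Match 0 x y → ⊥
  out-unmatched (keep p _ _ _) (tail q) = merge-reduced q p
  out-unmatched (swap p _ _ _) (tail q) = merge-reduced q p
  out-unmatched (first p _ _ _ _) (rest q) = out-unmatched p q
  out-unmatched lone (form () _ _)
  out-unmatched (keep p cb _ _) (form (formA q _) _ s) = fixed-unmatched (fixA (subst (_< b) (proj₁ (reduced-unique p q)) cb)) s
  out-unmatched (swap p cb _ _) (form (formA q _) _ s) = fixed-unmatched (fixA (subst (_< b) (proj₁ (reduced-unique p q)) cb)) s
  out-unmatched (first o _ _ ct refl) (form (formB o' refl) _ s) with out-unique o o'
  ... | refl , refl , refl , refl = fixed-unmatched (fixB ct) s

  FixedSkeleton : ℕ → Skeleton → Set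
  FixedSkeleton ε x = ∃ λ r → ∃ λ P → ∃ λ ds → Form x r P ds × Fixed ε (suc (length ds)) P

  fixed-skeleton-unmatched : ∀ {ε x y} → FixedSkeleton ε x → Match ε x y → ⊥
  fixed-skeleton-unmatched (_ , _ , _ , formA p _ , _) (tail q) = merge-reduced q p
  fixed-skeleton-unmatched (_ , _ , _ , formB o _ , _) (rest q) = out-unmatched o q
  fixed-skeleton-unmatched (_ , _ , _ , f , fx) (form g _ s) with form-unique f g
  ... | refl , refl , refl = fixed-unmatched fx s

  -- Validity of both targets is required because a recoding determines its skeleton only among the
  -- valid ones of a given size.
  match-unique : ∀ {ε m x y z} → Valid ε m y → Valid ε m z → Match ε x y → Match ε x z → y ≡ z
  match-unique v w (tail p) (tail q) with tailMatch-unique p q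
  ... | refl = refl
  match-unique v w (tail p) (form (formA q _) _ _) = ⊥-elim (merge-reduced p q)
  match-unique (vcons _ _ _ v m) (vcons _ _ _ w m') (rest {cs = cs} p) (rest q) with +-cancelˡ-≡ (suc (length cs)) _ _ (trans (sym m) m')
  ... | refl with match-unique v w p q
  ... | refl = refl
  match-unique v w (rest p) (form (formB q _) _ _) = ⊥-elim (out-unmatched q p)
  match-unique v w (form (formA q _) _ _) (tail p) = ⊥-elim (merge-reduced p q)
  match-unique v w (form (formB q _) _ _) (rest p) = ⊥-elim (out-unmatched q p)
  match-unique v w (form f g s) (form f' g' s') with form-unique f f'
  ... | refl , refl , refl with shapeMatch-unique s s'
  ... | refl = form-inj v w g g'

  step-first : ∀ {ε m P Q} → Step ε m P Q → firstPart (shapeParts P) ≡ firstPart (shapeParts Q)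
  step-first (append _ _ _) = refl
  step-first (insert _ _ _) = refl
  step-first (absorb _ _ _) = refl
  step-first (join _ _ _) = refl

  match-first : ∀ {ε m P Q} → ShapeMatch ε m P Q → firstPart (shapeParts P) ≡ firstPart (shapeParts Q)
  match-first (inj₁ s) = step-first s
  match-first (inj₂ s) = sym (step-first s)

  -- Priority runs from the inside out: the trailing trees or the inner skeleton are tried first,
  -- and only if they are unmatched does the shape of the whole decide. The recursion descends into
  -- the inner skeleton, always at `ε = 0`.
  match-total  : ∀ {ε m x} → ε ≤ 1 → Valid ε m x → (∃ λ r → x ≡ alone r) ⊎ FixedSkeleton ε x ⊎ (∃ λ y → Match ε x y × Valid ε m y)
  match-total₀ : ∀ {m x} → Valid 0 m x →
    (∃ λ c → ∃ λ c' → ∃ λ t → ∃ λ ds → Out x c c' t ds) ⊎ (∃ λ y → Match 0 x y × Valid 0 m y)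
  form-total : ∀ {ε m x r P ds} → ε ≤ 1 → Valid ε m x → Form x r P ds →
    FixedSkeleton ε x ⊎ (∃ λ y → Match ε x y × Valid ε m y)

  form-total ε≤1 v f with form-valid v f
  ... | vForm refl code s , r< with shape-total ε≤1 s
  ... | inj₁ fx = inj₁ (_ , _ , _ , f , fx)
  ... | inj₂ (Q , sm , vq) with realise-form (vForm refl code vq) (subst (_ <_) (match-first sm) r<)
  ... | y , g , vy = inj₂ (y , form f g sm , vy)

  match-total ε≤1 (vonly _ _) = inj₁ (_ , refl)
  match-total ε≤1 v@(vspec w bg s code nt tm vt e) with tail-total vt
  ... | inj₁ (c , es , red) = inj₂ (form-total ε≤1 v (formA red refl))
  ... | inj₂ (zs , mt , vz) = inj₂ (inj₂ (_ , tail mt , vspec w bg s code nt tm vz e))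
  match-total ε≤1 v@(vcons w s code vx e) with match-total₀ vx
  ... | inj₁ (_ , _ , _ , _ , o) = inj₂ (form-total ε≤1 v (formB o refl))
  ... | inj₂ (y , mt , vy) = inj₂ (inj₂ (_ , rest mt , vcons w s code vy e))

  match-total₀ v with match-total z≤n v
  ... | inj₁ (_ , refl) = inj₁ (_ , _ , _ , _ , lone)
  ... | inj₂ (inj₂ y) = inj₂ y
  match-total₀ (vspec _ _ _ _ _ _ _ _) | inj₂ (inj₁ (r , _ , ds , formA {t = t} {c = c} p refl , fixA cb)) with c ≤? r
  ... | yes cr = inj₁ (_ , _ , _ , _ , keep p cb cr refl)
  ... | no cr = inj₁ (_ , _ , _ , _ , swap p cb (≰⇒> cr) refl)
  match-total₀ (vcons {n = n₁} (_ , r<) s _ vx refl) | inj₂ (inj₁ (r , _ , ds , formB {cs = cs} {c' = c'} {t} {es} o refl , fixB {d} ct)) with out-valid vx o | d <? b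
  ... | vOut len total _ b≤c' _ t<c' _ | yes db = inj₁ (_ , _ , _ , _ , first o db (trans (sym (+-identityʳ d)) s) ct refl)
  -- `d ≥ b` cannot occur: `t` is below `c' = n₁ + b`, yet at least `d + n₁`.
  ... | vOut len total _ b≤c' _ t<c' _ | no db = absurd (balance-≤ (+-mono-≤ (≤-reflexive s) (+-mono-≤ ct (+-mono-≤ (≤-reflexive (sym len)) (+-mono-≤ (≤-reflexive total) (+-mono-≤ t<c' (+-mono-≤ (≮⇒≥ db) (≤-reflexive (sym (length-++ cs {es}))))))))) (solve 8 (λ i j k l m n o p → con 1 :+ (con 1 :+ o :+ (m :+ (p :+ (k :+ n :+ (l :+ (i :+ j)))))) := con 0 :+ (i :+ con 0 :+ (con 1 :+ j :+ (k :+ (l :+ (con 1 :+ m :+ (n :+ (o :+ p)))))))) refl d (length (cs ++ es)) n₁ c' t b (length cs) (length es)))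

  -- Sign, type and weight of skeletons

  skeletonParts : Skeleton → List ℕ
  skeletonParts (alone r)           = b ∷ []
  skeletonParts (special r α cs t ys) = α ++ partsOf ys
  skeletonParts (before r α cs x)    = α ++ skeletonParts x

  skeletonCuts : Skeleton → ℕ
  skeletonCuts (alone r)           = 0
  skeletonCuts (special r α cs t ys) = cuts α + tailCuts ys
  skeletonCuts (before r α cs x)    = cuts α + skeletonCuts x

  skeletonWeight : Skeleton → ℕ
  skeletonWeight (alone r)           = r
  skeletonWeight (special r α cs t ys) = r + sum cs + t + tailWeight ys
  skeletonWeight (before r α cs x)    = r + sum cs + skeletonWeight x

  skeletonFirst : Skeleton → ℕ
  skeletonFirst (alone r)           = b
  skeletonFirst (special r α cs t ys) = firstPart α
  skeletonFirst (before r α cs x)    = firstPart α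

  formParts : Shape → List ℕ
  formParts (PA α c t)    = α ++ positive c
  formParts (PB α c c' t) = α ++ c' ∷ positive c

  formWeight : Shape → ℕ
  formWeight (PA α c t)    = t
  formWeight (PB α c c' t) = t

  SkeletonStats : Skeleton → Skeleton → Set
  SkeletonStats x y = Stats (skeletonCuts x) (skeletonCuts y) (skeletonParts x) (skeletonParts y) (skeletonWeight x) (skeletonWeight y)

  -- `keep` exchanges the roles of `r` and `t`, the other cases leave them in place; only their sum
  -- enters the weight.
  out-stats : ∀ {x c c' t ds} → Out x c c' t ds →
    skeletonCuts x ≡ 0 × skeletonParts x ↭ c' ∷ positive c × skeletonWeight x ≡ t + sum ds
  out-stats {t = t} lone = refl , ↭-refl , sym (+-identityʳ t)
  out-stats (keep {r} {c' = c'} {cs} {t} {ys} {es} p _ _ refl) with reduced-stats p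
  ... | q , q' , q'' = q , ↭-reflexive (cong (c' ∷_) q') , balance (cong₂ _+_ q'' (sym (sum-++ cs es))) (solve 6 (λ i j k l m n → i :+ j :+ k :+ l :+ (n :+ m) := i :+ (k :+ m) :+ (l :+ (j :+ n))) refl r (sum cs) t (tailWeight ys) (sum (cs ++ es)) (sum es))
  out-stats (swap {r} {c' = c'} {cs} {t} {ys} {es} p _ _ refl) with reduced-stats p
  ... | q , q' , q'' = q , ↭-reflexive (cong (c' ∷_) q') , balance (cong₂ _+_ q'' (sym (sum-++ cs es))) (solve 6 (λ i j k l m n → i :+ j :+ k :+ l :+ (n :+ m) := k :+ (i :+ m) :+ (l :+ (j :+ n))) refl r (sum cs) t (tailWeight ys) (sum (cs ++ es)) (sum es))
  out-stats (first {r} {d} {c'} {cs} {x} {t} {es} o _ refl _ refl) with out-stats o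
  ... | q , q' , q'' = q , ↭-trans (↭-prep d q') (↭-swap d c' ↭-refl) , balance (cong₂ _+_ q'' (sym (sum-++ cs es))) (solve 6 (λ i j k l m n → i :+ j :+ k :+ (l :+ n :+ m) := l :+ (i :+ m) :+ (k :+ (j :+ n))) refl r (sum cs) (skeletonWeight x) t (sum (cs ++ es)) (sum es))

  form-stats : ∀ {x r P ds} → Form x r P ds →
    skeletonCuts x ≡ cuts (shapeParts P) × skeletonParts x ↭ formParts P × skeletonWeight x ≡ r + formWeight P + sum ds
    × skeletonFirst x ≡ firstPart (shapeParts P)
  form-stats (formA {r} {α} {cs} {t} {ys} {es = es} p refl) with reduced-stats p
  ... | q , q' , q'' = trans (cong (cuts α +_) q) (+-identityʳ _) , ↭-reflexive (cong (α ++_) q') , balance (cong₂ _+_ q'' (sym (sum-++ cs es))) (solve 6 (λ i j k l m n → i :+ j :+ k :+ l :+ (n :+ m) := i :+ k :+ m :+ (l :+ (j :+ n))) refl r (sum cs) t (tailWeight ys) (sum (cs ++ es)) (sum es)) , refl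
  form-stats (formB {r} {α} {cs} {x} {t = t} {es} o refl) with out-stats o
  ... | q , q' , q'' = trans (cong (cuts α +_) q) (+-identityʳ _) , Perm.++⁺ˡ α q' , balance (cong₂ _+_ q'' (sym (sum-++ cs es))) (solve 6 (λ i j k l m n → i :+ j :+ k :+ (l :+ n :+ m) := i :+ l :+ m :+ (k :+ (j :+ n))) refl r (sum cs) (skeletonWeight x) t (sum (cs ++ es)) (sum es)) , refl

  step-stats : ∀ {ε m P Q} → Step ε m P Q →
    cuts (shapeParts Q) ≡ suc (cuts (shapeParts P)) × formParts P ↭ formParts Q × formWeight P ≡ formWeight Q
  step-stats (append {g} {l} {zero} bc _ _) = absurd (balance-≤ (+-mono-≤ bc b≥1) (solve 1 (λ i → con 1 :+ (con 0 :+ i) := con 0 :+ (i :+ con 1)) refl b))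
  step-stats (append {g} {l} {suc c} _ _ _) = refl , ↭-trans (Perm.++-comm (g ∷ l) (suc c ∷ [])) (↭-reflexive (sym (++-identityʳ _))) , refl
  step-stats (insert {g} {e} {l} {suc c} _ _ _) = refl ,
    ↭-prep g (↭-trans (Perm.++-comm (e ∷ l) (suc c ∷ [])) (↭-reflexive (sym (++-identityʳ _)))) , refl
  step-stats (absorb {e} {l} {suc c} {c'} _ _ _) = refl ,
    ↭-trans (Perm.++⁺ˡ (e ∷ l) (↭-swap c' (suc c) ↭-refl)) (Perm.shift (suc c) (e ∷ l) (c' ∷ [])) , refl
  step-stats (join {d} {l} {c'} _ _ _) = refl ,
    ↭-trans (Perm.++-comm (d ∷ l) (c' ∷ [])) (↭-reflexive (sym (++-identityʳ _))) , refl

  match-stats : ∀ {ε x y} → Match ε x y → SkeletonStats x y × skeletonFirst x ≡ skeletonFirst y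
  match-stats (tail {r} {α} {cs} {t} p) with tail-stats p
  ... | stats f q w = stats (Flip-+ˡ (cuts α) f) (Perm.++⁺ˡ α q) (cong (r + sum cs + t +_) w) , refl
  match-stats (rest {r} {α} {cs} p) with match-stats p
  ... | stats f q w , _ = stats (Flip-+ˡ (cuts α) f) (Perm.++⁺ˡ α q) (cong (r + sum cs +_) w) , refl
  match-stats (form {x} {y} {r} {P} {Q} {ds} f g s) with form-stats f | form-stats g
  ... | fc , fp , fw , ff | gc , gp , gw , gf = stats (flip s) (↭-trans fp (↭-trans (parts s) (↭-sym gp)))
        (trans fw (trans (cong (λ k → r + k + sum ds) (weight′ s)) (sym gw))) , trans ff (trans (match-first s) (sym gf))
    where
    flip : ShapeMatch _ _ P Q → Flip (skeletonCuts x) (skeletonCuts y)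
    flip (inj₁ s) = inj₁ (trans gc (trans (proj₁ (step-stats s)) (cong suc (sym fc))))
    flip (inj₂ s) = inj₂ (trans fc (trans (proj₁ (step-stats s)) (cong suc (sym gc))))
    parts : ShapeMatch _ _ P Q → formParts P ↭ formParts Q
    parts (inj₁ s) = proj₁ (proj₂ (step-stats s))
    parts (inj₂ s) = ↭-sym (proj₁ (proj₂ (step-stats s)))
    weight′ : ShapeMatch _ _ P Q → formWeight P ≡ formWeight Q
    weight′ (inj₁ s) = proj₂ (proj₂ (step-stats s))
    weight′ (inj₂ s) = sym (proj₂ (proj₂ (step-stats s)))

-- Decreasing subtrees as parent functions

true≢false : ∀ {A : Set} {b} → b ≡ true → b ≡ false → A
true≢false refl ()

∧-true : ∀ {x y} → x ∧ y ≡ true → x ≡ true × y ≡ true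
∧-true {true} {true} _ = refl , refl

∨-true : ∀ {x y} → x ∨ y ≡ true → x ≡ true ⊎ y ≡ true
∨-true {true} _ = inj₁ refl
∨-true {false} p = inj₂ p

∨-introʳ : ∀ x {y} → y ≡ true → x ∨ y ≡ true
∨-introʳ true  _ = refl
∨-introʳ false p = p

≡ᵇ-true : ∀ {m n} → (m ≡ᵇ n) ≡ true → m ≡ n
≡ᵇ-true {m} {n} p = ≡ᵇ⇒≡ m n (subst T (sym p) unit)

≡ᵇ-refl : ∀ n → (n ≡ᵇ n) ≡ true
≡ᵇ-refl zero    = refl
≡ᵇ-refl (suc n) = ≡ᵇ-refl n

<ᵇ-true : ∀ {m n} → (m <ᵇ n) ≡ true → m < n
<ᵇ-true {m} {n} p = <ᵇ⇒< m n (subst T (sym p) unit)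

<ᵇ-intro : ∀ {m n} → m < n → (m <ᵇ n) ≡ true
<ᵇ-intro {m} {n} p with m <ᵇ n | <⇒<ᵇ p
... | true | _ = refl

≤ᵇ-true : ∀ {m n} → (m ≤ᵇ n) ≡ true → m ≤ n
≤ᵇ-true {m} {n} p = ≤ᵇ⇒≤ m n (subst T (sym p) unit)

≤ᵇ-intro : ∀ {m n} → m ≤ n → (m ≤ᵇ n) ≡ true
≤ᵇ-intro {m} {n} p with m ≤ᵇ n | ≤⇒≤ᵇ p
... | true | _ = refl

not-true⇒false : ∀ {x} → (x ≡ true → ⊥) → x ≡ false
not-true⇒false {true}  p = ⊥-elim (p refl)
not-true⇒false {false} p = refl

≤ᵇ-false : ∀ {m n} → n < m → (m ≤ᵇ n) ≡ false
≤ᵇ-false p = not-true⇒false (λ q → <⇒≱ p (≤ᵇ-true q))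

<ᵇ-false : ∀ {m n} → n ≤ m → (m <ᵇ n) ≡ false
<ᵇ-false p = not-true⇒false (λ q → <⇒≱ (<ᵇ-true q) p)

≡ᵇ-false : ∀ {m n} → m ≢ n → (m ≡ᵇ n) ≡ false
≡ᵇ-false p = not-true⇒false (λ q → p (≡ᵇ-true q))

module _ {A : Set} (p : A → Bool) where
  any-elim : ∀ xs → any p xs ≡ true → ∃ λ x → x ∈ xs × p x ≡ true
  any-elim (x ∷ xs) q with ∨-true {p x} q
  ... | inj₁ r = x , here refl , r
  ... | inj₂ r with any-elim xs r
  ... | y , y∈ , s = y , there y∈ , s

  any-intro : ∀ {x xs} → x ∈ xs → p x ≡ true → any p xs ≡ true
  any-intro {xs = y ∷ xs} (here refl) q rewrite q = refl
  any-intro {xs = y ∷ xs} (there x∈) q = ∨-introʳ (p y) (any-intro x∈ q)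

  any-false : ∀ xs → (∀ {x} → x ∈ xs → p x ≡ false) → any p xs ≡ false
  any-false xs q = not-true⇒false λ r → let (x , x∈ , s) = any-elim xs r in true≢false s (q x∈)

  filter-elim : ∀ {x} xs → x ∈ filterᵇ p xs → x ∈ xs × p x ≡ true
  filter-elim (y ∷ xs) q with p y in e
  filter-elim (y ∷ xs) (here refl) | true = here refl , e
  filter-elim (y ∷ xs) (there q)   | true with filter-elim xs q
  ... | x∈ , r = there x∈ , r
  filter-elim (y ∷ xs) q | false with filter-elim xs q
  ... | x∈ , r = there x∈ , r

  filter-intro : ∀ {x} xs → x ∈ xs → p x ≡ true → x ∈ filterᵇ p xs
  filter-intro (y ∷ xs) x∈ q with p y in e
  filter-intro (y ∷ xs) (here refl) q | true = here refl
  filter-intro (y ∷ xs) (there x∈)  q | true = there (filter-intro xs x∈ q)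
  filter-intro (y ∷ xs) (here refl) q | false = true≢false q e
  filter-intro (y ∷ xs) (there x∈)  q | false = filter-intro xs x∈ q

  filter-empty : ∀ xs → (∀ {x} → x ∈ xs → p x ≡ false) → filterᵇ p xs ≡ []
  filter-empty [] q = refl
  filter-empty (x ∷ xs) q rewrite q (here refl) = filter-empty xs (q ∘ there)

  filter-full : ∀ xs → (∀ {x} → x ∈ xs → p x ≡ true) → filterᵇ p xs ≡ xs
  filter-full [] q = refl
  filter-full (x ∷ xs) q rewrite q (here refl) = cong (x ∷_) (filter-full xs (q ∘ there))

  filterᵇ-++ : ∀ xs ys → filterᵇ p (xs ++ ys) ≡ filterᵇ p xs ++ filterᵇ p ys
  filterᵇ-++ [] ys = refl
  filterᵇ-++ (x ∷ xs) ys with p x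
  ... | true = cong (x ∷_) (filterᵇ-++ xs ys)
  ... | false = filterᵇ-++ xs ys

memB-elim : ∀ {x} xs → memB x xs ≡ true → x ∈ xs
memB-elim {x} xs q with any-elim (x ≡ᵇ_) xs q
... | y , y∈ , r = subst (_∈ xs) (sym (≡ᵇ-true r)) y∈

memB-intro : ∀ {x xs} → x ∈ xs → memB x xs ≡ true
memB-intro {x} x∈ = any-intro (x ≡ᵇ_) x∈ (≡ᵇ-refl x)

memB-false : ∀ {x xs} → x ∉ xs → memB x xs ≡ false
memB-false {x} {xs} x∉ = not-true⇒false (x∉ ∘ memB-elim xs)

Joined : List (ℕ × ℕ) → ℕ → ℕ → Set
Joined Ed u v = (u , v) ∈ Ed ⊎ (v , u) ∈ Ed

adj-elim : ∀ Ed {u v} → adjT Ed u v ≡ true → Joined Ed u v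
adj-elim Ed {u} {v} q with any-elim _ Ed q
... | (x , y) , e∈ , r with ∨-true {(x ≡ᵇ u) ∧ (y ≡ᵇ v)} r
... | inj₁ s with ∧-true {x ≡ᵇ u} s
...   | p₁ , p₂ = inj₁ (subst₂ (λ a b → (a , b) ∈ Ed) (≡ᵇ-true p₁) (≡ᵇ-true p₂) e∈)
adj-elim Ed {u} {v} q | (x , y) , e∈ , r | inj₂ s with ∧-true {x ≡ᵇ v} s
...   | p₁ , p₂ = inj₂ (subst₂ (λ a b → (a , b) ∈ Ed) (≡ᵇ-true p₁) (≡ᵇ-true p₂) e∈)

adj-intro : ∀ Ed {u v} → Joined Ed u v → adjT Ed u v ≡ true
adj-intro Ed {u} {v} (inj₁ e∈) = any-intro _ e∈ (subst₂ (λ a b → (a ∧ b) ∨ ((u ≡ᵇ v) ∧ (v ≡ᵇ u)) ≡ true) (sym (≡ᵇ-refl u)) (sym (≡ᵇ-refl v)) refl)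
adj-intro Ed {u} {v} (inj₂ e∈) = any-intro _ e∈ (∨-introʳ ((v ≡ᵇ u) ∧ (u ≡ᵇ v)) (subst₂ (λ a b → a ∧ b ≡ true) (sym (≡ᵇ-refl v)) (sym (≡ᵇ-refl u)) refl))

Increasing : List ℕ → Set
Increasing = AllPairs _<_

increasing-ext : ∀ {xs ys} → Increasing xs → Increasing ys → (∀ {x} → x ∈ xs → x ∈ ys) → (∀ {x} → x ∈ ys → x ∈ xs) → xs ≡ ys
increasing-ext {[]} {[]} _ _ _ _ = refl
increasing-ext {[]} {y ∷ ys} _ _ _ g = case g (here refl) of λ ()
increasing-ext {x ∷ xs} {[]} _ _ f _ = case f (here refl) of λ ()
increasing-ext {x ∷ xs} {y ∷ ys} (p ∷ ps) (q ∷ qs) f g = cong₂ _∷_ x≡y (increasing-ext ps qs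
    (λ z∈ → tail-of q (f (there z∈)) (λ e → <-irrefl (trans x≡y (sym e)) (All.lookup p z∈)))
    (λ z∈ → tail-of p (g (there z∈)) (λ e → <-irrefl (trans (sym x≡y) (sym e)) (All.lookup q z∈))))
  where
  least : ∀ {a b bs} → All (b <_) bs → a ∈ b ∷ bs → b ≤ a
  least _ (here refl) = ≤-refl
  least q (there a∈) = <⇒≤ (All.lookup q a∈)
  x≡y : x ≡ y
  x≡y = ≤-antisym (least p (g (here refl))) (least q (f (here refl)))
  tail-of : ∀ {a b bs} → All (b <_) bs → a ∈ b ∷ bs → a ≢ b → a ∈ bs
  tail-of _ (here refl) ne = ⊥-elim (ne refl)
  tail-of _ (there a∈) _ = a∈

increasing-split : ∀ xs {ys} → Increasing (xs ++ ys) → Increasing xs × Increasing ys × (∀ {x y} → x ∈ xs → y ∈ ys → x < y)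
increasing-split [] p = [] , p , λ ()
increasing-split (x ∷ xs) (p ∷ ps) with increasing-split xs ps
... | q , r , s = Allₚ.++⁻ˡ xs p ∷ q , r , λ where
  (here refl) y∈ → All.lookup p (∈-++⁺ʳ xs y∈)
  (there x∈) y∈ → s x∈ y∈

increasing-++ : ∀ {xs ys} → Increasing xs → Increasing ys → (∀ {x y} → x ∈ xs → y ∈ ys → x < y) → Increasing (xs ++ ys)
increasing-++ p q r = AllPairsₚ.++⁺ p q (All.tabulate (λ x∈ → All.tabulate (λ y∈ → r x∈ y∈)))

-- One edge per vertex other than the largest, sorted by its lower end: the edge list is the graph
-- of a parent function. Connectedness and acyclicity are then consequences and need not be carried
-- along.
record Tree (G : Graph) (Vs : List ℕ) (Ed : List (ℕ × ℕ)) : Set where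
  constructor tree
  field
    {below}    : List ℕ
    {top}      : ℕ
    vertices   : Vs ≡ below ++ top ∷ []
    sources    : map proj₁ Ed ≡ below
    increasing : Increasing Vs
    edges      : ∀ {u w} → (u , w) ∈ Ed → u < w × w ∈ Vs × E G u w ≡ true

  source∈ : ∀ {u w} → (u , w) ∈ Ed → u ∈ Vs
  source∈ e∈ = subst (_ ∈_) (sym vertices) (∈-++⁺ˡ (subst (_ ∈_) sources (∈-map⁺ proj₁ e∈)))

  ≤top : ∀ {v} → v ∈ Vs → v ≤ top
  ≤top v∈ with ∈-++⁻ below (subst (_ ∈_) vertices v∈)
  ... | inj₁ q = <⇒≤ (proj₂ (proj₂ (increasing-split below (subst Increasing vertices increasing))) q (here refl))
  ... | inj₂ (here refl) = ≤-refl

  parent : ∀ {v} → v ∈ Vs → v ≢ top → ∃ λ w → (v , w) ∈ Ed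
  parent v∈ ne with ∈-++⁻ below (subst (_ ∈_) vertices v∈)
  ... | inj₂ (here e) = ⊥-elim (ne e)
  ... | inj₁ q with ∈-map⁻ proj₁ (subst (_ ∈_) (sym sources) q)
  ... | (u , w) , e∈ , refl = w , e∈

  increasing-sources : Increasing (map proj₁ Ed)
  increasing-sources = subst Increasing (sym sources) (proj₁ (increasing-split below (subst Increasing vertices increasing)))

  parent-unique : ∀ {v w w'} → (v , w) ∈ Ed → (v , w') ∈ Ed → w ≡ w'
  parent-unique = go increasing-sources
    where
    go : ∀ {es v w w'} → Increasing (map proj₁ es) → (v , w) ∈ es → (v , w') ∈ es → w ≡ w'
    go (_ ∷ _) (here refl) (here refl) = refl
    go (p ∷ _) (here refl) (there q) = ⊥-elim (<-irrefl refl (All.lookup p (∈-map⁺ proj₁ q)))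
    go (p ∷ _) (there q) (here refl) = ⊥-elim (<-irrefl refl (All.lookup p (∈-map⁺ proj₁ q)))
    go (_ ∷ p) (there q) (there q') = go p q q'

joined-sym : ∀ {Ed u v} → Joined Ed u v → Joined Ed v u
joined-sym (inj₁ p) = inj₂ p
joined-sym (inj₂ p) = inj₁ p

reach-trans : ∀ {Ed u v w} → Reach Ed u v → Reach Ed v w → Reach Ed u w
reach-trans here q = q
reach-trans (step a p) q = step a (reach-trans p q)

reach-sym : ∀ {Ed u v} → Reach Ed u v → Reach Ed v u
reach-sym here = here
reach-sym {Ed} (step {u} {w} a p) = reach-trans (reach-sym p) (step (adj-intro Ed (joined-sym (adj-elim Ed {u} {w} a))) here)

maxL-top : ∀ xs {m} → (∀ {x} → x ∈ xs → x < m) → maxL (xs ++ m ∷ []) ≡ m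
maxL-top [] p = ⊔-identityʳ _
maxL-top (x ∷ xs) p = trans (cong (x ⊔_) (maxL-top xs (p ∘ there))) (m≤n⇒m⊔n≡n (<⇒≤ (p (here refl))))

singleton-filter : ∀ (p : ℕ → Bool) {w} xs → Increasing xs → w ∈ xs → p w ≡ true → (∀ {x} → x ∈ xs → p x ≡ true → x ≡ w) →
                   length (filterᵇ p xs) ≡ 1
singleton-filter p (x ∷ xs) (lt ∷ inc) (here refl) pw only rewrite pw =
  cong (suc ∘ length) (filter-empty p xs λ z∈ → not-true⇒false λ q → <-irrefl (sym (only (there z∈) q)) (All.lookup lt z∈))
singleton-filter p (x ∷ xs) (lt ∷ inc) (there w∈) pw only with p x in e
... | true = ⊥-elim (<-irrefl (only (here refl) e) (All.lookup lt w∈))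
... | false = singleton-filter p xs inc w∈ pw (only ∘ there)

length-one : ∀ {A : Set} {xs : List A} {x y} → length xs ≡ 1 → x ∈ xs → y ∈ xs → x ≡ y
length-one {xs = _ ∷ []} _ (here refl) (here refl) = refl

module FromTree {G Vs Ed} (t : Tree G Vs Ed) where
  open Tree t

  maximum : maxL Vs ≡ top
  maximum = trans (cong maxL vertices) (maxL-top below λ x∈ → proj₂ (proj₂ (increasing-split below (subst Increasing vertices increasing))) x∈ (here refl))

  private
    -- `k` is fuel: parents increase, so at most `top - v` steps lead to the largest vertex.
    climb : ∀ k {v} → v ∈ Vs → top ≤ k + v → Reach Ed v top
    climb k {v} v∈ le with v ≟ top
    ... | yes refl = here
    climb zero v∈ le | no ne = ⊥-elim (ne (≤-antisym (≤top v∈) le))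
    climb (suc k) {v} v∈ le | no ne with parent v∈ ne
    ... | w , e∈ with edges e∈
    ... | u<w , w∈ , _ = step (adj-intro Ed (inj₁ e∈)) (climb k w∈ (balance-≤ (+-mono-≤ le u<w) (solve 4 (λ i j k l → i :+ (con 1 :+ (j :+ l) :+ k) := j :+ k :+ (i :+ (con 1 :+ l))) refl top k w v)))

  connected : ∀ u v → u ∈ Vs → v ∈ Vs → Reach Ed u v
  connected u v u∈ v∈ = reach-trans (climb top u∈ (m≤m+n top u)) (reach-sym (climb top v∈ (m≤m+n top v)))

  private
    data Climbs (u : ℕ) : ℕ → Set where
      here : Climbs u u
      step : ∀ {v w} → (v , w) ∈ Ed → Climbs u w → Climbs u v

    climbs-≤ : ∀ {u v} → Climbs u v → v ≤ u
    climbs-≤ here = ≤-refl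
    climbs-≤ (step e∈ c) = ≤-trans (<⇒≤ (proj₁ (edges e∈))) (climbs-≤ c)

    removed : ∀ {es : List (ℕ × ℕ)} → Increasing (map proj₁ es) → ∀ (k : Fin (length es)) {e} → e ∈ removeAt es k →
              e ∈ es × proj₁ e ≢ proj₁ (lookup es k)
    removed {e ∷ es} (p ∷ _) zero q = there q , λ r → <-irrefl (sym r) (All.lookup p (∈-map⁺ proj₁ q))
    removed {e ∷ es} (p ∷ _) (suc k) (here refl) = here refl , λ r → <-irrefl r (All.lookup p (∈-map⁺ proj₁ (lookup∈ es k)))
      where
      lookup∈ : ∀ (xs : List (ℕ × ℕ)) i → lookup xs i ∈ xs
      lookup∈ (x ∷ xs) zero = here refl
      lookup∈ (x ∷ xs) (suc i) = there (lookup∈ xs i)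
    removed {e ∷ es} (_ ∷ p) (suc k) (there q) with removed p k q
    ... | q' , r = there q' , r

    lookup∈′ : ∀ (xs : List (ℕ × ℕ)) i → lookup xs i ∈ xs
    lookup∈′ (x ∷ xs) zero = here refl
    lookup∈′ (x ∷ xs) (suc i) = there (lookup∈′ xs i)

  -- Removing the edge from u to its parent leaves the set of descendants of u closed under adjacency.
  acyclic : ∀ (k : Fin (length Ed)) → ¬ Reach (removeAt Ed k) (proj₁ (lookup Ed k)) (proj₂ (lookup Ed k))
  acyclic k path = <⇒≱ (proj₁ (edges (lookup∈′ Ed k))) (climbs-≤ (invariant path here))
    where
    u = proj₁ (lookup Ed k)
    invariant : ∀ {x y} → Reach (removeAt Ed k) x y → Climbs u x → Climbs u y
    invariant here c = c
    invariant (step {x} {w} a path) c with adj-elim (removeAt Ed k) {x} {w} a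
    ... | inj₂ e∈ = invariant path (step (proj₁ (removed increasing-sources k e∈)) c)
    ... | inj₁ e∈ with removed increasing-sources k e∈ | c
    ... | _ , ne | here = ⊥-elim (ne refl)
    ... | e∈′ , _ | step f∈ c' = invariant path (subst (Climbs u) (parent-unique f∈ e∈′) c')

  isDecSubtree : IsDecSubtree G Vs Ed
  isDecSubtree = record
    { nonempty = subst (λ xs → 1 ≤ length xs) (sym vertices) (subst (1 ≤_) (sym (length-++ below)) (m≤n+m 1 (length below)))
    ; V-canon = Linkedₚ.AllPairs⇒Linked increasing
    ; Ed-orient = All.tabulate (proj₁ ∘ edges)
    ; Ed-canon = Linked.map inj₁ (Linkedₚ.map⁻ {f = proj₁} (Linkedₚ.AllPairs⇒Linked increasing-sources))
    ; subgraph = All.tabulate (λ e∈ → source∈ e∈ , proj₂ (edges e∈))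
    ; connected = connected
    ; acyclic = acyclic
    ; decreasing = λ v v∈ ne → decr v v∈ (λ e → ne (trans e (sym maximum)))
    }
    where
    decr : ∀ v → v ∈ Vs → v ≢ top → length (largerNbrs Vs Ed v) ≡ 1
    decr v v∈ ne with parent v∈ ne
    ... | w , e∈ = singleton-filter _ Vs increasing (proj₁ (proj₂ (edges e∈)))
                     (subst₂ (λ a b → a ∧ b ≡ true) (sym (<ᵇ-intro (proj₁ (edges e∈)))) (sym (adj-intro Ed (inj₁ e∈))) refl) uniq
      where
      uniq : ∀ {x} → x ∈ Vs → (v <ᵇ x) ∧ adjT Ed v x ≡ true → x ≡ w
      uniq {x} _ q with ∧-true {v <ᵇ x} q
      ... | lt , a with adj-elim Ed {v} {x} a
      ... | inj₁ f∈ = parent-unique f∈ e∈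
      ... | inj₂ f∈ = ⊥-elim (<-asym (<ᵇ-true lt) (proj₁ (edges f∈)))

snoc-view : ∀ {A : Set} (xs : List A) → 1 ≤ length xs → ∃ λ ys → ∃ λ y → xs ≡ ys ++ y ∷ []
snoc-view (x ∷ []) _ = [] , x , refl
snoc-view (x ∷ y ∷ xs) _ with snoc-view (y ∷ xs) (s≤s z≤n)
... | ys , z , e = x ∷ ys , z , cong (x ∷_) e

module ToTree {G Vs Ed} (d : IsDecSubtree G Vs Ed) where
  open IsDecSubtree d

  private
    increasing : Increasing Vs
    increasing = Linkedₚ.Linked⇒AllPairs <-trans V-canon
    vs = proj₁ (snoc-view Vs nonempty)
    m  = proj₁ (proj₂ (snoc-view Vs nonempty))
    eq : Vs ≡ vs ++ m ∷ []
    eq = proj₂ (proj₂ (snoc-view Vs nonempty))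
    parts = increasing-split vs (subst Increasing eq increasing)
    max≡ : maxL Vs ≡ m
    max≡ = trans (cong maxL eq) (maxL-top vs λ x∈ → proj₂ (proj₂ parts) x∈ (here refl))

    edge : ∀ {u w} → (u , w) ∈ Ed → u < w × u ∈ Vs × w ∈ Vs × E G u w ≡ true
    edge e∈ = All.lookup Ed-orient e∈ , All.lookup subgraph e∈

    bounded : ∀ {v} → v ∈ Vs → v ≤ m
    bounded v∈ with ∈-++⁻ vs (subst (_ ∈_) eq v∈)
    ... | inj₁ q = <⇒≤ (proj₂ (proj₂ parts) q (here refl))
    ... | inj₂ (here refl) = ≤-refl

    source : ∀ {u w} → (u , w) ∈ Ed → u ∈ vs
    source e∈ with edge e∈
    ... | lt , u∈ , w∈ , _ with ∈-++⁻ vs (subst (_ ∈_) eq u∈)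
    ... | inj₁ q = q
    ... | inj₂ (here refl) = ⊥-elim (<⇒≱ lt (bounded w∈))

    single : ∀ {v} → v ∈ vs → length (largerNbrs Vs Ed v) ≡ 1
    single v∈ = decreasing _ (subst (_ ∈_) (sym eq) (∈-++⁺ˡ v∈)) λ e → <-irrefl (trans e max≡) (proj₂ (proj₂ parts) v∈ (here refl))

    neighbour : ∀ {u w} → (u , w) ∈ Ed → w ∈ largerNbrs Vs Ed u
    neighbour e∈ with edge e∈
    ... | lt , _ , w∈ , _ = filter-intro _ Vs w∈ (subst₂ (λ a b → a ∧ b ≡ true) (sym (<ᵇ-intro lt)) (sym (adj-intro Ed (inj₁ e∈))) refl)

    target : ∀ {v} → v ∈ vs → ∃ λ w → (v , w) ∈ Ed
    target {v} v∈ with largerNbrs Vs Ed v in e | single v∈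
    ... | w ∷ [] | _ with filter-elim _ Vs (subst (w ∈_) (sym e) (here refl))
    ...   | _ , q with ∧-true {v <ᵇ w} q
    ...     | lt , a with adj-elim Ed {v} {w} a
    ...       | inj₁ e∈ = w , e∈
    ...       | inj₂ e∈ = ⊥-elim (<-asym (<ᵇ-true lt) (proj₁ (edge e∈)))

    <ₑ-trans : ∀ {e f g} → e <ₑ f → f <ₑ g → e <ₑ g
    <ₑ-trans (inj₁ p) (inj₁ q) = inj₁ (<-trans p q)
    <ₑ-trans (inj₁ p) (inj₂ (refl , _)) = inj₁ p
    <ₑ-trans (inj₂ (refl , _)) (inj₁ q) = inj₁ q
    <ₑ-trans (inj₂ (refl , p)) (inj₂ (refl , q)) = inj₂ (refl , <-trans p q)

    -- Two edges with the same lower end would give that vertex two larger neighbours, so the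
    -- lexicographic order is already strict in the first coordinate.
    sources-increasing : ∀ {es} → (∀ {e} → e ∈ es → e ∈ Ed) → AllPairs _<ₑ_ es → Increasing (map proj₁ es)
    sources-increasing {[]} sub [] = []
    sources-increasing {(u , w) ∷ es} sub (p ∷ ps) =
      Allₚ.map⁺ (All.tabulate λ {e} e∈ → strict e∈ (All.lookup p e∈)) ∷ sources-increasing (sub ∘ there) ps
      where
      strict : ∀ {e} → e ∈ es → (u , w) <ₑ e → u < proj₁ e
      strict e∈ (inj₁ lt) = lt
      strict e∈ (inj₂ (refl , lt)) = ⊥-elim (<-irrefl (length-one (single (source (sub (here refl)))) (neighbour (sub (here refl))) (neighbour (sub (there e∈)))) lt)

  toTree : Tree G Vs Ed
  toTree = tree eq
    (increasing-ext (sources-increasing id (Linkedₚ.Linked⇒AllPairs <ₑ-trans Ed-canon)) (proj₁ parts)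
      (λ x∈ → case ∈-map⁻ proj₁ x∈ of λ where (_ , e∈ , refl) → source e∈)
      (λ x∈ → ∈-map⁺ proj₁ (proj₂ (target x∈))))
    increasing (λ e∈ → proj₁ (edge e∈) , proj₂ (proj₂ (edge e∈)))

-- Reading words

Unique : List ℕ → Set
Unique = AllPairs _≢_

increasing⇒unique : ∀ {xs} → Increasing xs → Unique xs
increasing⇒unique = AllPairs.map (λ lt e → <-irrefl e lt)

unique-↭ : ∀ {xs ys} → xs ↭ ys → Unique xs → Unique ys
unique-↭ _↭_.refl u = u
unique-↭ (_↭_.prep x p) (q ∷ u) = Perm.All-resp-↭ p q ∷ unique-↭ p u
unique-↭ (_↭_.swap x y p) ((q ∷ qs) ∷ (q' ∷ u)) = ((λ e → q (sym e)) ∷ Perm.All-resp-↭ p q') ∷ Perm.All-resp-↭ p qs ∷ unique-↭ p u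
unique-↭ (_↭_.trans p q) u = unique-↭ q (unique-↭ p u)

unique-++⁻ : ∀ xs {ys} → Unique (xs ++ ys) → Unique xs × Unique ys × (∀ {x} → x ∈ xs → x ∉ ys)
unique-++⁻ [] u = [] , u , λ ()
unique-++⁻ (x ∷ xs) (p ∷ u) with unique-++⁻ xs u
... | q , r , s = Allₚ.++⁻ˡ xs p ∷ q , r , λ where
  (here refl) y∈ → All.lookup p (∈-++⁺ʳ xs y∈) refl
  (there x∈) y∈ → s x∈ y∈

∉-before : ∀ xs {v ys} → Unique (xs ++ v ∷ ys) → v ∉ xs
∉-before xs u v∈ = proj₂ (proj₂ (unique-++⁻ xs u)) v∈ (here refl)

∉-after : ∀ xs {v ys} → Unique (xs ++ v ∷ ys) → v ∉ ys
∉-after xs u v∈ with proj₁ (proj₂ (unique-++⁻ xs u))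
... | p ∷ _ = All.lookup p v∈ refl

recast : ∀ {x : ℕ} {xs ys} → xs ≡ ys → x ∈ xs → x ∈ ys
recast refl x∈ = x∈

∈-reverse : ∀ {x : ℕ} xs → x ∈ reverse xs → x ∈ xs
∈-reverse xs = Perm.∈-resp-↭ (Perm.↭-reverse xs)

∈-reverse⁺ : ∀ {x : ℕ} xs → x ∈ xs → x ∈ reverse xs
∈-reverse⁺ xs = Perm.∈-resp-↭ (↭-sym (Perm.↭-reverse xs))

reverse-mid : ∀ (xs : List ℕ) v ys → reverse (xs ++ v ∷ ys) ≡ reverse ys ++ v ∷ reverse xs
reverse-mid xs v ys = trans (reverse-++ xs (v ∷ ys)) (trans (cong (_++ reverse xs) (unfold-reverse v ys)) (++-assoc (reverse ys) _ _))

firstGt : ℕ → List ℕ → ℕ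
firstGt v []       = 0
firstGt v (x ∷ xs) = if v <ᵇ x then x else firstGt v xs

firstGt-here : ∀ {v x} xs → v < x → firstGt v (x ∷ xs) ≡ x
firstGt-here xs lt rewrite <ᵇ-intro lt = refl

firstGt-skip : ∀ {v} xs {ys} → (∀ {x} → x ∈ xs → x ≤ v) → firstGt v (xs ++ ys) ≡ firstGt v ys
firstGt-skip [] _ = refl
firstGt-skip (x ∷ xs) p rewrite <ᵇ-false (p (here refl)) = firstGt-skip xs (p ∘ there)

firstGt-∈ : ∀ {v y} xs {ys} → y ∈ xs → v < y → firstGt v (xs ++ ys) ∈ xs × v < firstGt v (xs ++ ys)
firstGt-∈ {v} (x ∷ xs) y∈ lt with v <ᵇ x in e
... | true = here refl , <ᵇ-true e
firstGt-∈ (x ∷ xs) (here refl) lt | false = true≢false (<ᵇ-intro lt) e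
firstGt-∈ (x ∷ xs) (there y∈) lt | false with firstGt-∈ xs y∈ lt
... | q , r = there q , r

-- In the increasing-children preorder the parent of v is the nearest larger letter before v;
-- if there is none, v lies on the path from the first letter to the root, and its parent is the next larger letter.
parentFrom : List ℕ → List ℕ → ℕ → ℕ
parentFrom seen []       v = 0
parentFrom seen (x ∷ xs) v = if x ≡ᵇ v then firstGt v (seen ++ xs) else parentFrom (x ∷ seen) xs v

parentIn : List ℕ → ℕ → ℕ
parentIn = parentFrom []

parentIn-split : ∀ xs v ys → v ∉ xs → parentIn (xs ++ v ∷ ys) v ≡ firstGt v (reverse xs ++ ys)
parentIn-split xs v ys v∉ = trans (go [] xs v∉) (cong (λ l → firstGt v (l ++ ys)) (++-identityʳ (reverse xs)))
  where
  go : ∀ seen xs → v ∉ xs → parentFrom seen (xs ++ v ∷ ys) v ≡ firstGt v ((reverse xs ++ seen) ++ ys)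
  go seen [] _ rewrite ≡ᵇ-refl v = refl
  go seen (x ∷ xs) v∉ rewrite ≡ᵇ-false {x} {v} (λ e → v∉ (here (sym e))) =
    trans (go (x ∷ seen) xs (v∉ ∘ there))
      (cong (λ l → firstGt v (l ++ ys)) (sym (trans (cong (_++ seen) (unfold-reverse x xs)) (++-assoc (reverse xs) (x ∷ []) seen))))

Candidate : List ℕ → List (ℕ × ℕ) → List ℕ → ℕ → Set
Candidate Vs Ed rd v = v ∈ Vs × v ∉ rd × (∃ λ u → u ∈ rd × Joined Ed u v)

-- The reading procedure as a relation, free of fuel and of Boolean tests, so that reading orders of
-- glued, shifted or word-defined trees can be built by induction.
data Greedy (Vs : List ℕ) (Ed : List (ℕ × ℕ)) : List ℕ → List ℕ → Set where
  done : ∀ {rd} → (∀ {v} → v ∈ Vs → v ∈ rd) → Greedy Vs Ed rd []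
  next : ∀ {rd v rest} → Candidate Vs Ed rd v → (∀ {z} → Candidate Vs Ed rd z → v ≤ z) →
         Greedy Vs Ed (rd ++ v ∷ []) rest → Greedy Vs Ed rd (v ∷ rest)

module _ {Vs : List ℕ} {Ed : List (ℕ × ℕ)} where
  private
    test : List ℕ → ℕ → Bool
    test rd v = not (memB v rd) ∧ any (λ u → adjT Ed u v) rd

    test-elim : ∀ rd {v} → v ∈ Vs → test rd v ≡ true → Candidate Vs Ed rd v
    test-elim rd {v} v∈ q with ∧-true {not (memB v rd)} q
    ... | q₁ , q₂ with any-elim (λ u → adjT Ed u v) rd q₂
    ... | u , u∈ , a = v∈ , (λ v∈rd → true≢false q₁ (cong not (memB-intro v∈rd))) , u , u∈ , adj-elim Ed {u} {v} a

    test-intro : ∀ rd {v} → Candidate Vs Ed rd v → test rd v ≡ true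
    test-intro rd (_ , v∉ , u , u∈ , j) rewrite memB-false v∉ = any-intro _ u∈ (adj-intro Ed j)

  -- `nextV` keeps the order of the sorted vertex list, so its first entry is the least candidate.
  filter-least : ∀ p {v} xs → Increasing xs → v ∈ xs → p v ≡ true → (∀ {z} → z ∈ xs → p z ≡ true → v ≤ z) →
                 ∃ λ tl → filterᵇ p xs ≡ v ∷ tl
  filter-least p (x ∷ xs) (_ ∷ _) (here refl) pv _ rewrite pv = _ , refl
  filter-least p (x ∷ xs) (q ∷ inc) (there v∈) pv least with p x in e
  ... | true = ⊥-elim (<⇒≱ (All.lookup q v∈) (least (here refl) e))
  ... | false = filter-least p xs inc v∈ pv (least ∘ there)

  greedy-read : Increasing Vs → ∀ {f rd rest} → Greedy Vs Ed rd rest → length rest ≤ f → readT f Vs Ed rd ≡ rd ++ rest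
  greedy-read inc {zero} {rd} (done _) _ = sym (++-identityʳ rd)
  greedy-read inc {suc f} {rd} (done all) _
    rewrite filter-empty (test rd) Vs (λ {x} x∈ → cong (λ b → not b ∧ any (λ u → adjT Ed u x) rd) (memB-intro (all x∈))) = sym (++-identityʳ rd)
  greedy-read inc {suc f} {rd} (next {v = v} {rest} c least g) (s≤s le)
    with filterᵇ (test rd) Vs | filter-least (test rd) Vs inc (proj₁ c) (test-intro rd c) (λ z∈ q → least (test-elim rd z∈ q))
  ... | _ ∷ _ | tl , refl = trans (greedy-read inc g le) (++-assoc rd (v ∷ []) rest)

  module _ {G} (t : Tree G Vs Ed) where
    open Tree t
    private
      -- The first unread vertex on a path that starts among the read ones is a candidate;
      -- connectedness thus keeps the reading from stalling.
      crossing : ∀ {rd un s z} → rd ++ un ↭ Vs → s ∈ rd → z ∉ rd → Reach Ed s z → ∃ λ v → Candidate Vs Ed rd v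
      crossing p s∈ z∉ here = ⊥-elim (z∉ s∈)
      crossing {rd} p s∈ z∉ (step {u} {w} a path) with memB w rd in e
      ... | true = crossing p (memB-elim rd e) z∉ path
      ... | false = w , endpoint (adj-elim Ed {u} {w} a) , (λ w∈ → true≢false (memB-intro w∈) e) , u , s∈ , adj-elim Ed {u} {w} a
        where
        endpoint : Joined Ed u w → w ∈ Vs
        endpoint (inj₁ e∈) = proj₁ (proj₂ (edges e∈))
        endpoint (inj₂ e∈) = source∈ e∈

    greedy-exists : ∀ k {rd un s} → length un ≡ k → s ∈ rd → rd ++ un ↭ Vs → ∃ λ rest → Greedy Vs Ed rd rest × rest ↭ un
    greedy-exists zero {rd} {[]} _ _ p = [] , done (λ v∈ → recast (++-identityʳ rd) (Perm.∈-resp-↭ (↭-sym p) v∈)) , ↭-refl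
    greedy-exists (suc k) {rd} {z ∷ un} {s} len s∈ p
      with crossing p s∈ (∉-z) (FromTree.connected t s z (Perm.∈-resp-↭ p (∈-++⁺ˡ s∈)) (Perm.∈-resp-↭ p (∈-++⁺ʳ rd (here refl))))
      where
      ∉-z : z ∉ rd
      ∉-z z∈ = proj₂ (proj₂ (unique-++⁻ rd (unique-↭ (↭-sym p) (increasing⇒unique increasing)))) z∈ (here refl)
    ... | v₀ , c₀ with filterᵇ (test rd) Vs in e | filter-intro (test rd) Vs (proj₁ c₀) (test-intro rd c₀) | AllPairsₚ.filter⁺ (Data.Bool.T? ∘ test rd) increasing
    ... | v ∷ tl | _ | lts ∷ _ with test-elim rd (proj₁ (filter-elim (test rd) Vs (subst (v ∈_) (sym e) (here refl)))) (proj₂ (filter-elim (test rd) Vs (subst (v ∈_) (sym e) (here refl))))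
    ... | c@(v∈ , v∉ , _) with ∈-++⁻ rd (Perm.∈-resp-↭ (↭-sym p) v∈)
    ... | inj₁ v∈rd = ⊥-elim (v∉ v∈rd)
    ... | inj₂ v∈un with ∈-∃++ v∈un
    ... | xs , ys , un≡ with greedy-exists k {rd ++ v ∷ []} {xs ++ ys} {s}
            (suc-injective (trans (sym (Perm.↭-length (Perm.shift v xs ys))) (trans (cong length (sym un≡)) len)))
            (∈-++⁺ˡ s∈)
            (↭-trans (↭-reflexive (++-assoc rd (v ∷ []) (xs ++ ys))) (↭-trans (Perm.++⁺ˡ rd (↭-trans (↭-sym (Perm.shift v xs ys)) (↭-reflexive (sym un≡)))) p))
    ... | rest , g , q = v ∷ rest , next c least g , ↭-trans (↭-prep v q) (↭-trans (↭-sym (Perm.shift v xs ys)) (↭-reflexive (sym un≡)))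
      where
      least : ∀ {z} → Candidate Vs Ed rd z → v ≤ z
      least {z} cz with subst (z ∈_) e (filter-intro (test rd) Vs (proj₁ cz) (test-intro rd cz))
      ... | here refl = ≤-refl
      ... | there z∈ = <⇒≤ (All.lookup lts z∈)

  greedy-at : ∀ {rd rest} → Greedy Vs Ed rd rest → ∀ xs {y ys} → rest ≡ xs ++ y ∷ ys →
              Candidate Vs Ed (rd ++ xs) y × (∀ {z} → Candidate Vs Ed (rd ++ xs) z → y ≤ z)
  greedy-at {rd} (next c l g) [] refl = subst (λ r → Candidate Vs Ed r _ × (∀ {z} → Candidate Vs Ed r z → _ ≤ z)) (sym (++-identityʳ rd)) (c , l)
  greedy-at {rd} (next {v = v} c l g) (x ∷ xs) refl =
    subst (λ r → Candidate Vs Ed r _ × (∀ {z} → Candidate Vs Ed r z → _ ≤ z)) (++-assoc rd (v ∷ []) xs) (greedy-at g xs refl)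

minL-head : ∀ {m xs} → Increasing (m ∷ xs) → minL (m ∷ xs) ≡ m ∷ []
minL-head {m} {xs} (p ∷ _) = cong (_∷ []) (go xs p)
  where
  go : ∀ xs → All (m <_) xs → foldr _⊓_ m xs ≡ m
  go [] [] = refl
  go (x ∷ xs) (q ∷ qs) = trans (cong (x ⊓_) (go xs qs)) (m≥n⇒m⊓n≡n (<⇒≤ q))

listT-greedy : ∀ {m V' Ed α r w} → Increasing (m ∷ V') → Greedy (m ∷ V') Ed (m ∷ []) w → w ↭ V' → listT (tt (m ∷ V') Ed α r) ≡ m ∷ w
listT-greedy {m} {V'} {Ed} {w = w} inc g p = trans (cong (readT (length (m ∷ V')) (m ∷ V') Ed) (minL-head inc))
  (greedy-read inc g (≤-trans (≤-reflexive (Perm.↭-length p)) (n≤1+n _)))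

tree-head : ∀ {G Vs Ed} → Tree G Vs Ed → ∃ λ m → ∃ λ V' → Vs ≡ m ∷ V'
tree-head (tree {[]} e _ _ _) = _ , _ , e
tree-head (tree {_ ∷ _} e _ _ _) = _ , _ , e

tree-reading : ∀ {G m V' Ed} → Tree G (m ∷ V') Ed → ∃ λ w → Greedy (m ∷ V') Ed (m ∷ []) w × w ↭ V'
tree-reading {V' = V'} t = greedy-exists t (length V') refl (here refl) ↭-refl

module Parents {G m V' Ed w} (t : Tree G (m ∷ V') Ed) (g : Greedy (m ∷ V') Ed (m ∷ []) w) (p : w ↭ V') where
  open Tree t
  private
    σ = m ∷ w
    Vs = m ∷ V'
    uniq : Unique σ
    uniq = unique-↭ (↭-sym (↭-prep m p)) (increasing⇒unique increasing)

    inV : ∀ {z} → z ∈ σ → z ∈ Vs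
    inV = Perm.∈-resp-↭ (↭-prep m p)

    at : ∀ {x} xs {y ys} → x ∈ xs → σ ≡ xs ++ y ∷ ys →
         Candidate Vs Ed xs y × (∀ {z} → Candidate Vs Ed xs z → y ≤ z)
    at (x ∷ xs) _ e with ∷-injective e
    ... | refl , e' = greedy-at g xs e'

    split-∉ : ∀ xs {v ys} → σ ≡ xs ++ v ∷ ys → (v ∉ xs) × (v ∉ ys) × (∀ {x} → x ∈ xs → x ∉ ys)
    split-∉ xs e with subst Unique e uniq
    ... | u = ∉-before xs u , ∉-after xs u , λ x∈ y∈ → proj₂ (proj₂ (unique-++⁻ xs u)) x∈ (there y∈)

    -- v is a candidate as soon as u is read, so the greedy rule takes smaller vertices until v itself.
    between : ∀ u {v} xs ys zs → σ ≡ xs ++ u ∷ (ys ++ v ∷ zs) → Joined Ed u v → ∀ {x} → x ∈ ys → x < v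
    between u {v} xs ys zs e j {x} x∈ with ∈-∃++ x∈
    ... | y₁ , y₂ , refl = ≤∧≢⇒< (proj₂ (at pre u∈ e') (inV v∈σ , v∉ , u , u∈ , j)) λ x≡v → proj₁ (proj₂ (split-∉ pre e')) (subst (_∈ y₂ ++ v ∷ zs) (sym x≡v) (∈-insert y₂))
      where
      pre = xs ++ u ∷ y₁
      u∈ : u ∈ pre
      u∈ = ∈-insert xs
      e' : σ ≡ pre ++ x ∷ (y₂ ++ v ∷ zs)
      e' = trans e (trans (cong (λ l → xs ++ u ∷ l) (++-assoc y₁ (x ∷ y₂) (v ∷ zs))) (sym (++-assoc xs (u ∷ y₁) _)))
      v∈σ : v ∈ σ
      v∈σ = subst (v ∈_) (sym e') (∈-++⁺ʳ pre (there (∈-insert y₂)))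
      v∉ : v ∉ pre
      v∉ v∈ = proj₂ (proj₂ (split-∉ pre e')) v∈ (∈-insert y₂)

    -- Some neighbour of `v` is read before `v`. As the parent `q` comes later, that neighbour is a
    -- child `u`, itself read before its parent; the claim for `u` covers what precedes `u`, and
    -- `between` covers the rest.
    before-max : ∀ k {v q} xs ys → length xs ≤ k → σ ≡ xs ++ v ∷ ys → (v , q) ∈ Ed → q ∈ ys → ∀ {x} → x ∈ xs → x < v
    before-max k {v} {q} xs ys le e e∈ q∈ {x} x∈ with proj₁ (at xs x∈ e)
    ... | _ , v∉ , u , u∈ , inj₂ f∈ = ⊥-elim (proj₂ (proj₂ (split-∉ xs e)) u∈ (subst (_∈ ys) (parent-unique e∈ f∈) q∈))
    ... | _ , v∉ , u , u∈ , inj₁ f∈ with ∈-∃++ u∈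
    before-max zero xs ys () e e∈ q∈ x∈ | _ , v∉ , u , u∈ , inj₁ f∈ | [] , xs₂ , refl
    before-max zero xs ys () e e∈ q∈ x∈ | _ , v∉ , u , u∈ , inj₁ f∈ | _ ∷ _ , xs₂ , refl
    before-max (suc k) {v} xs ys le e e∈ q∈ x∈ | _ , v∉ , u , u∈ , inj₁ f∈ | xs₁ , xs₂ , refl with ∈-++⁻ xs₁ x∈
    ... | inj₁ x∈₁ = <-trans (before-max k xs₁ (xs₂ ++ v ∷ ys) (balance-slack (length xs₂) (+-mono-≤ le (≤-reflexive (sym (length-++ xs₁ {u ∷ xs₂})))) (solve 4 (λ i j k l → i :+ (con 1 :+ j :+ k) :+ l := j :+ (k :+ (i :+ (con 1 :+ l)))) refl (length xs₁) k (length (xs₁ ++ u ∷ xs₂)) (length xs₂))) (trans e (++-assoc xs₁ (u ∷ xs₂) _)) f∈ (∈-insert xs₂) x∈₁) (proj₁ (edges f∈))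
    ... | inj₂ (here refl) = proj₁ (edges f∈)
    ... | inj₂ (there x∈₂) = between u xs₁ xs₂ ys (trans e (++-assoc xs₁ (u ∷ xs₂) _)) (inj₁ f∈) x∈₂

    prefix-induction : ∀ {P : ℕ → Set} ys → (∀ as z bs → ys ≡ as ++ z ∷ bs → (∀ {y} → y ∈ as → P y) → P z) → ∀ {z} → z ∈ ys → P z
    prefix-induction {P} ys h = go [] ys refl (λ ())
      where
      go : ∀ as bs → ys ≡ as ++ bs → (∀ {y} → y ∈ as → P y) → ∀ {z} → z ∈ bs → P z
      go as (b ∷ bs) e acc z∈ with h as b bs e acc
      go as (b ∷ bs) e acc (here refl) | pb = pb
      go as (b ∷ bs) e acc (there z∈) | pb = go (as ++ b ∷ []) bs (trans e (sym (++-assoc as (b ∷ []) bs))) acc' z∈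
        where
        acc' : ∀ {y} → y ∈ as ++ b ∷ [] → P y
        acc' y∈ with ∈-++⁻ as y∈
        ... | inj₁ q = acc q
        ... | inj₂ (here refl) = pb

    -- Each `z` read between `v` and its parent is joined to an earlier `u`. If `u` is the parent of
    -- `z`, then `z < u ≤ v`. If `z` were the parent of `u`, there would be a contradiction: for `u`
    -- before `v` by induction on the prefix, for `u = v` by uniqueness of the parent, for `u` after
    -- `v` by `before-max`.
    until-parent : ∀ k {v q} xs ys zs → length xs ≤ k → σ ≡ xs ++ v ∷ (ys ++ q ∷ zs) → (v , q) ∈ Ed → ∀ {z} → z ∈ ys → z < v
    until-parent k {v} {q} xs ys zs le e e∈ = prefix-induction ys inner
      where
      lr : ∀ {x} → x ∈ xs → x < v
      lr = before-max k xs (ys ++ q ∷ zs) le e e∈ (∈-insert ys)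
      inner : ∀ as z bs → ys ≡ as ++ z ∷ bs → (∀ {y} → y ∈ as → y < v) → z < v
      inner as z bs ys≡ smaller = go (proj₁ (at (xs ++ v ∷ as) (∈-insert xs) e₂))
        where
        e₂ : σ ≡ (xs ++ v ∷ as) ++ z ∷ (bs ++ q ∷ zs)
        e₂ = trans e (trans (cong (λ l → xs ++ v ∷ (l ++ q ∷ zs)) ys≡)
               (trans (cong (λ l → xs ++ v ∷ l) (++-assoc as (z ∷ bs) (q ∷ zs))) (sym (++-assoc xs (v ∷ as) _))))
        earlier : ∀ {u} → (u , z) ∈ Ed → u ∈ xs → v < u
        earlier {u} f∈ u∈ with ∈-∃++ u∈
        ... | x₁ , x₂ , xs≡ = split k le
          where
          e₃ : σ ≡ x₁ ++ u ∷ ((x₂ ++ v ∷ as) ++ z ∷ (bs ++ q ∷ zs))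
          e₃ = trans e₂ (trans (cong (λ l → (l ++ v ∷ as) ++ z ∷ (bs ++ q ∷ zs)) xs≡)
                 (trans (cong (_++ z ∷ (bs ++ q ∷ zs)) (++-assoc x₁ (u ∷ x₂) (v ∷ as))) (++-assoc x₁ (u ∷ x₂ ++ v ∷ as) _)))
          split : ∀ k → length xs ≤ k → v < u
          split zero l0 = absurd (balance-slack (length x₁ + length x₂) (+-mono-≤ l0 (+-mono-≤ (≤-reflexive (sym (cong length xs≡))) (≤-reflexive (sym (length-++ x₁ {u ∷ x₂}))))) (solve 4 (λ i j k l → con 1 :+ (con 0 :+ (i :+ j)) :+ (k :+ l) := con 0 :+ (i :+ (j :+ (k :+ (con 1 :+ l))))) refl (length xs) (length (x₁ ++ u ∷ x₂)) (length x₁) (length x₂)))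
          split (suc k) l = until-parent k x₁ (x₂ ++ v ∷ as) (bs ++ q ∷ zs) (balance-slack (length x₂) (+-mono-≤ l (+-mono-≤ (≤-reflexive (sym (cong length xs≡))) (≤-reflexive (sym (length-++ x₁ {u ∷ x₂}))))) (solve 5 (λ i j k l m → i :+ (con 1 :+ j :+ (k :+ l)) :+ m := j :+ (k :+ (l :+ (i :+ (con 1 :+ m))))) refl (length x₁) k (length xs) (length (x₁ ++ u ∷ x₂)) (length x₂))) e₃ f∈ (∈-insert x₂)
        later : ∀ {u} → (u , z) ∈ Ed → u ∈ as → v < u
        later {u} f∈ u∈ with ∈-∃++ u∈
        ... | a₁ , a₂ , refl = before-max _ (xs ++ v ∷ a₁) (a₂ ++ z ∷ (bs ++ q ∷ zs)) ≤-refl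
          (trans e₂ (trans (++-assoc xs _ _) (trans (cong (λ l → xs ++ v ∷ l) (++-assoc a₁ (u ∷ a₂) _)) (sym (++-assoc xs (v ∷ a₁) _))))) f∈ (∈-insert a₂) (∈-insert xs)
        go : Candidate Vs Ed (xs ++ v ∷ as) z → z < v
        go (_ , _ , u , u∈ , j) with ∈-++⁻ xs u∈ | j
        ... | inj₁ u∈xs | inj₂ f∈ = <-trans (proj₁ (edges f∈)) (lr u∈xs)
        ... | inj₂ (here refl) | inj₂ f∈ = proj₁ (edges f∈)
        ... | inj₂ (there u∈as) | inj₂ f∈ = <-trans (proj₁ (edges f∈)) (smaller u∈as)
        ... | inj₁ u∈xs | inj₁ f∈ = ⊥-elim (<-asym (lr u∈xs) (earlier f∈ u∈xs))
        ... | inj₂ (here refl) | inj₁ f∈ = ⊥-elim (proj₁ (proj₂ (split-∉ (xs ++ v ∷ as) e₂)) (subst (_∈ bs ++ q ∷ zs) (parent-unique e∈ f∈) (∈-insert bs)))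
        ... | inj₂ (there u∈as) | inj₁ f∈ = ⊥-elim (<-asym (smaller u∈as) (later f∈ u∈as))

  -- If the parent is read before `v`, all letters in between are smaller, so it is the nearest
  -- larger letter to the left. If it is read later, no letter to the left of `v` is larger and the
  -- parent is the first larger one to the right.
  parent≡parentIn : ∀ {v q} → (v , q) ∈ Ed → parentIn σ v ≡ q
  parent≡parentIn {v} {q} e∈ with ∈-∃++ (Perm.∈-resp-↭ (↭-sym (↭-prep m p)) (source∈ e∈)) 
  ... | xs , ys , e with ∈-++⁻ xs (subst (q ∈_) e (Perm.∈-resp-↭ (↭-sym (↭-prep m p)) (proj₁ (proj₂ (edges e∈)))))
  ... | inj₁ q∈ with ∈-∃++ q∈
  ...   | x₁ , x₂ , refl = trans (cong (λ l → parentIn l v) e) (trans (parentIn-split xs v ys (proj₁ (split-∉ xs e)))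
            (trans (cong (λ l → firstGt v (l ++ ys)) (reverse-mid x₁ q x₂)) (trans (cong (firstGt v) (++-assoc (reverse x₂) _ ys))
            (trans (firstGt-skip (reverse x₂) (λ x∈ → <⇒≤ (between q x₁ x₂ ys (trans e (++-assoc x₁ (q ∷ x₂) _)) (inj₂ e∈) (∈-reverse x₂ x∈))))
              (firstGt-here (reverse x₁ ++ ys) (proj₁ (edges e∈)))))))
  parent≡parentIn {v} {q} e∈ | xs , ys , e | inj₂ (here refl) = ⊥-elim (<-irrefl refl (proj₁ (edges e∈)))
  parent≡parentIn {v} {q} e∈ | xs , ys , e | inj₂ (there q∈) with ∈-∃++ q∈
  ...   | y₁ , y₂ , refl = trans (cong (λ l → parentIn l v) e) (trans (parentIn-split xs v ys (proj₁ (split-∉ xs e)))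
            (trans (firstGt-skip (reverse xs) (λ x∈ → <⇒≤ (before-max _ xs ys ≤-refl e e∈ q∈ (∈-reverse xs x∈))))
            (trans (firstGt-skip y₁ (λ x∈ → <⇒≤ (until-parent _ xs y₁ y₂ ≤-refl e e∈ x∈))) (firstGt-here y₂ (proj₁ (edges e∈))))))

front : List ℕ → List ℕ
front []          = []
front (x ∷ [])    = []
front (x ∷ y ∷ l) = x ∷ front (y ∷ l)

front-snoc : ∀ xs x → front (xs ++ x ∷ []) ≡ xs
front-snoc [] x = refl
front-snoc (y ∷ []) x = refl
front-snoc (y ∷ z ∷ xs) x = cong (y ∷_) (front-snoc (z ∷ xs) x)

wordEdges : List ℕ → List ℕ → List (ℕ × ℕ)
wordEdges σ Vs = map (λ v → v , parentIn σ v) (front Vs)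

edges≡wordEdges : ∀ {G m V' Ed w} → Tree G (m ∷ V') Ed → Greedy (m ∷ V') Ed (m ∷ []) w → w ↭ V' → Ed ≡ wordEdges (m ∷ w) (m ∷ V')
edges≡wordEdges {m = m} {V'} {Ed} {w} t g p = trans (go Ed id) (cong (map (λ v → v , parentIn (m ∷ w) v))
    (trans (Tree.sources t) (sym (trans (cong front (Tree.vertices t)) (front-snoc (Tree.below t) (Tree.top t))))))
  where
  go : ∀ es → (∀ {e} → e ∈ es → e ∈ Ed) → es ≡ map (λ v → v , parentIn (m ∷ w) v) (map proj₁ es)
  go [] _ = refl
  go ((v , q) ∷ es) sub = cong₂ _∷_ (cong (v ,_) (sym (Parents.parent≡parentIn t g p (sub (here refl))))) (go es (sub ∘ there))

module WordTree {G : Graph} {m : ℕ} {V' w : List ℕ} (inc : Increasing (m ∷ V')) (p : w ↭ V')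
  (edge : ∀ {u} → u ∈ m ∷ V' → u < parentIn (m ∷ w) u → parentIn (m ∷ w) u ∈ m ∷ V' → E G u (parentIn (m ∷ w) u) ≡ true) where
  private
    σ = m ∷ w
    Vs = m ∷ V'
    Es = wordEdges σ Vs
    perm : σ ↭ Vs
    perm = ↭-prep m p
    uniq : Unique σ
    uniq = unique-↭ (↭-sym perm) (increasing⇒unique inc)
    snoc = snoc-view Vs (s≤s z≤n)
    vs = proj₁ snoc
    top = proj₁ (proj₂ snoc)
    eq : Vs ≡ vs ++ top ∷ []
    eq = proj₂ (proj₂ snoc)
    front≡ : front Vs ≡ vs
    front≡ = trans (cong front eq) (front-snoc vs top)

    below-top : ∀ {v} → v ∈ vs → v < top
    below-top v∈ = proj₂ (proj₂ (increasing-split vs (subst Increasing eq inc))) v∈ (here refl)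

    -- The largest letter stands before or after `v`, so the search in `parentIn` never falls
    -- through to its default 0.
    larger : ∀ {v} → v ∈ vs → v < parentIn σ v × parentIn σ v ∈ σ
    larger {v} v∈ with ∈-∃++ (Perm.∈-resp-↭ (↭-sym perm) (subst (v ∈_) (sym eq) (∈-++⁺ˡ v∈)))
    ... | xs , ys , e rewrite trans (cong (λ l → parentIn l v) e) (parentIn-split xs v ys (∉-before xs (subst Unique e uniq)))
      with ∈-++⁻ xs (subst (top ∈_) e (Perm.∈-resp-↭ (↭-sym perm) (subst (top ∈_) (sym eq) (∈-++⁺ʳ vs (here refl)))))
    ... | inj₂ (here t≡v) = ⊥-elim (<-irrefl (sym t≡v) (below-top v∈))
    ... | inj₁ t∈ with firstGt-∈ (reverse xs) {ys} (∈-reverse⁺ xs t∈) (below-top v∈)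
    ...   | q , lt = lt , recast (sym e) (∈-++⁺ˡ (∈-reverse xs q))
    larger {v} v∈ | xs , ys , e | inj₂ (there t∈) with firstGt-∈ {v} {top} (reverse xs ++ ys) {[]} (∈-++⁺ʳ (reverse xs) t∈) (below-top v∈)
    ...   | q , lt with subst (λ l → firstGt v l ∈ reverse xs ++ ys) (++-identityʳ (reverse xs ++ ys)) q | subst (λ l → v < firstGt v l) (++-identityʳ (reverse xs ++ ys)) lt
    ...     | q' | lt' with ∈-++⁻ (reverse xs) q'
    ...       | inj₁ r = lt' , recast (sym e) (∈-++⁺ˡ (∈-reverse xs r))
    ...       | inj₂ r = lt' , recast (sym e) (∈-++⁺ʳ xs (there r))

    edge-elim : ∀ {u q} → (u , q) ∈ Es → u ∈ vs × q ≡ parentIn σ u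
    edge-elim e∈ with ∈-map⁻ (λ v → v , parentIn σ v) e∈
    ... | v , v∈ , refl = subst (v ∈_) front≡ v∈ , refl

    edge-intro : ∀ {u} → u ∈ vs → (u , parentIn σ u) ∈ Es
    edge-intro u∈ = ∈-map⁺ (λ v → v , parentIn σ v) (recast (sym front≡) u∈)

    nontop : ∀ {u v} → u ∈ Vs → v ∈ Vs → u < v → u ∈ vs
    nontop u∈ v∈ lt with ∈-++⁻ vs (recast eq u∈) | ∈-++⁻ vs (recast eq v∈)
    ... | inj₁ q | _ = q
    ... | inj₂ (here refl) | inj₁ q = ⊥-elim (<-asym lt (below-top q))
    ... | inj₂ (here refl) | inj₂ (here refl) = ⊥-elim (<-irrefl refl lt)

  wordTree : Tree G Vs Es
  wordTree = tree eq (trans (sym (map-∘ (front Vs))) (trans (map-id (front Vs)) front≡)) inc edges'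
    where
    edges' : ∀ {u q} → (u , q) ∈ Es → u < q × q ∈ Vs × E G u q ≡ true
    edges' {u} e∈ with edge-elim e∈
    ... | u∈ , refl with larger u∈
    ... | lt , q∈ = lt , Perm.∈-resp-↭ perm q∈ , edge (subst (u ∈_) (sym eq) (∈-++⁺ˡ u∈)) lt (Perm.∈-resp-↭ perm q∈)

  private
    largest : ∀ x (xs : List ℕ) → ∃ λ M → M ∈ x ∷ xs × (∀ {y} → y ∈ x ∷ xs → y ≤ M)
    largest x [] = x , here refl , λ where (here refl) → ≤-refl
    largest x (y ∷ ys) with largest y ys
    ... | M , M∈ , ub with ≤-total x M
    ... | inj₁ le = M , there M∈ , λ where
      (here refl) → le
      (there z∈) → ub z∈
    ... | inj₂ ge = x , here refl , λ where
      (here refl) → ≤-refl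
      (there z∈) → ≤-trans (ub z∈) ge

    module At (x : ℕ) (xs : List ℕ) (y : ℕ) (ys : List ℕ) (e : σ ≡ (x ∷ xs) ++ y ∷ ys) where
      rd = x ∷ xs
      u-split : Unique (rd ++ y ∷ ys)
      u-split = subst Unique e uniq
      y∈ : y ∈ Vs
      y∈ = Perm.∈-resp-↭ perm (subst (y ∈_) (sym e) (∈-insert rd))
      rd∈ : ∀ {z} → z ∈ rd → z ∈ Vs
      rd∈ z∈ = Perm.∈-resp-↭ perm (recast (sym e) (∈-++⁺ˡ z∈))

      -- Compare `y` with the largest read letter `M`. If `y < M`, the parent of `y` is a read
      -- letter. If `M < y`, the other read letters are all below `M`, so `y` is the first larger
      -- letter that `M` meets.
      y-adjacent : ∃ λ u → u ∈ rd × Joined Es u y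
      y-adjacent with largest x xs
      ... | M , M∈ , ub with <-cmp M y
      ... | tri≈ _ M≡y _ = ⊥-elim (∉-before rd u-split (subst (_∈ rd) M≡y M∈))
      ... | tri> _ _ y<M = _ , proj₁ found , inj₂ (subst (λ q → (y , q) ∈ Es) par (edge-intro (nontop y∈ (rd∈ M∈) y<M)))
        where
        par : parentIn σ y ≡ firstGt y (reverse rd ++ ys)
        par = trans (cong (λ l → parentIn l y) e) (parentIn-split rd y ys (∉-before rd u-split))
        found : firstGt y (reverse rd ++ ys) ∈ rd × y < firstGt y (reverse rd ++ ys)
        found with firstGt-∈ (reverse rd) {ys} (∈-reverse⁺ rd M∈) y<M
        ... | q , lt = ∈-reverse rd q , lt
      ... | tri< M<y _ _ with ∈-∃++ M∈
      ... | x₁ , x₂ , rd≡ = M , M∈ , inj₁ (subst (λ q → (M , q) ∈ Es) par (edge-intro (nontop (rd∈ M∈) y∈ M<y)))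
        where
        e' : σ ≡ x₁ ++ M ∷ (x₂ ++ y ∷ ys)
        e' = trans e (trans (cong (_++ y ∷ ys) rd≡) (++-assoc x₁ (M ∷ x₂) _))
        par : parentIn σ M ≡ y
        par = trans (cong (λ l → parentIn l M) e') (trans (parentIn-split x₁ M (x₂ ++ y ∷ ys) (∉-before x₁ (subst Unique e' uniq)))
          (trans (firstGt-skip (reverse x₁) (λ z∈ → ub (recast (sym rd≡) (∈-++⁺ˡ (∈-reverse x₁ z∈)))))
          (trans (firstGt-skip x₂ (λ z∈ → ub (recast (sym rd≡) (∈-++⁺ʳ x₁ (there z∈))))) (firstGt-here ys M<y))))

      -- Let a later `z` be joined to a read `u`. If `z` is the parent of `u` and `u < y`, the
      -- search from `u` stops at `y` or earlier and misses `z`. If `u` is the parent of `z` and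
      -- `z < y`, the leftward search from `z` goes no further than `y` and misses `u`. Otherwise
      -- `y ≤ z` is immediate.
      y-least : ∀ {z} → Candidate Vs Es rd z → y ≤ z
      y-least {z} (z∈ , z∉ , u , u∈ , j) with ∈-++⁻ rd (subst (z ∈_) e (Perm.∈-resp-↭ (↭-sym perm) z∈))
      ... | inj₁ z∈rd = ⊥-elim (z∉ z∈rd)
      ... | inj₂ (here refl) = ≤-refl
      y-least {z} (z∈ , z∉ , u , u∈ , inj₁ f∈) | inj₂ (there z∈ys) with edge-elim f∈ | ∈-∃++ u∈
      ... | u∈vs , z≡ | x₁ , x₂ , rd≡ with <-cmp u y
      ...   | tri≈ _ u≡y _ = ⊥-elim (∉-before rd u-split (subst (_∈ rd) u≡y u∈))
      ...   | tri> _ _ y<u = <⇒≤ (<-trans y<u (proj₁ (Tree.edges wordTree f∈)))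
      ...   | tri< u<y _ _ = ⊥-elim ([ (λ q → ∉-rd q) , (λ where (here z≡y) → ∉-after rd u-split (subst (_∈ ys) z≡y z∈ys)) ]′
                (∈-++⁻ (reverse x₁ ++ x₂) (subst (_∈ (reverse x₁ ++ x₂) ++ y ∷ []) (sym (trans z≡ par)) (proj₁ found))))
        where
        e' : σ ≡ x₁ ++ u ∷ (x₂ ++ y ∷ ys)
        e' = trans e (trans (cong (_++ y ∷ ys) rd≡) (++-assoc x₁ (u ∷ x₂) _))
        par : parentIn σ u ≡ firstGt u (((reverse x₁ ++ x₂) ++ y ∷ []) ++ ys)
        par = trans (cong (λ l → parentIn l u) e') (trans (parentIn-split x₁ u (x₂ ++ y ∷ ys) (∉-before x₁ (subst Unique e' uniq)))
          (cong (firstGt u) (trans (sym (++-assoc (reverse x₁) x₂ (y ∷ ys))) (sym (++-assoc (reverse x₁ ++ x₂) (y ∷ []) ys)))))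
        found : firstGt u (((reverse x₁ ++ x₂) ++ y ∷ []) ++ ys) ∈ (reverse x₁ ++ x₂) ++ y ∷ [] × _
        found = firstGt-∈ ((reverse x₁ ++ x₂) ++ y ∷ []) {ys} (∈-++⁺ʳ (reverse x₁ ++ x₂) (here refl)) u<y
        ∉-rd : z ∉ reverse x₁ ++ x₂
        ∉-rd q with ∈-++⁻ (reverse x₁) q
        ... | inj₁ r = z∉ (subst (z ∈_) (sym rd≡) (∈-++⁺ˡ (∈-reverse x₁ r)))
        ... | inj₂ r = z∉ (subst (z ∈_) (sym rd≡) (∈-++⁺ʳ x₁ (there r)))
      y-least {z} (z∈ , z∉ , u , u∈ , inj₂ f∈) | inj₂ (there z∈ys) with edge-elim f∈ | ∈-∃++ z∈ys
      ... | z∈vs , u≡ | y₁ , y₂ , ys≡ with <-cmp z y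
      ...   | tri≈ _ z≡y _ = ≤-reflexive (sym z≡y)
      ...   | tri> _ _ y<z = <⇒≤ y<z
      ...   | tri< z<y _ _ = ⊥-elim (proj₂ (proj₂ (unique-++⁻ rd u-split)) u∈
                ([ (λ q → there (subst (u ∈_) (sym ys≡) (∈-++⁺ˡ (∈-reverse y₁ q)))) , (λ where (here u≡y) → here u≡y) ]′
                   (∈-++⁻ (reverse y₁) (subst (_∈ reverse y₁ ++ y ∷ []) (sym (trans u≡ par)) (proj₁ found)))))
        where
        e' : σ ≡ (rd ++ y ∷ y₁) ++ z ∷ y₂
        e' = trans e (trans (cong (λ l → rd ++ y ∷ l) ys≡) (sym (++-assoc rd (y ∷ y₁) (z ∷ y₂))))
        par : parentIn σ z ≡ firstGt z ((reverse y₁ ++ y ∷ []) ++ (reverse rd ++ y₂))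
        par = trans (cong (λ l → parentIn l z) e') (trans (parentIn-split (rd ++ y ∷ y₁) z y₂ (∉-before (rd ++ y ∷ y₁) (subst Unique e' uniq)))
          (cong (firstGt z) (trans (cong (_++ y₂) (reverse-mid rd y y₁)) (trans (++-assoc (reverse y₁) (y ∷ reverse rd) y₂) (sym (++-assoc (reverse y₁) (y ∷ []) _))))))
        found : firstGt z ((reverse y₁ ++ y ∷ []) ++ (reverse rd ++ y₂)) ∈ reverse y₁ ++ y ∷ [] × _
        found = firstGt-∈ (reverse y₁ ++ y ∷ []) {reverse rd ++ y₂} (∈-++⁺ʳ (reverse y₁) (here refl)) z<y

  wordGreedy : Greedy Vs Es (m ∷ []) w
  wordGreedy = go m [] w refl
    where
    go : ∀ x xs rest → σ ≡ (x ∷ xs) ++ rest → Greedy Vs Es (x ∷ xs) rest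
    go x xs [] e = done λ v∈ → recast (trans e (++-identityʳ _)) (Perm.∈-resp-↭ (↭-sym perm) v∈)
    go x xs (y ∷ ys) e = next (y∈ , ∉-before rd u-split , y-adjacent) y-least
        (go x (xs ++ y ∷ []) ys (trans e (sym (++-assoc (x ∷ xs) (y ∷ []) ys))))
      where open At x xs y ys e

∧-intro : ∀ {x y} → x ≡ true → y ≡ true → x ∧ y ≡ true
∧-intro refl refl = refl

∨-introˡ : ∀ {x} y → x ≡ true → x ∨ y ≡ true
∨-introˡ _ refl = refl

not-true : ∀ {x} → not x ≡ true → x ≡ true → ⊥
not-true {true} () _

map-split : ∀ {A B : Set} (f : A → B) xs ys {zs} → map f xs ≡ ys ++ zs →
            ∃ λ as → ∃ λ bs → xs ≡ as ++ bs × map f as ≡ ys × map f bs ≡ zs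
map-split f xs [] e = [] , xs , refl , refl , e
map-split f (x ∷ xs) (y ∷ ys) e with ∷-injective e
... | refl , e' with map-split f xs ys e'
... | as , bs , refl , p , q = x ∷ as , bs , refl , cong (f x ∷_) p , q

-- Lehmer codes

-- Codes that satisfy `IsCode` never reach the default value.
nth : ℕ → List ℕ → ℕ
nth c       []       = 0
nth zero    (x ∷ xs) = x
nth (suc c) (x ∷ xs) = nth c xs

delete : ℕ → List ℕ → List ℕ
delete c       []       = []
delete zero    (x ∷ xs) = xs
delete (suc c) (x ∷ xs) = x ∷ delete c xs

-- `rem` is kept increasing, so a digit is the number of smaller letters that are still to come.
word : List ℕ → List ℕ → List ℕ
word []       rem = []
word (c ∷ cs) rem = nth c rem ∷ word cs (delete c rem)

remaining : List ℕ → List ℕ → List ℕ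
remaining []       rem = rem
remaining (c ∷ cs) rem = remaining cs (delete c rem)

nth-mid : ∀ p x q → nth (length p) (p ++ x ∷ q) ≡ x
nth-mid []      x q = refl
nth-mid (y ∷ p) x q = nth-mid p x q

delete-mid : ∀ p x q → delete (length p) (p ++ x ∷ q) ≡ p ++ q
delete-mid []      x q = refl
delete-mid (y ∷ p) x q = cong (y ∷_) (delete-mid p x q)

split-nth : ∀ c (rem : List ℕ) → c < length rem → ∃ λ p → ∃ λ x → ∃ λ q → rem ≡ p ++ x ∷ q × length p ≡ c
split-nth zero (x ∷ rem) _ = [] , x , rem , refl , refl
split-nth (suc c) (y ∷ rem) (s≤s lt) with split-nth c rem lt
... | p , x , q , refl , refl = y ∷ p , x , q , refl , refl

length-mid : ∀ (p : List ℕ) x q → length (p ++ x ∷ q) ≡ suc (length (p ++ q))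
length-mid p x q = trans (length-++ p) (trans (+-suc _ _) (cong suc (sym (length-++ p))))

increasing-delete : ∀ p {x q} → Increasing (p ++ x ∷ q) → Increasing (p ++ q)
increasing-delete p inc with increasing-split p inc
... | i₁ , _ ∷ i₂ , lt = increasing-++ i₁ i₂ (λ y∈ z∈ → lt y∈ (there z∈))

FirstLetter : List ℕ → ℕ → List ℕ → Set
FirstLetter rem c cs = ∃ λ p → ∃ λ x → ∃ λ q →
  rem ≡ p ++ x ∷ q × length p ≡ c × nth c rem ≡ x × delete c rem ≡ p ++ q × IsCode (length (p ++ q)) cs

first-letter : ∀ {rem c cs} → IsCode (length rem) (c ∷ cs) → FirstLetter rem c cs
first-letter {rem} {c} {cs} = go (length rem) refl
  where
  go : ∀ k → length rem ≡ k → IsCode k (c ∷ cs) → FirstLetter rem c cs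
  go (suc m) e (c≤m , code') with split-nth c rem (≤-trans (s≤s c≤m) (≤-reflexive (sym e)))
  ... | p , x , q , refl , refl = p , x , q , refl , refl , nth-mid p x q , delete-mid p x q ,
        subst (λ k → IsCode k cs) (suc-injective (trans (sym e) (length-mid p x q))) code'

word-↭ : ∀ cs {rem} → IsCode (length rem) cs → word cs rem ++ remaining cs rem ↭ rem
word-↭ [] _ = ↭-refl
word-↭ (c ∷ cs) {rem} code with first-letter {rem} code
... | p , x , q , refl , refl , e₁ , e₂ , code' rewrite e₁ | e₂ =
  ↭-trans (↭-prep x (word-↭ cs code')) (↭-sym (Perm.shift x p q))

remaining-increasing : ∀ cs {rem} → IsCode (length rem) cs → Increasing rem → Increasing (remaining cs rem)
remaining-increasing [] _ inc = inc
remaining-increasing (c ∷ cs) {rem} code inc with first-letter {rem} code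
... | p , x , q , refl , refl , e₁ , e₂ , code' rewrite e₂ = remaining-increasing cs code' (increasing-delete p inc)

length-word : ∀ cs rem → length (word cs rem) ≡ length cs
length-word [] rem = refl
length-word (c ∷ cs) rem = cong suc (length-word cs (delete c rem))

length-remaining : ∀ cs {rem} → IsCode (length rem) cs → length cs + length (remaining cs rem) ≡ length rem
length-remaining cs {rem} code = trans (cong (_+ length (remaining cs rem)) (sym (length-word cs rem)))
  (trans (sym (length-++ (word cs rem))) (Perm.↭-length (word-↭ cs code)))

word-++ : ∀ cs ds rem → word (cs ++ ds) rem ≡ word cs rem ++ word ds (remaining cs rem)
word-++ [] ds rem = refl
word-++ (c ∷ cs) ds rem = cong (nth c rem ∷_) (word-++ cs ds (delete c rem))

remaining-++ : ∀ cs ds rem → remaining (cs ++ ds) rem ≡ remaining ds (remaining cs rem)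
remaining-++ [] ds rem = refl
remaining-++ (c ∷ cs) ds rem = remaining-++ cs ds (delete c rem)

word-exists : ∀ w {rest rem} → w ++ rest ↭ rem →
  ∃ λ cs → IsCode (length rem) cs × length cs ≡ length w × word cs rem ≡ w × remaining cs rem ↭ rest
word-exists [] p = [] , _ , refl , refl , ↭-sym p
word-exists (x ∷ w) {rest} {rem} perm with ∈-∃++ (Perm.∈-resp-↭ perm (here refl))
... | p , q , refl with word-exists w (Perm.drop-mid [] p perm)
... | cs , code , len , e , r = length p ∷ cs , code' , cong suc len ,
      cong₂ _∷_ (nth-mid p x q) (trans (cong (word cs) (delete-mid p x q)) e) ,
      subst (λ l → remaining cs l ↭ rest) (sym (delete-mid p x q)) r
  where
  code' : IsCode (length (p ++ x ∷ q)) (length p ∷ cs)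
  code' = subst (λ k → IsCode k (length p ∷ cs)) (sym (length-mid p x q)) (balance-slack (length q) (≤-reflexive (sym (length-++ p {q}))) (solve 3 (λ i j k → i :+ j :+ k := j :+ (i :+ k)) refl (length p) (length (p ++ q)) (length q)) , code)

word-injective : ∀ cs ds {rem} → Unique rem → IsCode (length rem) cs → IsCode (length rem) ds → word cs rem ≡ word ds rem → cs ≡ ds
word-injective [] [] _ _ _ _ = refl
word-injective (c ∷ cs) (d ∷ ds) {rem} u code code' e with first-letter {rem} code | first-letter {rem} code'
... | p , x , q , refl , refl , n₁ , d₁ , c₁ | p' , x' , q' , e' , refl , n₂ , d₂ , c₂ with ∷-injective e
... | x≡ , e₂ with trans (sym n₁) (trans x≡ n₂)
... | refl with same-place p p' u e'
  where
  same-place : ∀ p p' {x q q'} → Unique (p ++ x ∷ q) → p ++ x ∷ q ≡ p' ++ x ∷ q' → p ≡ p'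
  same-place [] [] _ _ = refl
  same-place [] (y ∷ p') (p ∷ _) refl = ⊥-elim (All.lookup p (∈-insert p') refl)
  same-place (y ∷ p) [] (h ∷ _) refl = ⊥-elim (All.lookup h (∈-insert p) refl)
  same-place (y ∷ p) (z ∷ p') (_ ∷ u) e with ∷-injective e
  ... | refl , e' = cong (y ∷_) (same-place p p' u e')
... | refl = cong (length p ∷_) (word-injective cs ds (unique-delete p u) c₁ (subst (λ l → IsCode (length l) ds) (trans (sym d₂) d₁) c₂)
               (trans (cong (word cs) (sym d₁)) (trans e₂ (cong (word ds) d₁))))
  where
  unique-delete : ∀ p {x q} → Unique (p ++ x ∷ q) → Unique (p ++ q)
  unique-delete p {x} {q} u with unique-↭ (Perm.shift x p q) u
  ... | _ ∷ u' = u'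

insertAt : ℕ → ℕ → List ℕ → List ℕ
insertAt k x w = take k w ++ x ∷ drop k w

insertAt-mid : ∀ {x} u v → insertAt (length u) x (u ++ v) ≡ u ++ x ∷ v
insertAt-mid {x} u v = cong₂ (λ l l' → l ++ x ∷ l') (go u) (go' u)
  where
  go : ∀ u → take (length u) (u ++ v) ≡ u
  go [] = refl
  go (y ∷ u) = cong (y ∷_) (go u)
  go' : ∀ u → drop (length u) (u ++ v) ≡ v
  go' [] = refl
  go' (y ∷ u) = go' u

insertAt-↭ : ∀ k x w → insertAt k x w ↭ x ∷ w
insertAt-↭ k x w = ↭-trans (Perm.shift x (take k w) (drop k w)) (↭-reflexive (cong (x ∷_) (take++drop≡id k w)))

insertAt-injective : ∀ {x} k k' w w' → k ≤ length w → k' ≤ length w' → x ∉ w → x ∉ w' →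
                     insertAt k x w ≡ insertAt k' x w' → k ≡ k' × w ≡ w'
insertAt-injective zero zero w w' _ _ _ _ e = refl , ∷-injectiveʳ e
insertAt-injective zero (suc k') w (y ∷ w') _ _ _ x∉ e = ⊥-elim (x∉ (here (∷-injectiveˡ e)))
insertAt-injective (suc k) zero (y ∷ w) w' _ _ x∉ _ e = ⊥-elim (x∉ (here (sym (∷-injectiveˡ e))))
insertAt-injective (suc k) (suc k') (y ∷ w) (z ∷ w') (s≤s l) (s≤s l') x∉ x∉' e with ∷-injective e
... | refl , e' with insertAt-injective k k' w w' l l' (x∉ ∘ there) (x∉' ∘ there) e'
... | refl , refl = refl , refl

sort-increasing : ∀ {w} → Unique w → Increasing (sort w)
sort-increasing {w} u = AllPairs.zipWith (λ (le , ne) → ≤∧≢⇒< le ne)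
  (Linkedₚ.Linked⇒AllPairs ≤-trans (sort-↗ w) , unique-↭ (↭-sym (sort-↭ w)) u)

increasing-↭ : ∀ {xs ys} → Increasing xs → Increasing ys → xs ↭ ys → xs ≡ ys
increasing-↭ i j p = increasing-ext i j (Perm.∈-resp-↭ p) (Perm.∈-resp-↭ (↭-sym p))

sort-≡ : ∀ {w xs} → Increasing xs → w ↭ xs → sort w ≡ xs
sort-≡ {w} inc p = increasing-↭ (sort-increasing (unique-↭ (↭-sym p) (increasing⇒unique inc))) inc (↭-trans (sort-↭ w) p)

sort-min : ∀ {m w} → Unique w → (∀ {x} → x ∈ w → m < x) → sort (m ∷ w) ≡ m ∷ sort w
sort-min {m} {w} u lt = sort-≡ (All.tabulate (λ x∈ → lt (Perm.∈-resp-↭ (sort-↭ w) x∈)) ∷ sort-increasing u) (↭-prep m (↭-sym (sort-↭ w)))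

front-max : ∀ {m xs} → Increasing xs → m ∈ xs → (∀ {x} → x ∈ xs → x ≤ m) → xs ≡ front xs ++ m ∷ []
front-max {m} {xs} inc m∈ ub with ∈-∃++ m∈
... | vs , [] , refl = cong (_++ m ∷ []) (sym (front-snoc vs m))
... | vs , y ∷ ys , refl with proj₁ (proj₂ (increasing-split vs inc))
... | (lt ∷ _) ∷ _ = ⊥-elim (<⇒≱ lt (ub (∈-++⁺ʳ vs (there (here refl)))))

headD-reverse : ∀ α {xs} → 0 < firstPart α → headD 0 (reverse α ++ xs) ≡ firstPart α
headD-reverse (x ∷ []) _ = refl
headD-reverse (x ∷ y ∷ l) {xs} p = trans (cong (λ l → headD 0 (l ++ xs)) (unfold-reverse x (y ∷ l)))
  (trans (cong (headD 0) (++-assoc (reverse (y ∷ l)) (x ∷ []) xs)) (headD-reverse (y ∷ l) p))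

sum-reverse : ∀ α → sum (reverse α) ≡ sum α
sum-reverse α = sum-↭ (Perm.↭-reverse α)

heads : Forest → List ℕ
heads = map (λ t → headD 0 (V t))

unique-filter : ∀ {xs} {z : ℕ} (p : ℕ → Bool) → Unique xs → z ∈ xs → p z ≡ true → (∀ {x} → x ∈ xs → p x ≡ true → x ≡ z) → filterᵇ p xs ≡ z ∷ []
unique-filter {x ∷ xs} p (h ∷ u) (here refl) pz uniq rewrite pz =
  cong (x ∷_) (filter-empty p xs λ y∈ → not-true⇒false λ q → All.lookup h y∈ (sym (uniq (there y∈) q)))
unique-filter {x ∷ xs} p (h ∷ u) (there z∈) pz uniq with p x in e
... | true = ⊥-elim (All.lookup h z∈ (uniq (here refl) e))
... | false = unique-filter p u z∈ pz (uniq ∘ there)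

applyUpTo-+ : ∀ (f : ℕ → ℕ) m k → applyUpTo f (m + k) ≡ applyUpTo f m ++ applyUpTo (λ i → f (m + i)) k
applyUpTo-+ f zero k = refl
applyUpTo-+ f (suc m) k = cong (f 0 ∷_) (applyUpTo-+ (f ∘ suc) m k)

applyUpTo-cong : ∀ {f g : ℕ → ℕ} → (∀ i → f i ≡ g i) → ∀ k → applyUpTo f k ≡ applyUpTo g k
applyUpTo-cong h zero = refl
applyUpTo-cong h (suc k) = cong₂ _∷_ (h 0) (applyUpTo-cong (h ∘ suc) k)

interval-increasing : ∀ k → Increasing (applyUpTo suc k)
interval-increasing k = AllPairsₚ.applyUpTo⁺₁ suc k (λ i<j _ → s≤s i<j)

interval-∈ : ∀ k {x} → x ∈ applyUpTo suc k → 1 ≤ x × x ≤ k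
interval-∈ k x∈ with go suc k x∈
  where
  go : ∀ (f : ℕ → ℕ) k {x} → x ∈ applyUpTo f k → ∃ λ i → i < k × x ≡ f i
  go f (suc k) (here refl) = 0 , s≤s z≤n , refl
  go f (suc k) (there x∈) with go (f ∘ suc) k x∈
  ... | i , lt , e = suc i , s≤s lt , e
... | i , lt , refl = s≤s z≤n , lt

-- Each head is the least vertex of its tree and the heads increase, so the first head is the least
-- vertex of all.
first-head : ∀ {G F L x t} → All (IsTreeTriple G) (t ∷ F) → Increasing (heads (t ∷ F)) → concat (map V (t ∷ F)) ↭ L →
             x ∈ L → (∀ {y} → y ∈ L → x ≤ y) → ∃ λ W → V t ≡ x ∷ W
first-head {G} {F} {L} {x} {t} (p ∷ ps) inc perm x∈ least with tree-head (ToTree.toTree (proj₁ p))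
... | m , W , refl = W , cong (_∷ W) (≤-antisym m≤x (least (Perm.∈-resp-↭ perm (here refl))))
  where
  head≤ : ∀ {s} → IsTreeTriple G s → x ∈ V s → headD 0 (V s) ≤ x
  head≤ q x∈s with tree-head (ToTree.toTree (proj₁ q)) | Tree.increasing (ToTree.toTree (proj₁ q))
  ... | h , U , refl | hs ∷ _ with x∈s
  ... | here refl = ≤-refl
  ... | there x∈U = <⇒≤ (All.lookup hs x∈U)
  search : ∀ {F} → All (IsTreeTriple G) F → All (m <_) (heads F) → x ∈ concat (map V F) → m ≤ x
  search {s ∷ F} (q ∷ qs) (lt ∷ lts) x∈ with ∈-++⁻ (V s) x∈
  ... | inj₁ x∈s = ≤-trans (<⇒≤ lt) (head≤ q x∈s)
  ... | inj₂ x∈F = search qs lts x∈F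
  m≤x : m ≤ x
  m≤x with ∈-++⁻ (m ∷ W) (Perm.∈-resp-↭ (↭-sym perm) x∈)
  ... | inj₁ x∈t = head≤ p x∈t
  ... | inj₂ x∈F = search ps (AllPairs.head inc) x∈F

firstR : Skeleton → ℕ
firstR (alone r)            = r
firstR (special r α cs t ys) = r
firstR (before r α cs x)     = r

interval-split : ∀ A k → applyUpTo suc A ++ map (A +_) (applyUpTo suc k) ≡ applyUpTo suc (A + k)
interval-split A k = sym (trans (applyUpTo-+ suc A k) (cong (applyUpTo suc A ++_)
  (trans (applyUpTo-cong (λ i → sym (+-suc A i)) k) (sym (map-applyUpTo suc (A +_) k)))))

-- Matching on this view exposes the first part `b`, on which the types of all skeletons depend.
record HeadView (R : Forest) : Set where
  constructor headView
  field
    {W'}  : List ℕ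
    {Fs}  : List (ℕ × ℕ)
    {b}   : ℕ
    {β}   : List ℕ
    {Rs}  : Forest
    view  : R ≡ tt (1 ∷ W') Fs (b ∷ β) 1 ∷ Rs

head-view : ∀ {G' R} → 1 ≤ n G' → SimpleFT G' R → HeadView R
head-view {G'} {[]} n≥1 ((_ , p , _) , _) = absurd (subst (1 ≤_) (trans (sym (length-applyUpTo suc (n G'))) (sym (Perm.↭-length p))) n≥1)
head-view {G'} {tt Vs Es α r ∷ Rs} n≥1 ((ts@(t ∷ _) , p , l) , refl)
  with first-head ts (Linkedₚ.Linked⇒AllPairs <-trans l) p (one∈ n≥1) (λ y∈ → proj₁ (interval-∈ (n G') y∈))
  where
  one∈ : ∀ {k} → 1 ≤ k → 1 ∈ applyUpTo suc k
  one∈ {suc k} _ = here refl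
... | W' , refl with α | t
... | [] | _ , (_ , ()) , _
... | b ∷ β | _ = headView refl

firstPart-reverse : ∀ α → firstPart (reverse α) ≡ headD 0 α
firstPart-reverse [] = refl
firstPart-reverse (x ∷ l) = trans (cong firstPart (unfold-reverse x l)) (go (reverse l))
  where
  go : ∀ l → firstPart (l ++ x ∷ []) ≡ x
  go [] = refl
  go (y ∷ []) = refl
  go (y ∷ z ∷ l) = go (z ∷ l)

-- Separates the vertices of one tree from the others when `P` distinguishes the letters on the two
-- sides of `a`.
extract : ∀ {P : ℕ → Set} W {X L H} → (∀ {x} → x ∈ W → P x) → (∀ {x} → x ∈ H → ¬ P x) → W ++ X ↭ L ++ H →
          ∃ λ L' → W ++ L' ↭ L × X ↭ L' ++ H
extract [] {L = L} _ _ p = L , ↭-refl , p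
extract (x ∷ W) {X} {L} {H} inP notP p with ∈-++⁻ L (Perm.∈-resp-↭ p (here refl))
... | inj₂ x∈H = ⊥-elim (notP x∈H (inP (here refl)))
... | inj₁ x∈L with ∈-∃++ x∈L
... | as , bs , refl with extract W {X} {as ++ bs} {H} (inP ∘ there) notP
          (↭-trans (Perm.drop-mid [] as (↭-trans p (↭-reflexive (++-assoc as (x ∷ bs) H)))) (↭-reflexive (sym (++-assoc as bs H))))
... | L' , q , r = L' , ↭-trans (↭-prep x q) (↭-sym (Perm.shift x as bs)) , r

-- Locates the part that contains the vertex number `κ`, as in the definition of the index j of seg.
split-composition : ∀ α κ → 1 ≤ κ → κ ≤ sum α → ∃ λ as → ∃ λ g → ∃ λ bs → α ≡ as ++ g ∷ bs × sum as < κ × κ ≤ sum as + g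
split-composition [] κ κ≥1 le = absurd (≤-trans κ≥1 le)
split-composition (x ∷ α) κ κ≥1 le with κ ≤? x
... | yes q = [] , x , α , refl , κ≥1 , q
... | no q with split-composition α (κ ∸ x) (m<n⇒0<n∸m (≰⇒> q)) (≤-trans (∸-monoˡ-≤ x le) (≤-reflexive (m+n∸m≡n x (sum α))))
... | as , g , bs , refl , lt , le' = x ∷ as , g , bs , refl ,
      balance-≤ (+-mono-≤ lt (≤-reflexive (m+[n∸m]≡n (<⇒≤ (≰⇒> q))))) (solve 4 (λ i j k l → con 1 :+ (i :+ j) :+ (l :+ k) := k :+ (con 1 :+ j :+ (i :+ l))) refl x (sum as) κ (κ ∸ x)) , balance-≤ (+-mono-≤ le' (≤-reflexive (sym (m+[n∸m]≡n (<⇒≤ (≰⇒> q)))))) (solve 5 (λ i j k l m → i :+ (k :+ l :+ (j :+ m)) := j :+ k :+ l :+ (m :+ i)) refl κ x (sum as) g (κ ∸ x))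

interval-cons : ∀ {k} → 1 ≤ k → applyUpTo suc k ≡ 1 ∷ applyUpTo (2 +_) (k ∸ 1)
interval-cons {suc k} _ = refl

interval-tail : ∀ {k} → 1 ≤ k → All (1 <_) (applyUpTo (2 +_) (k ∸ 1))
interval-tail {suc k} _ = AllPairs.head (interval-increasing (suc k))

-- Evaluation of the restriction and of the segment index

restAlpha-split : ∀ k as g bs → sum as < k → k ≤ sum as + g → restAlpha k (as ++ g ∷ bs) ≡ (sum as + g ∸ k + 1) ∷ bs
restAlpha-split k [] g bs _ le rewrite ≤ᵇ-intro le = refl
restAlpha-split k (x ∷ as) g bs lt le rewrite ≤ᵇ-false {k} {x} (≤-trans (s≤s (m≤m+n x (sum as))) lt) =
  trans (restAlpha-split (k ∸ x) as g bs
      (subst (_≤ k ∸ x) (m+n∸m≡n x (suc (sum as))) (∸-monoˡ-≤ x (subst (_≤ k) (sym (+-suc x (sum as))) lt)))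
      (subst (k ∸ x ≤_) (trans (cong (_∸ x) (+-assoc x (sum as) g)) (m+n∸m≡n x (sum as + g))) (∸-monoˡ-≤ x le)))
    (cong (λ j → (j + 1) ∷ bs) value)
  where
  x≤k : x ≤ k
  x≤k = ≤-trans (m≤m+n x (sum as)) (<⇒≤ lt)
  value : sum as + g ∸ (k ∸ x) ≡ x + sum as + g ∸ k
  value = trans (sym ([m+n]∸[m+o]≡n∸o x (sum as + g) (k ∸ x))) (cong₂ _∸_ (sym (+-assoc x (sum as) g)) (m+[n∸m]≡n x≤k))

segIdx-split : ∀ k as g bs → sum as < k → k ≤ sum as + g → segIdx k (as ++ g ∷ bs) ≡ suc (length as)
segIdx-split k [] g bs _ le rewrite ≤ᵇ-intro le = refl
segIdx-split k (x ∷ as) g bs lt le rewrite ≤ᵇ-false {k} {x} (≤-trans (s≤s (m≤m+n x (sum as))) lt) =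
  cong suc (segIdx-split (k ∸ x) as g bs
      (subst (_≤ k ∸ x) (m+n∸m≡n x (suc (sum as))) (∸-monoˡ-≤ x (subst (_≤ k) (sym (+-suc x (sum as))) lt)))
      (subst (k ∸ x ≤_) (trans (cong (_∸ x) (+-assoc x (sum as) g)) (m+n∸m≡n x (sum as + g))) (∸-monoˡ-≤ x le)))

totalLength : Forest → ℕ
totalLength F = sum (map (λ t → length (α t)) F)

module Located (a : ℕ) {pre : Forest} {t : TreeTriple} {post Z : Forest}
  (pre∌ : ∀ {s} → s ∈ pre → a ∉ V s) (t∋ : a ∈ V t) (post-meets : ∀ {s} → s ∈ post → meets a s ≡ true) (Z-avoids : ∀ {s} → s ∈ Z → meets a s ≡ false) where

  F : Forest
  F = pre ++ t ∷ post ++ Z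

  idxOf≡ : idxOf a F ≡ length pre
  idxOf≡ = go pre pre∌
    where
    go : ∀ pre → (∀ {s} → s ∈ pre → a ∉ V s) → idxOf a (pre ++ t ∷ post ++ Z) ≡ length pre
    go [] _ rewrite memB-intro t∋ = refl
    go (s ∷ pre) h rewrite memB-false (h (here refl)) = cong suc (go pre (h ∘ there))

  getT≡ : getT F (idxOf a F) ≡ t
  getT≡ = trans (cong (getT F) idxOf≡) (go pre)
    where
    go : ∀ pre → getT (pre ++ t ∷ post ++ Z) (length pre) ≡ t
    go [] = refl
    go (s ∷ pre) = go pre

  drop-length : ∀ (pre F : Forest) → drop (length pre) (pre ++ F) ≡ F
  drop-length [] F = refl
  drop-length (_ ∷ pre) F = drop-length pre F

  drop-suc : ∀ (pre : Forest) t F → drop (suc (length pre)) (pre ++ t ∷ F) ≡ F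
  drop-suc [] t F = refl
  drop-suc (_ ∷ pre) t F = drop-suc pre t F

  take-length : ∀ (pre F : Forest) → take (length pre) (pre ++ F) ≡ pre
  take-length [] F = refl
  take-length (s ∷ pre) F = cong (s ∷_) (take-length pre F)

  lastMeet≡ : ∀ t post → (∀ {s} → s ∈ post → meets a s ≡ true) → lastMeet a (t ∷ post ++ Z) ≡ length post
  lastMeet≡ t [] _ rewrite any-false (meets a) Z Z-avoids = refl
  lastMeet≡ t (s ∷ post) h rewrite h (here refl) = cong suc (lastMeet≡ s post (h ∘ there))

  idx'≡ : idx' a F ≡ length pre + length post
  idx'≡ = cong₂ _+_ idxOf≡ (trans (cong (λ k → lastMeet a (drop k F)) idxOf≡)
    (trans (cong (lastMeet a) (drop-length pre _)) (lastMeet≡ t post post-meets)))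

  drop-idx' : drop (suc (idx' a F)) F ≡ Z
  drop-idx' = trans (cong (λ k → drop (suc k) F) idx'≡) (go pre)
    where
    go : ∀ pre → drop (suc (length pre + length post)) (pre ++ t ∷ post ++ Z) ≡ Z
    go [] = drop-length post Z
    go (s ∷ pre) = go pre

  restrict≡ : restrict a F ≡ shiftT (a ∸ 1) (restrictT a t) ∷ map (shiftT (a ∸ 1)) Z
  restrict≡ = cong₂ (λ s Z → shiftT (a ∸ 1) (restrictT a s) ∷ map (shiftT (a ∸ 1)) Z) getT≡ drop-idx'

  segF≡ : segF a F ≡ segT a t + totalLength pre + totalLength post
  segF≡ = cong₂ _+_ (cong₂ _+_ (cong (segT a) getT≡) (cong totalLength (trans (cong (λ k → take k F) idxOf≡) (take-length pre _))))
    (cong totalLength (trans (cong₂ (λ i j → take (j ∸ i) (drop (suc i) F)) idxOf≡ idx'≡)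
      (trans (cong₂ take (m+n∸m≡n (length pre) (length post)) (drop-suc pre t (post ++ Z))) (take-length post Z))))

prefix-unique : ∀ {A : Set} (as bs : List A) {cs ds} → length as ≡ length bs → as ++ cs ≡ bs ++ ds → as ≡ bs × cs ≡ ds
prefix-unique [] [] _ e = refl , e
prefix-unique (a ∷ as) (b ∷ bs) l e with ∷-injective e
... | refl , e' with prefix-unique as bs (suc-injective l) e'
... | refl , q = refl , q

rSum : Forest → ℕ
rSum F = sum (map (λ t → r t ∸ 1) F)

cutSum : Forest → ℕ
cutSum F = sum (map (λ t → length (α t) ∸ 1) F)

partList : Forest → List ℕ
partList F = concat (map α F)

map-sum-++ : ∀ {X : Set} (f : X → ℕ) F F' → sum (map f (F ++ F')) ≡ sum (map f F) + sum (map f F')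
map-sum-++ f F F' = trans (cong sum (map-++ f F F')) (sum-++ (map f F) (map f F'))

concat-map-++ : ∀ {X : Set} (f : X → List ℕ) F F' → concat (map f (F ++ F')) ≡ concat (map f F) ++ concat (map f F')
concat-map-++ f F F' = trans (cong concat (map-++ f F F')) (sym (concat-++ (map f F) (map f F')))

filterᵇ-↭ : ∀ (p : ℕ → Bool) {xs ys} → xs ↭ ys → length (filterᵇ p xs) ≡ length (filterᵇ p ys)
filterᵇ-↭ p q = Perm.↭-length (Perm.filter-↭ (Data.Bool.T? ∘ p) q)

filter-yes : ∀ (p : ℕ → Bool) {x} xs → p x ≡ true → filterᵇ p (x ∷ xs) ≡ x ∷ filterᵇ p xs
filter-yes p xs e rewrite e = refl

filter-no : ∀ (p : ℕ → Bool) {x} xs → p x ≡ false → filterᵇ p (x ∷ xs) ≡ filterᵇ p xs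
filter-no p xs e rewrite e = refl

filter-absorb : ∀ (p q : ℕ → Bool) xs → (∀ {x} → x ∈ xs → p x ≡ true → q x ≡ true) → length (filterᵇ p (filterᵇ q xs)) ≡ length (filterᵇ p xs)
filter-absorb p q [] h = refl
filter-absorb p q (x ∷ xs) h with q x in eq
... | true with p x
...   | true = cong suc (filter-absorb p q xs (h ∘ there))
...   | false = filter-absorb p q xs (h ∘ there)
filter-absorb p q (x ∷ xs) h | false with p x in ep
...   | true = true≢false (h (here refl) ep) eq
...   | false = filter-absorb p q xs (h ∘ there)

filter-map : ∀ (p q : ℕ → Bool) (f : ℕ → ℕ) xs → (∀ {x} → x ∈ xs → p (f x) ≡ q x) → length (filterᵇ p (map f xs)) ≡ length (filterᵇ q xs)
filter-map p q f [] h = refl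
filter-map p q f (x ∷ xs) h rewrite h (here refl) with q x
... | true = cong suc (filter-map p q f xs (h ∘ there))
... | false = filter-map p q f xs (h ∘ there)

bool-ext : ∀ {x y} → (x ≡ true → y ≡ true) → (y ≡ true → x ≡ true) → x ≡ y
bool-ext {true} f g = sym (f refl)
bool-ext {false} {true} f g = g refl
bool-ext {false} {false} f g = refl

listT-∈ : ∀ {G t} → IsTreeTriple G t → ∀ {x} → x ∈ listT t → x ∈ V t
listT-∈ {t = tt Vs Es α r} (d , _) x∈ with tree-head (ToTree.toTree d)
... | m , U , refl with tree-reading (ToTree.toTree d)
... | w , g , p = Perm.∈-resp-↭ (↭-prep m p) (recast (listT-greedy {α = α} {r} (Tree.increasing (ToTree.toTree d)) g p) x∈)

-- The graph K a ε ⊕ G' with a = A + 1.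
module Sum (G' : Graph) (range : ∀ i j → E G' i j ≡ true → (1 ≤ i × i ≤ n G') × (1 ≤ j × j ≤ n G')) (n≥1 : 1 ≤ n G') (A ε : ℕ) where
  a : ℕ
  a = suc A

  G : Graph
  G = K a ε ⊕ G'

  Forbidden : ℕ → ℕ → Set
  Forbidden u v = 1 ≤ ε × u ≡ 1 × v ≡ a

  private
    inRange-elim : ∀ {u} → inRange a u ≡ true → 1 ≤ u × u ≤ a
    inRange-elim {u} q with ∧-true {1 ≤ᵇ u} q
    ... | p₁ , p₂ = ≤ᵇ-true p₁ , ≤ᵇ-true p₂

    inRange-intro : ∀ {u} → 1 ≤ u → u ≤ a → inRange a u ≡ true
    inRange-intro p q = ∧-intro (≤ᵇ-intro p) (≤ᵇ-intro q)

    ∸-shift : ∀ {u} → a ≤ u → u ∸ a + 1 ≡ u ∸ A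
    ∸-shift {suc u} (s≤s le) = trans (+-comm (u ∸ A) 1) (sym (+-∸-assoc 1 le))

  K-elim : ∀ {u v} → E (K a ε) u v ≡ true → (1 ≤ u × u ≤ a) × (1 ≤ v × v ≤ a) × ¬ Forbidden u v
  K-elim {u} {v} q with ∧-true {inRange a u} q
  ... | q₁ , q' with ∧-true {inRange a v} q'
  ... | q₂ , q'' with ∧-true {not (u ≡ᵇ v)} q''
  ... | _ , q₄ = inRange-elim q₁ , inRange-elim q₂ , λ where
    (ε≥1 , refl , refl) → not-true q₄ (∧-intro (≤ᵇ-intro ε≥1) (∨-introˡ _ (∧-intro (≡ᵇ-refl 1) (≡ᵇ-refl a))))

  K-intro : ∀ {u v} → 1 ≤ u → u < v → v ≤ a → ¬ Forbidden u v → E (K a ε) u v ≡ true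
  K-intro {u} {v} u≥1 u<v v≤a ok = ∧-intro (inRange-intro u≥1 (<⇒≤ (≤-trans u<v v≤a)))
    (∧-intro (inRange-intro (≤-trans u≥1 (<⇒≤ u<v)) v≤a)
      (∧-intro (cong not (≡ᵇ-false (<⇒≢ u<v))) (cong not (not-true⇒false bad))))
    where
    bad : (1 ≤ᵇ ε) ∧ (((u ≡ᵇ 1) ∧ (v ≡ᵇ a)) ∨ ((u ≡ᵇ a) ∧ (v ≡ᵇ 1))) ≡ true → ⊥
    bad q with ∧-true {1 ≤ᵇ ε} q
    ... | q₁ , q₂ with ∨-true {(u ≡ᵇ 1) ∧ (v ≡ᵇ a)} q₂
    ... | inj₁ r with ∧-true {u ≡ᵇ 1} r
    ...   | r₁ , r₂ = ok (≤ᵇ-true q₁ , ≡ᵇ-true r₁ , ≡ᵇ-true r₂)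
    bad q | q₁ , q₂ | inj₂ r with ∧-true {u ≡ᵇ a} r
    ...   | r₁ , r₂ = <⇒≱ u<v (≤-trans (≤-reflexive (≡ᵇ-true r₂)) u≥1)

  low-edge : ∀ {u v} → 1 ≤ u → u < v → v ≤ a → ¬ Forbidden u v → E G u v ≡ true
  low-edge u≥1 u<v v≤a ok = ∨-introˡ _ (K-intro u≥1 u<v v≤a ok)

  high-edge : ∀ {x y} → E G' x y ≡ true → E G (A + x) (A + y) ≡ true
  high-edge {x} {y} q = ∨-introʳ (E (K a ε) (A + x) (A + y)) (∧-intro (≤ᵇ-intro x≥) (∧-intro (≤ᵇ-intro y≥)
      (trans (cong₂ (E G') (trans (∸-shift x≥) (m+n∸m≡n A x)) (trans (∸-shift y≥) (m+n∸m≡n A y))) q)))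
    where
    x≥ : a ≤ A + x
    x≥ = balance-≤ (proj₁ (proj₁ (range x y q))) (solve 2 (λ i j → con 1 :+ i :+ j := i :+ j :+ con 1) refl A x)
    y≥ : a ≤ A + y
    y≥ = balance-≤ (proj₁ (proj₂ (range x y q))) (solve 2 (λ i j → con 1 :+ i :+ j := i :+ j :+ con 1) refl A y)

  -- `a` is a cut vertex: an edge lies on one side of it. The lower end decides, and `a` as lower
  -- end belongs to `G'`.
  edge-elim : ∀ {u v} → E G u v ≡ true → u < v →
              (u < a × 1 ≤ u × v ≤ a × ¬ Forbidden u v) ⊎ (a ≤ u × E G' (u ∸ A) (v ∸ A) ≡ true)
  edge-elim {u} {v} q u<v with ∨-true {E (K a ε) u v} q
  ... | inj₁ k with K-elim {u} {v} k
  ...   | (u≥1 , _) , (_ , v≤a) , ok = inj₁ (≤-trans u<v v≤a , u≥1 , v≤a , ok)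
  edge-elim {u} {v} q u<v | inj₂ h with ∧-true {a ≤ᵇ u} h
  ...   | h₁ , h' with ∧-true {a ≤ᵇ v} h'
  ...     | h₂ , h₃ = inj₂ (≤ᵇ-true h₁ , subst₂ (λ x y → E G' x y ≡ true) (∸-shift (≤ᵇ-true h₁)) (∸-shift (≤ᵇ-true h₂)) h₃)

  -- Trees on the two sides of a, gluing and ungluing

  up : ℕ → ℕ
  up x = A + x

  up² : ℕ × ℕ → ℕ × ℕ
  up² (u , v) = up u , up v

  down² : ℕ × ℕ → ℕ × ℕ
  down² (u , v) = u ∸ A , v ∸ A

  down-up : ∀ x → up x ∸ A ≡ x
  down-up = m+n∸m≡n A

  up-down : ∀ {x} → a ≤ x → up (x ∸ A) ≡ x
  up-down le = m+[n∸m]≡n (≤-trans (n≤1+n A) le)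

  up-injective : ∀ {x y} → up x ≡ up y → x ≡ y
  up-injective {x} {y} = +-cancelˡ-≡ A x y

  up-increasing : ∀ {xs} → Increasing xs → Increasing (map up xs)
  up-increasing = AllPairsₚ.map⁺ ∘ AllPairs.map (+-monoʳ-< A)

  map-down-up : ∀ xs → map (_∸ A) (map up xs) ≡ xs
  map-down-up xs = trans (sym (map-∘ xs)) (trans (map-cong down-up xs) (map-id xs))

  map-up-down : ∀ {xs} → (∀ {x} → x ∈ xs → a ≤ x) → map up (map (_∸ A) xs) ≡ xs
  map-up-down {[]} _ = refl
  map-up-down {x ∷ xs} h = cong₂ _∷_ (up-down (h (here refl))) (map-up-down (h ∘ there))

  map-down²-up² : ∀ es → map down² (map up² es) ≡ es
  map-down²-up² es = trans (sym (map-∘ es)) (trans (map-cong (λ e → cong₂ _,_ (down-up (proj₁ e)) (down-up (proj₂ e))) es) (map-id es))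

  map-up²-down² : ∀ {es : List (ℕ × ℕ)} → (∀ {u v} → (u , v) ∈ es → a ≤ u × a ≤ v) → map up² (map down² es) ≡ es
  map-up²-down² {[]} _ = refl
  map-up²-down² {_ ∷ es} h = cong₂ _∷_ (cong₂ _,_ (up-down (proj₁ (h (here refl)))) (up-down (proj₂ (h (here refl))))) (map-up²-down² (h ∘ there))

  tree-up : ∀ {W Fs} → Tree G' W Fs → Tree G (map up W) (map up² Fs)
  tree-up {W} {Fs} (tree {bs} {z} e s inc ed) = tree (trans (cong (map up) e) (map-++ up bs (z ∷ [])))
    (trans (sym (map-∘ Fs)) (trans (map-∘ Fs) (cong (map up) s))) (up-increasing inc) edges'
    where
    edges' : ∀ {u v} → (u , v) ∈ map up² Fs → u < v × v ∈ map up W × E G u v ≡ true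
    edges' e∈ with ∈-map⁻ up² e∈
    ... | (x , y) , f∈ , refl with ed f∈
    ... | lt , y∈ , q = +-monoʳ-< A lt , ∈-map⁺ up y∈ , high-edge q

  tree-down : ∀ {Vs Es} → Tree G Vs Es → (∀ {v} → v ∈ Vs → a ≤ v) → Tree G' (map (_∸ A) Vs) (map down² Es)
  tree-down {Vs} {Es} t@(tree {bs} {z} e s inc ed) hi = tree (trans (cong (map (_∸ A)) e) (map-++ (_∸ A) bs (z ∷ [])))
    (trans (sym (map-∘ Es)) (trans (map-∘ Es) (cong (map (_∸ A)) s))) (lower inc hi) edges'
    where
    lower : ∀ {xs} → Increasing xs → (∀ {v} → v ∈ xs → a ≤ v) → Increasing (map (_∸ A) xs)
    lower [] _ = []
    lower (p ∷ ps) h = Allₚ.map⁺ (All.tabulate (λ y∈ → ∸-monoˡ-< (All.lookup p y∈) (≤-trans (n≤1+n A) (h (here refl))))) ∷ lower ps (h ∘ there)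
    edges' : ∀ {u v} → (u , v) ∈ map down² Es → u < v × v ∈ map (_∸ A) Vs × E G' u v ≡ true
    edges' e∈ with ∈-map⁻ down² e∈
    ... | (x , y) , f∈ , refl with ed f∈
    ... | lt , y∈ , q with edge-elim {x} {y} q lt
    ... | inj₁ (x<a , _) = ⊥-elim (<⇒≱ x<a (hi (Tree.source∈ t f∈)))
    ... | inj₂ (x≥ , q') = ∸-monoˡ-< lt (≤-trans (n≤1+n A) x≥) , ∈-map⁺ (_∸ A) y∈ , q'

  high-edges : ∀ {Vs Es} → Tree G Vs Es → (∀ {v} → v ∈ Vs → a ≤ v) → ∀ {u v} → (u , v) ∈ Es → a ≤ u × a ≤ v
  high-edges t hi e∈ = hi (Tree.source∈ t e∈) , hi (proj₁ (proj₂ (Tree.edges t e∈)))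

  up-1 : up 1 ≡ a
  up-1 = +-comm A 1

  -- `a` is the top of the left tree, hence has no parent there, and any edge upwards from it comes
  -- from the right tree; the two edge lists therefore concatenate to one parent function.
  glue-tree : ∀ {vs Es W' Fs} → Tree G (vs ++ a ∷ []) Es → Tree G' (1 ∷ W') Fs → Tree G (vs ++ map up (1 ∷ W')) (Es ++ map up² Fs)
  glue-tree {vs} {Es} {W'} {Fs} t s with tree-up s | ∷ʳ-injective vs (Tree.below t) (Tree.vertices t)
  ... | s' | refl , refl = tree (trans (cong (vs ++_) (Tree.vertices s')) (sym (++-assoc vs (Tree.below s') _)))
      (trans (map-++ proj₁ Es (map up² Fs)) (cong₂ _++_ (Tree.sources t) (Tree.sources s')))
      (increasing-++ (proj₁ (increasing-split vs (Tree.increasing t))) (Tree.increasing s')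
        (λ x∈ y∈ → ≤-trans (proj₂ (proj₂ (increasing-split vs (Tree.increasing t))) x∈ (here refl)) (a≤ (Tree.increasing s') y∈)))
      edges'
    where
    a≤ : ∀ {y} → Increasing (map up (1 ∷ W')) → y ∈ map up (1 ∷ W') → a ≤ y
    a≤ _ (here refl) = ≤-reflexive (sym up-1)
    a≤ (p ∷ _) (there y∈) = ≤-trans (≤-reflexive (sym up-1)) (<⇒≤ (All.lookup p y∈))
    edges' : ∀ {u v} → (u , v) ∈ Es ++ map up² Fs → u < v × v ∈ vs ++ map up (1 ∷ W') × E G u v ≡ true
    edges' e∈ with ∈-++⁻ Es e∈
    ... | inj₂ f∈ with Tree.edges s' f∈
    ...   | lt , v∈ , q = lt , ∈-++⁺ʳ vs v∈ , q
    edges' e∈ | inj₁ f∈ with Tree.edges t f∈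
    ...   | lt , v∈ , q with ∈-++⁻ vs v∈
    ...     | inj₁ v∈vs = lt , ∈-++⁺ˡ v∈vs , q
    ...     | inj₂ (here refl) = lt , ∈-++⁺ʳ vs (here (sym up-1)) , q

  record Unglued (Vs : List ℕ) (Es : List (ℕ × ℕ)) : Set where
    constructor unglued
    field
      {vs} {W'} : List ℕ
      {Ls} {Fs} : List (ℕ × ℕ)
      vertices≡ : Vs ≡ vs ++ map up (1 ∷ W')
      edges≡    : Es ≡ Ls ++ map up² Fs
      left      : Tree G (vs ++ a ∷ []) Ls
      right     : Tree G' (1 ∷ W') Fs

  -- Edges are sorted by lower end, so they can be cut at the position of `a`. Those with lower end
  -- below `a` cannot pass `a`, since it separates the two sides.
  unglue : ∀ {Vs Es} → Tree G Vs Es → a ∈ Vs → Unglued Vs Es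
  unglue {Vs} {Es} t a∈ with ∈-∃++ a∈
  ... | vs , vr , refl with snoc-view (a ∷ vr) (s≤s z≤n)
  ... | bs , z , vr≡ with ∷ʳ-injective (vs ++ bs) (Tree.below t) (trans (++-assoc vs bs (z ∷ [])) (trans (cong (vs ++_) (sym vr≡)) (Tree.vertices t)))
  ... | b≡ , refl with map-split proj₁ Es vs (trans (Tree.sources t) (sym b≡))
  ... | Ls , Rs , refl , ls≡ , rs≡ = unglued {Fs = map down² Rs}
      (cong (vs ++_) (sym (trans (cong (λ x → map up (x ∷ map (_∸ A) vr)) (sym a∸A)) (map-up-down hi))))
      (cong (Ls ++_) (sym (map-up²-down² (high-edges right hi))))
      left (subst (λ x → Tree G' (x ∷ map (_∸ A) vr) (map down² Rs)) a∸A (tree-down right hi))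
    where
    a∸A : a ∸ A ≡ 1
    a∸A = trans (cong (_∸ A) (+-comm 1 A)) (down-up 1)
    pieces = increasing-split vs (Tree.increasing t)
    hi : ∀ {v} → v ∈ a ∷ vr → a ≤ v
    hi (here refl) = ≤-refl
    hi (there v∈) with proj₁ (proj₂ pieces)
    ... | p ∷ _ = <⇒≤ (All.lookup p v∈)
    bs⊂ : ∀ {v} → v ∈ bs → v ∈ a ∷ vr
    bs⊂ v∈ = recast (sym vr≡) (∈-++⁺ˡ v∈)
    left-edges : ∀ {u v} → (u , v) ∈ Ls → u < v × v ∈ vs ++ a ∷ [] × E G u v ≡ true
    left-edges {u} {v} e∈ with Tree.edges t (∈-++⁺ˡ e∈)
    ... | lt , v∈ , q with edge-elim {u} {v} q lt
    ... | inj₂ (u≥a , _) = ⊥-elim (<⇒≱ (proj₂ (proj₂ pieces) (recast ls≡ (∈-map⁺ proj₁ e∈)) (here refl)) u≥a)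
    ... | inj₁ (_ , _ , v≤a , _) with ∈-++⁻ vs v∈
    ...   | inj₁ v∈vs = lt , ∈-++⁺ˡ v∈vs , q
    ...   | inj₂ v∈r = lt , ∈-++⁺ʳ vs (here (≤-antisym v≤a (hi v∈r))) , q
    left : Tree G (vs ++ a ∷ []) Ls
    left = tree refl ls≡ (increasing-++ (proj₁ pieces) ([] ∷ []) (λ where x∈ (here refl) → proj₂ (proj₂ pieces) x∈ (here refl))) left-edges
    right-edges : ∀ {u v} → (u , v) ∈ Rs → u < v × v ∈ a ∷ vr × E G u v ≡ true
    right-edges {u} {v} e∈ with Tree.edges t (∈-++⁺ʳ Ls e∈)
    ... | lt , v∈ , q with ∈-++⁻ vs v∈
    ...   | inj₂ v∈r = lt , v∈r , q
    ...   | inj₁ v∈vs = ⊥-elim (<⇒≱ (proj₂ (proj₂ pieces) v∈vs (here refl)) (≤-trans (hi (bs⊂ (recast rs≡ (∈-map⁺ proj₁ e∈)))) (<⇒≤ lt)))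
    right : Tree G (a ∷ vr) Rs
    right = tree vr≡ rs≡ (proj₁ (proj₂ pieces)) right-edges

  joined-up : ∀ {Fs u v} → Joined Fs u v → Joined (map up² Fs) (up u) (up v)
  joined-up (inj₁ p) = inj₁ (∈-map⁺ up² p)
  joined-up (inj₂ p) = inj₂ (∈-map⁺ up² p)

  joined-down : ∀ {Fs u v} → Joined (map up² Fs) (up u) (up v) → Joined Fs u v
  joined-down (inj₁ p) with ∈-map⁻ up² p
  ... | (x , y) , q , e with up-injective (cong proj₁ e) | up-injective (cong proj₂ e)
  ... | refl | refl = inj₁ q
  joined-down (inj₂ p) with ∈-map⁻ up² p
  ... | (x , y) , q , e with up-injective (cong proj₁ e) | up-injective (cong proj₂ e)
  ... | refl | refl = inj₂ q

  up-∈⁻ : ∀ {x xs} → up x ∈ map up xs → x ∈ xs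
  up-∈⁻ p with ∈-map⁻ up p
  ... | y , y∈ , e with up-injective e
  ... | refl = y∈

  candidate-up : ∀ {W Fs rd v} → Candidate W Fs rd v → Candidate (map up W) (map up² Fs) (map up rd) (up v)
  candidate-up (v∈ , v∉ , u , u∈ , j) = ∈-map⁺ up v∈ , v∉ ∘ up-∈⁻ , up u , ∈-map⁺ up u∈ , joined-up j

  greedy-up : ∀ {W Fs rd rest} → Greedy W Fs rd rest → Greedy (map up W) (map up² Fs) (map up rd) (map up rest)
  greedy-up {W} {Fs} {rd} (done all) = done λ v∈ → case ∈-map⁻ up v∈ of λ where (x , x∈ , refl) → ∈-map⁺ up (all x∈)
  greedy-up {W} {Fs} {rd} (next {v = v} {rest} c least g) = next (candidate-up c) least'
      (subst (λ l → Greedy (map up W) (map up² Fs) l (map up rest)) (map-++ up rd (v ∷ [])) (greedy-up g))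
    where
    least' : ∀ {z} → Candidate (map up W) (map up² Fs) (map up rd) z → up v ≤ z
    least' (z∈ , z∉ , u , u∈ , j) with ∈-map⁻ up z∈ | ∈-map⁻ up u∈
    ... | x , x∈ , refl | y , y∈ , refl = +-monoʳ-≤ A (least (x∈ , z∉ ∘ ∈-map⁺ up , y , y∈ , joined-down j))

  module GreedyGlue {vs Ls Hs Rs} (t : Tree G (vs ++ a ∷ []) Ls) (s : Tree G (a ∷ Hs) Rs) where
    private
      VL = vs ++ a ∷ []
      VR = a ∷ Hs
      Vs = vs ++ a ∷ Hs
      Es = Ls ++ Rs

      low : ∀ {v} → v ∈ VL → v ≤ a
      low v∈ with ∈-++⁻ vs v∈
      ... | inj₁ q = <⇒≤ (proj₂ (proj₂ (increasing-split vs (Tree.increasing t))) q (here refl))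
      ... | inj₂ (here refl) = ≤-refl

      high : ∀ {v} → v ∈ VR → a ≤ v
      high (here refl) = ≤-refl
      high (there v∈) with Tree.increasing s
      ... | p ∷ _ = <⇒≤ (All.lookup p v∈)

      VL⊂ : ∀ {v} → v ∈ VL → v ∈ Vs
      VL⊂ v∈ with ∈-++⁻ vs v∈
      ... | inj₁ q = ∈-++⁺ˡ q
      ... | inj₂ (here refl) = ∈-++⁺ʳ vs (here refl)

      either : ∀ {v} → v ∈ Vs → v ∈ VL ⊎ v ∈ VR
      either v∈ with ∈-++⁻ vs v∈
      ... | inj₁ q = inj₁ (∈-++⁺ˡ q)
      ... | inj₂ q = inj₂ q

      joinedL : ∀ {u v} → Joined Ls u v → Joined Es u v
      joinedL (inj₁ p) = inj₁ (∈-++⁺ˡ p)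
      joinedL (inj₂ p) = inj₂ (∈-++⁺ˡ p)

      joinedR : ∀ {u v} → Joined Rs u v → Joined Es u v
      joinedR (inj₁ p) = inj₁ (∈-++⁺ʳ Ls p)
      joinedR (inj₂ p) = inj₂ (∈-++⁺ʳ Ls p)

      joined-split : ∀ {u v} → Joined Es u v → (Joined Ls u v × u ∈ VL × v ∈ VL) ⊎ (Joined Rs u v × u ∈ VR × v ∈ VR)
      joined-split (inj₁ p) with ∈-++⁻ Ls p
      ... | inj₁ q = inj₁ (inj₁ q , Tree.source∈ t q , proj₁ (proj₂ (Tree.edges t q)))
      ... | inj₂ q = inj₂ (inj₁ q , Tree.source∈ s q , proj₁ (proj₂ (Tree.edges s q)))
      joined-split (inj₂ p) with ∈-++⁻ Ls p
      ... | inj₁ q = inj₁ (inj₂ q , proj₁ (proj₂ (Tree.edges t q)) , Tree.source∈ t q)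
      ... | inj₂ q = inj₂ (inj₂ q , proj₁ (proj₂ (Tree.edges s q)) , Tree.source∈ s q)

      only-a : ∀ {v} → v ∈ VL → v ∈ VR → v ≡ a
      only-a p q = ≤-antisym (low p) (high q)

    module _ {σ} (σ⊂ : ∀ {v} → v ∈ σ → v ∈ VL) (⊂σ : ∀ {v} → v ∈ VL → v ∈ σ) where
      private
        a∈σ : a ∈ σ
        a∈σ = ⊂σ (∈-++⁺ʳ vs (here refl))

        liftR : ∀ {τ v} → v ∈ a ∷ τ → v ∈ σ ++ τ
        liftR (here refl) = ∈-++⁺ˡ a∈σ
        liftR (there v∈) = ∈-++⁺ʳ σ v∈

        lowerR : ∀ {τ v} → v ∈ VR → v ∈ σ ++ τ → v ∈ a ∷ τ
        lowerR v∈R v∈ with ∈-++⁻ σ v∈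
        ... | inj₁ q = here (only-a (σ⊂ q) v∈R)
        ... | inj₂ q = there q

      -- Once the left tree is exhausted, `a` is its only vertex to which the right tree is
      -- attached, so the reading goes on as if only `a ∷ τ` had been read.
      glueʳ : ∀ τ {rest} → Greedy VR Rs (a ∷ τ) rest → Greedy Vs Es (σ ++ τ) rest
      glueʳ τ (done all) = done λ v∈ → [ (λ q → ∈-++⁺ˡ (⊂σ q)) , (λ q → liftR (all q)) ]′ (either v∈)
      glueʳ τ (next {v = v} {rest} (v∈ , v∉ , u , u∈ , j) least g) =
        next (∈-++⁺ʳ vs v∈ , v∉ ∘ lowerR v∈ , u , liftR u∈ , joinedR j) least'
             (subst (λ l → Greedy Vs Es l rest) (sym (++-assoc σ τ (v ∷ []))) (glueʳ (τ ++ v ∷ []) g))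
        where
        least' : ∀ {z} → Candidate Vs Es (σ ++ τ) z → v ≤ z
        least' (z∈ , z∉ , u , u∈ , j) with joined-split j
        ... | inj₁ (_ , _ , z∈L) = ⊥-elim (z∉ (∈-++⁺ˡ (⊂σ z∈L)))
        ... | inj₂ (j' , u∈R , z∈R) = least (z∈R , z∉ ∘ liftR , u , lowerR u∈R u∈ , j')

    -- Vertices above `a` become available as soon as `a` is read, but the next letter of the left
    -- reading is always smaller, so the left tree is finished first.
    glueˡ : ∀ rd {rest w'} → (∀ {v} → v ∈ rd → v ∈ VL) → Greedy VL Ls rd rest → Greedy VR Rs (a ∷ []) w' → Greedy Vs Es rd (rest ++ w')
    glueˡ rd rd⊂ (done all) h = subst (λ l → Greedy Vs Es l _) (++-identityʳ rd) (glueʳ rd⊂ all [] h)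
    glueˡ rd rd⊂ (next {v = v} {rest} c@(v∈ , v∉ , u , u∈ , j) least g) h =
      next (VL⊂ v∈ , v∉ , u , u∈ , joinedL j) least' (glueˡ (rd ++ v ∷ []) (λ x∈ → [ rd⊂ , (λ where (here refl) → v∈) ]′ (∈-++⁻ rd x∈)) g h)
      where
      least' : ∀ {z} → Candidate Vs Es rd z → v ≤ z
      least' (z∈ , z∉ , u , u∈ , j) with joined-split j
      ... | inj₁ (j' , _ , z∈L) = least (z∈L , z∉ , u , u∈ , j')
      ... | inj₂ (_ , _ , z∈R) = ≤-trans (low v∈) (high z∈R)

  -- Decoding skeletons into forests

  wordTriple : List ℕ → List ℕ → ℕ → TreeTriple
  wordTriple σ α r = tt (sort σ) (wordEdges σ (sort σ)) (reverse α) (suc r)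

  -- `front` removes `a`, which returns as the raised vertex 1 of `R`. The last part of `α` already
  -- covers the first part of the composition of `R`, whence `drop 1`.
  glueTriple : List ℕ → List ℕ → ℕ → TreeTriple → TreeTriple
  glueTriple σ α r R = tt (front (sort σ) ++ map up (V R)) (wordEdges σ (sort σ) ++ map up² (Ed R))
                          (reverse α ++ drop 1 (TreeTriple.α R)) (suc r)

  raise : TreeTriple → TreeTriple
  raise t = tt (map up (V t)) (map up² (Ed t)) (TreeTriple.α t) (TreeTriple.r t)

  -- The position leaves exactly `t` of the letters in `rem` after `a`, whether in this tree or in
  -- later ones.
  specialWord : ℕ → List ℕ → List ℕ → ℕ → List ℕ
  specialWord m rem cs t = m ∷ insertAt (length rem ∸ t) a (word cs rem)

  decodeTail : List ℕ → List Block → Forest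
  decodeTail (m ∷ rem) (blk r α cs ∷ ys) = wordTriple (m ∷ word cs rem) α r ∷ decodeTail (remaining cs rem) ys
  decodeTail _         _                 = []

  decodeLeft : ℕ → TreeTriple → List ℕ → Skeleton → Forest
  decodeLeft b R rem       (alone r)            = glueTriple (a ∷ []) (b ∷ []) r R ∷ []
  decodeLeft b R (m ∷ rem) (special r α cs t ys) = glueTriple (specialWord m rem cs t) α r R ∷ decodeTail (remaining cs rem) ys
  decodeLeft b R (m ∷ rem) (before r α cs x)     = wordTriple (m ∷ word cs rem) α r ∷ decodeLeft b R (remaining cs rem) x
  decodeLeft b R []        _                    = []

  decode : Skeleton → Forest → Forest
  decode x []      = []
  decode x (R ∷ Rs) = decodeLeft (headD 0 (TreeTriple.α R)) R (applyUpTo suc A) x ++ map raise Rs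

  tailWord : List ℕ → List Block → List ℕ
  tailWord (m ∷ rem) (blk r α cs ∷ ys) = m ∷ word cs rem ++ tailWord (remaining cs rem) ys
  tailWord _         _                 = []

  leftWord : List ℕ → Skeleton → List ℕ
  leftWord rem       (alone r)            = a ∷ []
  leftWord (m ∷ rem) (special r α cs t ys) = specialWord m rem cs t ++ tailWord (remaining cs rem) ys
  leftWord (m ∷ rem) (before r α cs x)     = m ∷ word cs rem ++ leftWord (remaining cs rem) x
  leftWord []        _                    = []

  record WordFacts (m : ℕ) (w : List ℕ) : Set where
    constructor wordFacts
    field
      sorted : sort (m ∷ w) ≡ m ∷ sort w
      wtree  : Tree G (m ∷ sort w) (wordEdges (m ∷ w) (m ∷ sort w))
      greedy : Greedy (m ∷ sort w) (wordEdges (m ∷ w) (m ∷ sort w)) (m ∷ []) w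

  -- All pairs in [a] except the removed edge are adjacent, so beyond a least first letter the only
  -- requirement on a word is that its tree avoids that edge.
  word-facts : ∀ {m w} → 1 ≤ m → Unique w → (∀ {x} → x ∈ w → m < x × x ≤ a) →
               (∀ {u} → u ∈ m ∷ w → ¬ Forbidden u (parentIn (m ∷ w) u)) → WordFacts m w
  word-facts {m} {w} m≥1 u bound ok = wordFacts eq wordTree wordGreedy
    where
    eq = sort-min u (proj₁ ∘ bound)
    inc : Increasing (m ∷ sort w)
    inc = subst Increasing eq (sort-increasing (All.tabulate (λ x∈ e → <-irrefl e (proj₁ (bound x∈))) ∷ u))
    ≥1 : ∀ {x} → x ∈ m ∷ sort w → 1 ≤ x
    ≥1 (here refl) = m≥1
    ≥1 (there x∈) = ≤-trans m≥1 (<⇒≤ (proj₁ (bound (Perm.∈-resp-↭ (sort-↭ w) x∈))))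
    edge : ∀ {u} → u ∈ m ∷ sort w → u < parentIn (m ∷ w) u → parentIn (m ∷ w) u ∈ m ∷ sort w → E G u (parentIn (m ∷ w) u) ≡ true
    edge u∈ lt (here e) = ⊥-elim (<⇒≱ lt (subst (_≤ _) (sym e) (least u∈)))
      where
      least : ∀ {x} → x ∈ m ∷ sort w → m ≤ x
      least (here refl) = ≤-refl
      least (there x∈) = <⇒≤ (proj₁ (bound (Perm.∈-resp-↭ (sort-↭ w) x∈)))
    edge u∈ lt (there p∈) = low-edge (≥1 u∈) lt (proj₂ (bound (Perm.∈-resp-↭ (sort-↭ w) p∈))) (ok (Perm.∈-resp-↭ (↭-prep m (sort-↭ w)) u∈))
    open WordTree {G} inc (↭-sym (sort-↭ w)) edge

  wordTriple-listT : ∀ {m w α r} → WordFacts m w → listT (wordTriple (m ∷ w) α r) ≡ m ∷ w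
  wordTriple-listT {m} {w} {α} {r} (wordFacts sorted t g) = go (sort (m ∷ w)) sorted
    where
    go : ∀ S → S ≡ m ∷ sort w → listT (tt S (wordEdges (m ∷ w) S) (reverse α) (suc r)) ≡ m ∷ w
    go _ refl = listT-greedy {α = reverse α} {r = suc r} (Tree.increasing t) g (↭-sym (sort-↭ w))

  glue-listT : ∀ {vs Ls W' Fs m VL w α r β s} → Tree G (vs ++ a ∷ []) Ls → Tree G' (1 ∷ W') Fs → vs ++ a ∷ [] ≡ m ∷ VL →
               Greedy (vs ++ a ∷ []) Ls (m ∷ []) w → w ↭ VL →
               listT (tt (vs ++ map up (1 ∷ W')) (Ls ++ map up² Fs) α r) ≡ m ∷ w ++ map up (drop 1 (listT (tt (1 ∷ W') Fs β s)))
  glue-listT {vs} {Ls} {W'} {Fs} {m} {VL} {w} {α} {r} {β} {s} t h e g p with tree-reading h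
  ... | w' , g' , p' rewrite listT-greedy {α = β} {r = s} (Tree.increasing h) g' p' = go vs e (Tree.increasing (glue-tree t h)) whole
    where
    whole : Greedy (vs ++ map up (1 ∷ W')) (Ls ++ map up² Fs) (m ∷ []) (w ++ map up w')
    whole = subst (λ k → Greedy (vs ++ k ∷ map up W') (Ls ++ map up² Fs) (m ∷ []) (w ++ map up w')) (sym up-1)
      (GreedyGlue.glueˡ t (subst (λ k → Tree G (k ∷ map up W') (map up² Fs)) up-1 (tree-up h)) (m ∷ [])
        (λ where (here refl) → recast (sym e) (here refl)) g
        (subst (λ k → Greedy (k ∷ map up W') (map up² Fs) (k ∷ []) (map up w')) up-1 (greedy-up g')))
    go : ∀ vs → vs ++ a ∷ [] ≡ m ∷ VL → Increasing (vs ++ map up (1 ∷ W')) →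
         Greedy (vs ++ map up (1 ∷ W')) (Ls ++ map up² Fs) (m ∷ []) (w ++ map up w') →
         listT (tt (vs ++ map up (1 ∷ W')) (Ls ++ map up² Fs) α r) ≡ m ∷ w ++ map up w'
    go [] refl inc gr with Perm.↭-empty-inv (↭-sym (↭-sym p))
    ... | refl rewrite up-1 = listT-greedy {α = α} {r = r} inc gr (Perm.map⁺ up p')
    go (v ∷ vs) e' inc gr with ∷-injective e'
    ... | refl , refl = listT-greedy {α = α} {r = r} inc gr (↭-trans (Perm.++⁺ p (Perm.map⁺ up p'))
            (↭-reflexive (trans (++-assoc vs (a ∷ []) (map up W')) (cong (λ k → vs ++ k ∷ map up W') (sym up-1)))))

  -- Invariant of the induction along a skeleton. The letter `a` belongs to both filtered lists;
  -- `heads∈` is what lets a tree with a smaller head be put in front.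
  record Facts (rem H low high : List ℕ) (F : Forest) : Set where
    constructor facts
    field
      trees    : All (IsTreeTriple G) F
      verts    : concat (map V F) ↭ rem ++ H
      increase : Increasing (heads F)
      heads∈   : ∀ {h} → h ∈ heads F → h ∈ rem ⊎ h ≡ a
      lowList  : filterᵇ (_≤ᵇ a) (concat (map listT F)) ≡ low
      highList : filterᵇ (a ≤ᵇ_) (concat (map listT F)) ≡ high

  filter-low : ∀ xs → (∀ {x} → x ∈ xs → x < a) → filterᵇ (_≤ᵇ a) xs ≡ xs × filterᵇ (a ≤ᵇ_) xs ≡ []
  filter-low xs h = filter-full _ xs (λ x∈ → ≤ᵇ-intro (<⇒≤ (h x∈))) , filter-empty _ xs (λ x∈ → ≤ᵇ-false (h x∈))

  extend : ∀ {rem rem' m w H low high F α r} → WordFacts m w → WellFormed r α → sum α ≡ suc (length w) →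
           (∀ {x} → x ∈ m ∷ w → x < a) → (∀ {x} → x ∈ rem' → m < x) → w ++ rem' ↭ rem →
           Facts rem' H low high F → Facts (m ∷ rem) H (m ∷ w ++ low) high (wordTriple (m ∷ w) α r ∷ F)
  extend {rem} {rem'} {m} {w} {H} {low} {high} {F} {α} {r} wf@(wordFacts sorted t g) (pos , r<) s lt m< p (facts ts vs inc h∈ ll hl) =
    facts ((subst (λ S → IsDecSubtree G S (wordEdges (m ∷ w) S)) (sym sorted) (FromTree.isDecSubtree t) ,
            (Perm.All-resp-↭ (↭-sym (Perm.↭-reverse α)) pos ,
             trans (sum-reverse α) (trans s (sym (Perm.↭-length (sort-↭ (m ∷ w)))))) ,
            s≤s z≤n , subst (suc r ≤_) (sym (trans (cong (headD 0) (sym (++-identityʳ (reverse α)))) (headD-reverse α (≤-trans (s≤s z≤n) r<)))) r<) ∷ ts)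
      (↭-trans (Perm.++⁺ (sort-↭ (m ∷ w)) vs) (↭-prep m (↭-trans (↭-reflexive (sym (++-assoc w rem' H))) (Perm.++⁺ʳ H p))))
      (subst (λ l → Increasing (headD 0 l ∷ heads F)) (sym sorted) (All.tabulate below ∷ inc))
      heads'
      (trans (filterᵇ-++ _ (listT tr) _) (cong₂ _++_ (trans (cong (filterᵇ _) lst) (proj₁ (filter-low (m ∷ w) lt))) ll))
      (trans (filterᵇ-++ _ (listT tr) _) (cong₂ _++_ (trans (cong (filterᵇ _) lst) (proj₂ (filter-low (m ∷ w) lt))) hl))
    where
    tr = wordTriple (m ∷ w) α r
    lst : listT tr ≡ m ∷ w
    lst = wordTriple-listT {α = α} {r = r} wf
    below : ∀ {h} → h ∈ heads F → m < h
    below h∈F with h∈ h∈F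
    ... | inj₁ q = m< q
    ... | inj₂ refl = lt (here refl)
    heads' : ∀ {h} → h ∈ headD 0 (sort (m ∷ w)) ∷ heads F → h ∈ m ∷ rem ⊎ h ≡ a
    heads' (here refl) = inj₁ (here (cong (headD 0) sorted))
    heads' (there q) with h∈ q
    ... | inj₁ q' = inj₁ (there (Perm.∈-resp-↭ p (∈-++⁺ʳ w q')))
    ... | inj₂ e = inj₂ e

  Letters : List ℕ → Set
  Letters rem = Increasing rem × (∀ {x} → x ∈ rem → 1 ≤ x × x < a)

  letters-remaining : ∀ {m rem} cs → Letters (m ∷ rem) → IsCode (length rem) cs → Letters (remaining cs rem)
  letters-remaining {m} {rem} cs (_ ∷ inc , bound) code = remaining-increasing cs code inc ,
    λ x∈ → bound (there (Perm.∈-resp-↭ (word-↭ cs code) (∈-++⁺ʳ (word cs rem) x∈)))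

  module FirstBlock {m rem} (L : Letters (m ∷ rem)) (cs : List ℕ) (code : IsCode (length rem) cs) where
    word∈ : ∀ {x} → x ∈ word cs rem → x ∈ rem
    word∈ x∈ = Perm.∈-resp-↭ (word-↭ cs code) (∈-++⁺ˡ x∈)

    remaining∈ : ∀ {x} → x ∈ remaining cs rem → x ∈ rem
    remaining∈ x∈ = Perm.∈-resp-↭ (word-↭ cs code) (∈-++⁺ʳ (word cs rem) x∈)

    above : ∀ {x} → x ∈ rem → m < x
    above x∈ with proj₁ L
    ... | p ∷ _ = All.lookup p x∈

    bound : ∀ {x} → x ∈ m ∷ word cs rem → x < a
    bound (here refl) = proj₂ (proj₂ L (here refl))
    bound (there x∈) = proj₂ (proj₂ L (there (word∈ x∈)))

    word-unique : Unique (word cs rem)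
    word-unique with proj₁ L
    ... | _ ∷ inc = proj₁ (unique-++⁻ (word cs rem) (unique-↭ (↭-sym (word-↭ cs code)) (increasing⇒unique inc)))

    parent∈ : ∀ {w} {u} → parentIn w u ∈ 0 ∷ w
    parent∈ {w} {u} = go [] w
      where
      gt : ∀ l → firstGt u l ∈ 0 ∷ l
      gt [] = here refl
      gt (x ∷ l) with u <ᵇ x
      ... | true = there (here refl)
      ... | false with gt l
      ...   | here e = here e
      ...   | there q = there (there q)
      go : ∀ seen l → parentFrom seen l u ∈ 0 ∷ seen ++ l
      go seen [] = here refl
      go seen (x ∷ l) with x ≡ᵇ u
      ... | true with gt (seen ++ l)
      ...   | here e = here e
      ...   | there q with ∈-++⁻ seen q
      ...     | inj₁ q' = there (∈-++⁺ˡ q')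
      ...     | inj₂ q' = there (∈-++⁺ʳ seen (there q'))
      go seen (x ∷ l) | false with go (x ∷ seen) l
      ... | here e = here e
      ... | there (here e) = there (∈-++⁺ʳ seen (here e))
      ... | there (there q) with ∈-++⁻ seen q
      ...   | inj₁ q' = there (∈-++⁺ˡ q')
      ...   | inj₂ q' = there (∈-++⁺ʳ seen (there q'))

    plain : WordFacts m (word cs rem)
    plain = word-facts (proj₁ (proj₂ L (here refl))) word-unique (λ x∈ → above (word∈ x∈) , <⇒≤ (bound (there x∈))) allowed
      where
      allowed : ∀ {u} → u ∈ m ∷ word cs rem → ¬ Forbidden u (parentIn (m ∷ word cs rem) u)
      allowed {u} _ (_ , _ , p≡a) with parent∈ {m ∷ word cs rem} {u}
      ... | here e = case trans (sym e) p≡a of λ ()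
      ... | there q = <-irrefl p≡a (bound q)

  facts-tail : ∀ {rem ys} → Letters rem → ValidTail (length rem) ys → Facts rem [] (tailWord rem ys) [] (decodeTail rem ys)
  facts-tail {[]} L [] = facts [] ↭-refl [] (λ ()) refl refl
  facts-tail {m ∷ rem} L (_∷_ {n} {r = r} {α} {cs} {ys} (wf , s , code , e) v) =
    extend plain wf (trans s (cong suc (sym (length-word cs rem)))) bound (above ∘ remaining∈) (word-↭ cs code')
      (facts-tail (letters-remaining cs L code') (subst (λ k → ValidTail k ys) len v))
    where
    code' : IsCode (length rem) cs
    code' = subst (λ k → IsCode k cs) (sym (suc-injective e)) code
    len : n ≡ length (remaining cs rem)
    len = +-cancelˡ-≡ (length cs) _ _ (trans (sym (suc-injective e)) (sym (length-remaining cs code')))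
    open FirstBlock L cs code'

  -- Either the bound on `t` still takes the missing edge into account, or vertex 1 has been used by
  -- an earlier tree.
  Guard : ℕ → List ℕ → Set
  Guard ε' rem = ε ≤ ε' ⊎ (∀ {x} → x ∈ rem → 2 ≤ x)

  module _ {W' Fs b β} (isT : IsTreeTriple G' (tt (1 ∷ W') Fs (b ∷ β) 1)) where
    private
      R = tt (1 ∷ W') Fs (b ∷ β) 1
      right : Tree G' (1 ∷ W') Fs
      right = ToTree.toTree (proj₁ isT)
      comp = proj₁ (proj₂ isT)

    b≥1 : 1 ≤ b
    b≥1 with proj₁ comp
    ... | p ∷ _ = p

    right-listT : ∃ λ w → listT R ≡ 1 ∷ w × w ↭ W'
    right-listT with tree-reading right
    ... | w , g , p = w , listT-greedy {α = b ∷ β} {r = 1} (Tree.increasing right) g p , p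

    >a : ∀ {x w} → w ↭ W' → x ∈ map up w → a < x
    >a p x∈ with ∈-map⁻ up x∈ | Tree.increasing right
    ... | y , y∈ , refl | lts ∷ _ = subst (_< up y) up-1 (+-monoʳ-< A (All.lookup lts (Perm.∈-resp-↭ p y∈)))

    glue-extend : ∀ {m w L rem rem' low F α r} → WordFacts m w → (∀ {x} → x ∈ m ∷ w → x ≤ a) →
      m ∷ w ↭ a ∷ L → L ++ rem' ↭ rem → WellFormed r α → sum α ≡ length w + b →
      Facts rem' [] low [] F → (∀ {h} → h ∈ heads F → m < h) → (∀ {x} → x ∈ rem' → x < a) → m ∈ rem ⊎ m ≡ a →
      Facts rem (map up (1 ∷ W')) (m ∷ w ++ low) (map up (listT R)) (glueTriple (m ∷ w) α r R ∷ F)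
    glue-extend {m} {w} {L} {rem} {rem'} {low} {F} {α} {r} (wordFacts sorted t g) ≤a perm p (pos , r<) s (facts ts vs inc h∈ ll hl) m< <a m∈ =
      facts (tree-triple ∷ ts) verts' (subst (λ h → Increasing (h ∷ heads F)) (sym head≡) (All.tabulate m< ∷ inc)) heads'
        (trans (filterᵇ-++ (_≤ᵇ a) (listT tr) (concat (map listT F))) (cong₂ _++_ lowT ll))
        (trans (filterᵇ-++ (a ≤ᵇ_) (listT tr) (concat (map listT F))) (trans (cong₂ _++_ highT hl) (++-identityʳ _)))
      where
      tr = glueTriple (m ∷ w) α r R
      vs' = front (m ∷ sort w)
      incσ : Increasing (m ∷ sort w)
      incσ = Tree.increasing t
      σ↭ : m ∷ sort w ↭ m ∷ w
      σ↭ = ↭-prep m (sort-↭ w)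
      a∈ : a ∈ m ∷ w
      a∈ = Perm.∈-resp-↭ (↭-sym perm) (here refl)
      snoc : m ∷ sort w ≡ vs' ++ a ∷ []
      snoc = front-max incσ (Perm.∈-resp-↭ (↭-sym σ↭) a∈) (≤a ∘ Perm.∈-resp-↭ σ↭)
      left : Tree G (vs' ++ a ∷ []) (wordEdges (m ∷ w) (m ∷ sort w))
      left = subst (λ S → Tree G S (wordEdges (m ∷ w) (m ∷ sort w))) snoc t
      vs'↭ : vs' ↭ L
      vs'↭ = ↭-trans (↭-reflexive (sym (++-identityʳ vs'))) (Perm.drop-mid vs' [] (↭-trans (↭-reflexive (sym snoc)) (↭-trans σ↭ perm)))
      length-vs' : length vs' ≡ length w
      length-vs' = suc-injective (trans (sym (trans (cong length snoc) (trans (length-++ vs') (+-comm _ 1)))) (Perm.↭-length σ↭))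
      V≡ : V tr ≡ vs' ++ map up (1 ∷ W')
      V≡ = cong (λ S → front S ++ map up (1 ∷ W')) sorted
      head≡ : headD 0 (V tr) ≡ m
      head≡ = trans (cong (headD 0) V≡) (go vs' snoc)
        where
        go : ∀ us → m ∷ sort w ≡ us ++ a ∷ [] → headD 0 (us ++ map up (1 ∷ W')) ≡ m
        go [] e = trans up-1 (sym (∷-injectiveˡ e))
        go (u ∷ us) e = sym (∷-injectiveˡ e)
      tree-triple : IsTreeTriple G tr
      tree-triple = subst (λ S → IsDecSubtree G (front S ++ map up (1 ∷ W')) (wordEdges (m ∷ w) S ++ map up² Fs)) (sym sorted)
                      (FromTree.isDecSubtree (glue-tree left right)) ,
        (Allₚ.++⁺ (Perm.All-resp-↭ (↭-sym (Perm.↭-reverse α)) pos) (All.tail (proj₁ comp)) ,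
         trans (sum-++ (reverse α) β) (balance (cong₂ _+_ (sum-reverse α) (cong₂ _+_ s (cong₂ _+_ (proj₂ comp) (cong₂ _+_ (sym (trans (cong length V≡) (length-++ vs'))) (cong₂ _+_ (sym (length-map up W')) (sym length-vs')))))) (solve 9 (λ i j k l m n o p q → i :+ j :+ (l :+ (q :+ m :+ (con 1 :+ p :+ (k :+ (o :+ n))))) := k :+ (i :+ (l :+ (m :+ j :+ (n :+ (con 1 :+ o) :+ (p :+ q)))))) refl (sum (reverse α)) (sum β) (length (front (sort (m ∷ w)) ++ up 1 ∷ map up W')) (sum α) b (length (front (m ∷ sort w))) (length (map up W')) (length W') (length w)))) ,
        s≤s z≤n , subst (suc r ≤_) (sym (headD-reverse α {β} (≤-trans (s≤s z≤n) r<))) r<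
      verts' : concat (map V (tr ∷ F)) ↭ rem ++ map up (1 ∷ W')
      verts' = ↭-trans (↭-reflexive (cong (_++ concat (map V F)) V≡)) (↭-trans (↭-reflexive (++-assoc vs' _ _))
        (↭-trans (Perm.++⁺ vs'↭ (↭-trans (Perm.++⁺ˡ (map up (1 ∷ W')) (↭-trans vs (↭-reflexive (++-identityʳ rem')))) (Perm.++-comm (map up (1 ∷ W')) rem')))
        (↭-trans (↭-reflexive (sym (++-assoc L rem' _))) (Perm.++⁺ʳ (map up (1 ∷ W')) p))))
      heads' : ∀ {h} → h ∈ heads (tr ∷ F) → h ∈ rem ⊎ h ≡ a
      heads' (here refl) = [ (λ q → inj₁ (subst (_∈ rem) (sym head≡) q)) , (λ e → inj₂ (trans head≡ e)) ]′ m∈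
      heads' (there q) with h∈ q
      ... | inj₁ q' = inj₁ (Perm.∈-resp-↭ p (∈-++⁺ʳ L q'))
      ... | inj₂ e = inj₂ e
      wR = proj₁ right-listT
      list≡ : listT tr ≡ (m ∷ w) ++ map up wR
      list≡ = trans (go (sort (m ∷ w)) sorted) (cong (λ l → m ∷ w ++ map up (drop 1 l)) (proj₁ (proj₂ right-listT)))
        where
        go : ∀ S → S ≡ m ∷ sort w →
             listT (tt (front S ++ map up (1 ∷ W')) (wordEdges (m ∷ w) S ++ map up² Fs) (reverse α ++ β) (suc r)) ≡ m ∷ w ++ map up (drop 1 (listT R))
        go _ refl = glue-listT {α = reverse α ++ β} {suc r} {b ∷ β} {1} left right (sym snoc) (subst (λ S → Greedy S _ (m ∷ []) w) snoc g) (↭-sym (sort-↭ w))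
      uniq : Unique (m ∷ w)
      uniq = unique-↭ σ↭ (increasing⇒unique incσ)
      lowT : filterᵇ (_≤ᵇ a) (listT tr) ≡ m ∷ w
      lowT = trans (cong (filterᵇ (_≤ᵇ a)) list≡) (trans (filterᵇ-++ (_≤ᵇ a) (m ∷ w) (map up wR))
        (trans (cong₂ _++_ (filter-full (_≤ᵇ a) (m ∷ w) (λ x∈ → ≤ᵇ-intro (≤a x∈)))
          (filter-empty (_≤ᵇ a) (map up wR) (λ x∈ → ≤ᵇ-false (>a (proj₂ (proj₂ right-listT)) x∈)))) (++-identityʳ (m ∷ w))))
      highT : filterᵇ (a ≤ᵇ_) (listT tr) ≡ map up (listT R)
      highT = trans (cong (filterᵇ (a ≤ᵇ_)) list≡) (trans (filterᵇ-++ (a ≤ᵇ_) (m ∷ w) (map up wR))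
        (trans (cong₂ _++_ (unique-filter (a ≤ᵇ_) uniq a∈ (≤ᵇ-intro {a} ≤-refl) (λ x∈ q → ≤-antisym (≤a x∈) (≤ᵇ-true q)))
          (filter-full (a ≤ᵇ_) (map up wR) (λ x∈ → ≤ᵇ-intro (<⇒≤ (>a (proj₂ (proj₂ right-listT)) x∈)))))
          (trans (cong (_∷ map up wR) (sym up-1)) (cong (map up) (sym (proj₁ (proj₂ right-listT)))))))

    open Skeletons b b≥1

    module SpecialBlock {m rem} (L : Letters (m ∷ rem)) {ε' n t cs} (guard : Guard ε' (m ∷ rem)) (code : IsCode (length rem) cs)
      (n≤t : n ≤ t) (len : length rem ≡ length cs + n) (t≤ : ε' + t ≤ length rem) where
      open FirstBlock L cs code public

      k : ℕ
      k = length rem ∸ t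

      k≤ : k ≤ length (word cs rem)
      k≤ = subst (k ≤_) (sym (length-word cs rem)) (≤-trans (∸-monoʳ-≤ (length rem) n≤t) (≤-reflexive (trans (cong (_∸ n) len) (m+n∸n≡m (length cs) n))))

      w : List ℕ
      w = insertAt k a (word cs rem)

      w↭ : w ↭ a ∷ word cs rem
      w↭ = insertAt-↭ k a (word cs rem)

      a∉ : a ∉ word cs rem
      a∉ a∈ = <-irrefl refl (bound (there a∈))

      bound-w : ∀ {x} → x ∈ w → m < x × x ≤ a
      bound-w x∈ with Perm.∈-resp-↭ w↭ x∈
      ... | here refl = bound (here refl) , ≤-refl
      ... | there q = above (word∈ q) , <⇒≤ (bound (there q))

      special-facts : WordFacts m w
      special-facts = word-facts m≥1 (unique-↭ (↭-sym w↭) (All.tabulate (λ x∈ e → a∉ (subst (_∈ word cs rem) (sym e) x∈)) ∷ word-unique)) bound-w ok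
        where
        m≥1 = proj₁ (proj₂ L (here refl))
        -- `1 ≤ j` puts a letter other than `a` right after 1. It is larger than 1, so it is the
        -- parent of 1.
        head-ok : ∀ j v → j ≤ length v → 1 ≤ j → (∀ {x} → x ∈ v → 1 < x × x < a) → firstGt 1 (insertAt j a v) ≢ a
        head-ok (suc j) (y ∷ v) _ _ h e = <-irrefl (trans (sym (firstGt-here (take j v ++ a ∷ drop j v) (proj₁ (h (here refl))))) e) (proj₂ (h (here refl)))
        ok : ∀ {u} → u ∈ m ∷ w → ¬ Forbidden u (parentIn (m ∷ w) u)
        ok (there u∈) (_ , refl , _) = <⇒≱ (proj₁ (bound-w u∈)) m≥1
        ok (here refl) (ε≥1 , refl , p≡a) = [ missing , (λ ≥2 → <⇒≱ (≥2 (here refl)) ≤-refl) ]′ guard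
          where
          missing : ε ≤ ε' → ⊥
          missing ε≤ε' = head-ok k (word cs rem) k≤ (m<n⇒0<n∸m (≤-trans (+-monoˡ-≤ t (≤-trans ε≥1 ε≤ε')) t≤))
                            (λ x∈ → above (word∈ x∈) , bound (there x∈)) p≡a

    facts-left : ∀ {ε' rem x} → Letters rem → Guard ε' rem → Valid ε' (length rem) x →
                 Facts rem (map up (1 ∷ W')) (leftWord rem x) (map up (listT R)) (decodeLeft b R rem x)
    facts-left {rem = []} L guard (vonly {r} r< _) =
      glue-extend {L = []} {rem' = []} (word-facts (s≤s z≤n) [] (λ ()) ok) (λ where (here refl) → ≤-refl) ↭-refl ↭-refl
        ((b≥1 ∷ []) , r<) (+-identityʳ b) (facts [] ↭-refl [] (λ ()) refl refl) (λ ()) (λ ()) (inj₂ refl)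
      where
      ok : ∀ {u} → u ∈ a ∷ [] → ¬ Forbidden u (parentIn (a ∷ []) u)
      ok {u} _ (_ , _ , e) with a ≡ᵇ u
      ok _ (_ , _ , ()) | true
      ok _ (_ , _ , ()) | false
    facts-left {ε'} {m ∷ rem} L guard (vspec {n} {r} {g} {l} {cs} {t} {ys} wf bg s code n≤t t≤ v e) =
      glue-extend {L = m ∷ word cs rem} {rem' = remaining cs rem} special-facts
        (λ where
          (here refl) → <⇒≤ (bound (here refl))
          (there x∈) → proj₂ (bound-w x∈))
        (↭-trans (↭-prep m w↭) (↭-swap m a ↭-refl)) (↭-prep m (word-↭ cs code')) wf
        (trans s (cong (_+ b) (trans (cong suc (sym (length-word cs rem))) (sym (Perm.↭-length w↭)))))
        ft (λ h∈ → [ above ∘ remaining∈ , (λ where refl → bound (here refl)) ]′ (Facts.heads∈ ft h∈))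
        (λ x∈ → proj₂ (proj₂ L (there (remaining∈ x∈)))) (inj₁ (here refl))
      where
      code' : IsCode (length rem) cs
      code' = subst (λ k → IsCode k cs) (sym (suc-injective e)) code
      open SpecialBlock L guard code' n≤t (suc-injective e) (subst (ε' + t ≤_) (sym (suc-injective e)) t≤)
      ft : Facts (remaining cs rem) [] (tailWord (remaining cs rem) ys) [] (decodeTail (remaining cs rem) ys)
      ft = facts-tail (letters-remaining cs L code')
             (subst (λ k → ValidTail k ys) (+-cancelˡ-≡ (length cs) _ _ (trans (sym (suc-injective e)) (sym (length-remaining cs code')))) v)
    facts-left {rem = m ∷ rem} L guard (vcons {n} {r} {d} {l} {cs} {x} wf s code v e) =
      extend plain wf (trans s (cong suc (sym (length-word cs rem)))) bound (above ∘ remaining∈) (word-↭ cs code')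
        (facts-left (letters-remaining cs L code')
          -- Only letters above the head of this tree remain, so 1 is gone and the constraint may be
          -- relaxed to 0.
          (inj₂ (λ x∈ → ≤-trans (s≤s (proj₁ (proj₂ L (here refl)))) (above (remaining∈ x∈))))
          (subst (λ k → Valid 0 k x) (+-cancelˡ-≡ (length cs) _ _ (trans (sym (suc-injective e)) (sym (length-remaining cs code')))) v))
      where
      code' : IsCode (length rem) cs
      code' = subst (λ k → IsCode k cs) (sym (suc-injective e)) code
      open FirstBlock L cs code'

  all-letters : Letters (applyUpTo suc A)
  all-letters = interval-increasing A , λ x∈ → proj₁ (interval-∈ A x∈) , s≤s (proj₂ (interval-∈ A x∈))

  raise-valid : ∀ {t} → IsTreeTriple G' t → IsTreeTriple G (raise t)
  raise-valid {t} (d , (pos , s) , r) = FromTree.isDecSubtree (tree-up (ToTree.toTree d)) , (pos , trans s (sym (length-map up (V t)))) , r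

  head-raise : ∀ {t} → IsTreeTriple G' t → headD 0 (V (raise t)) ≡ up (headD 0 (V t))
  head-raise {t} (d , _) with V t | IsDecSubtree.nonempty d
  ... | _ ∷ _ | _ = refl

  heads-raise : ∀ {F} → All (IsTreeTriple G') F → heads (map raise F) ≡ map up (heads F)
  heads-raise [] = refl
  heads-raise {t ∷ F} (p ∷ ps) = cong₂ _∷_ (head-raise {t} p) (heads-raise ps)

  verts-raise : ∀ F → concat (map V (map raise F)) ≡ map up (concat (map V F))
  verts-raise [] = refl
  verts-raise (t ∷ F) = trans (cong (map up (V t) ++_) (verts-raise F)) (sym (map-++ up (V t) _))

  module WithRight {W' Fs b β Rs} (ft : SimpleFT G' (tt (1 ∷ W') Fs (b ∷ β) 1 ∷ Rs)) where
    R₁ = tt (1 ∷ W') Fs (b ∷ β) 1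
    isT : IsTreeTriple G' R₁
    isT = All.head (proj₁ (proj₁ ft))
    isTs : All (IsTreeTriple G') Rs
    isTs = All.tail (proj₁ (proj₁ ft))
    right-heads : All (1 <_) (heads Rs) × Increasing (heads Rs)
    right-heads with Linkedₚ.Linked⇒AllPairs <-trans (proj₂ (proj₂ (proj₁ ft)))
    ... | p ∷ q = p , q
    b>0 : 1 ≤ b
    b>0 = b≥1 isT
    open Skeletons b b>0 public

    module _ {x} (v : Valid ε A x) where
      left-facts : Facts (applyUpTo suc A) (map up (1 ∷ W')) (leftWord (applyUpTo suc A) x) (map up (listT R₁)) (decodeLeft b R₁ (applyUpTo suc A) x)
      left-facts = facts-left isT all-letters (inj₁ ≤-refl) (subst (λ k → Valid ε k x) (sym (length-applyUpTo suc A)) v)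
      open Facts left-facts

      decode-forest : IsForestTriple G (decode x (R₁ ∷ Rs))
      decode-forest = Allₚ.++⁺ trees (Allₚ.map⁺ (All.map (λ {t} → raise-valid {t}) isTs)) , perm ,
          Linkedₚ.AllPairs⇒Linked (subst Increasing (sym heads≡) (increasing-++ increase (up-increasing (proj₂ right-heads)) sep))
        where
        L = decodeLeft b R₁ (applyUpTo suc A) x
        perm : concat (map V (L ++ map raise Rs)) ↭ applyUpTo suc (A + n G')
        perm = ↭-trans (↭-reflexive (trans (cong concat (map-++ V L _)) (sym (concat-++ (map V L) (map V (map raise Rs))))))
          (↭-trans (Perm.++⁺ verts (↭-reflexive (verts-raise Rs)))
          (↭-trans (↭-reflexive (trans (++-assoc (applyUpTo suc A) _ _) (cong (applyUpTo suc A ++_) (sym (map-++ up (1 ∷ W') _)))))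
          (↭-trans (Perm.++⁺ˡ (applyUpTo suc A) (Perm.map⁺ up (proj₁ (proj₂ (proj₁ ft))))) (↭-reflexive (interval-split A (n G'))))))
        heads≡ : heads (L ++ map raise Rs) ≡ heads L ++ map up (heads Rs)
        heads≡ = trans (map-++ _ L _) (cong (heads L ++_) (heads-raise isTs))
        sep : ∀ {h k} → h ∈ heads L → k ∈ map up (heads Rs) → h < k
        sep h∈ k∈ with ∈-map⁻ up k∈
        ... | y , y∈ , refl = ≤-trans (s≤s (low (heads∈ h∈))) (subst (_< up y) up-1 (+-monoʳ-< A (All.lookup (proj₁ right-heads) y∈)))
          where
          low : ∀ {h} → h ∈ applyUpTo suc A ⊎ h ≡ a → h ≤ a
          low (inj₁ q) = ≤-trans (proj₂ (interval-∈ A q)) (n≤1+n A)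
          low (inj₂ refl) = ≤-refl

      decode-valid : firstR x ≡ 0 → SimpleFT G (decode x (R₁ ∷ Rs))
      decode-valid e = decode-forest , simple (subst (λ k → Valid ε k x) (sym (length-applyUpTo suc A)) v) e
        where
        simple : ∀ {ε' rem x} → Valid ε' (length rem) x → firstR x ≡ 0 → Simple (decodeLeft b R₁ rem x ++ map raise Rs)
        simple {rem = []} (vonly _ _) refl = refl
        simple {rem = _ ∷ _} (vspec _ _ _ _ _ _ _ _) refl = refl
        simple {rem = _ ∷ _} (vcons _ _ _ _ _) refl = refl

  -- Encoding forests as skeletons

  lower : TreeTriple → TreeTriple
  lower t = tt (map (_∸ A) (V t)) (map down² (Ed t)) (TreeTriple.α t) (TreeTriple.r t)

  raise-lower : ∀ {t} → IsTreeTriple G t → (∀ {x} → x ∈ V t → a ≤ x) → raise (lower t) ≡ t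
  raise-lower {tt Vs Es α r} (d , _) hi = cong₂ (λ X Y → tt X Y α r) (map-up-down hi) (map-up²-down² (high-edges (ToTree.toTree d) hi))

  lower-valid : ∀ {t} → IsTreeTriple G t → (∀ {x} → x ∈ V t → a ≤ x) → IsTreeTriple G' (lower t)
  lower-valid {t} (d , (pos , s) , r) hi = FromTree.isDecSubtree (tree-down (ToTree.toTree d) hi) , (pos , trans s (sym (length-map (_∸ A) (V t)))) , r

  -- The parent of a vertex below `a` is at most `a`, and it is not `a` by assumption, so the climb
  -- to the top stays below `a`.
  low-tree : ∀ {Vs Es v} → Tree G Vs Es → a ∉ Vs → v ∈ Vs → v < a → ∀ {x} → x ∈ Vs → x < a
  low-tree {Vs} {Es} t a∉ v∈ v<a x∈ = ≤-trans (s≤s (≤top x∈)) (climb top v∈ v<a (m≤m+n top _))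
    where
    open Tree t
    climb : ∀ k {v} → v ∈ Vs → v < a → top ≤ k + v → top < a
    climb k {v} v∈ v<a le with v ≟ top
    ... | yes refl = v<a
    climb zero v∈ v<a le | no ne = ⊥-elim (ne (≤-antisym (≤top v∈) le))
    climb (suc k) {v} v∈ v<a le | no ne with parent v∈ ne
    ... | w , e∈ with edges e∈
    ... | lt , w∈ , q with edge-elim {v} {w} q lt
    ... | inj₂ (v≥a , _) = ⊥-elim (<⇒≱ v<a v≥a)
    ... | inj₁ (_ , _ , w≤a , _) = climb k w∈ (≤∧≢⇒< w≤a λ w≡a → a∉ (subst (_∈ Vs) w≡a w∈)) (balance-≤ (+-mono-≤ le lt) (solve 4 (λ i j k l → i :+ (con 1 :+ (j :+ l) :+ k) := j :+ k :+ (i :+ (con 1 :+ l))) refl top k w v))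

  suc-pred′ : ∀ {r} → 1 ≤ r → suc (r ∸ 1) ≡ r
  suc-pred′ {suc r} _ = refl

  record BlockCode (rem : List ℕ) (t : TreeTriple) (rem″ : List ℕ) (m : ℕ) : Set where
    constructor blockCode
    field
      {r}    : ℕ
      {α cs} : List ℕ
      triple : t ≡ wordTriple (m ∷ word cs rem) α r
      wf     : WellFormed r α
      size   : sum α ≡ suc (length cs)
      code   : IsCode (length rem) cs
      rest↭  : remaining cs rem ↭ rem″

  -- The reading word is a word in the available letters and so has a code; the edges are recovered
  -- because a tree is determined by its reading word.
  block-code : ∀ {rem t m W rem″} → IsTreeTriple G t → V t ≡ m ∷ W → W ++ rem″ ↭ rem → BlockCode rem t rem″ m
  block-code {rem} {tt _ Es α r} {m} {W} {rem″} (d , (pos , s) , r≥1 , r≤) refl p with tree-reading (ToTree.toTree d)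
  ... | w , g , q with word-exists w (↭-trans (Perm.++⁺ʳ rem″ q) p)
  ... | cs , code , len , refl , r↭ = blockCode triple ((Perm.All-resp-↭ (↭-sym (Perm.↭-reverse α)) pos) , r<)
        (trans (sum-reverse α) (trans s (cong suc (trans (sym (Perm.↭-length q)) (sym len))))) code r↭
    where
    sorted : sort (m ∷ word cs rem) ≡ m ∷ W
    sorted = sort-≡ (Tree.increasing (ToTree.toTree d)) (↭-prep m q)
    r< : r ∸ 1 < firstPart (reverse α)
    r< = subst₂ _≤_ (sym (suc-pred′ r≥1)) (sym (firstPart-reverse α)) r≤
    triple : tt (m ∷ W) Es α r ≡ wordTriple (m ∷ word cs rem) (reverse α) (r ∸ 1)
    triple rewrite sorted | reverse-involutive α | suc-pred′ r≥1 = cong (λ e → tt (m ∷ W) e α r) (edges≡wordEdges (ToTree.toTree d) g q)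

  tree-∈ : ∀ {F : Forest} {t x} → t ∈ F → x ∈ V t → x ∈ concat (map V F)
  tree-∈ (here refl) x∈ = ∈-++⁺ˡ x∈
  tree-∈ {t ∷ F} (there t∈) x∈ = ∈-++⁺ʳ (V t) (tree-∈ t∈ x∈)

  least-letter : ∀ {m rem H} → Letters (m ∷ rem) → (∀ {x} → x ∈ H → a ≤ x) → ∀ {y} → y ∈ m ∷ rem ++ H → m ≤ y
  least-letter {m} {rem} (lts ∷ _ , bd) hi (here refl) = ≤-refl
  least-letter {m} {rem} (lts ∷ _ , bd) hi (there y∈) with ∈-++⁻ rem y∈
  ... | inj₁ q = <⇒≤ (All.lookup lts q)
  ... | inj₂ q = ≤-trans (<⇒≤ (proj₂ (bd (here refl)))) (hi q)

  record EncodedTail (rem H : List ℕ) (F : Forest) : Set where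
    constructor encodedTail
    field
      {ys}  : List Block
      {Zs}  : Forest
      split : F ≡ decodeTail rem ys ++ Zs
      valid : ValidTail (length rem) ys
      high  : concat (map V Zs) ↭ H

  encode-tail : ∀ {rem H} F → Letters rem → (∀ {x} → x ∈ H → a < x) → All (IsTreeTriple G) F → Increasing (heads F) →
                concat (map V F) ↭ rem ++ H → EncodedTail rem H F
  encode-tail {[]} F L hi ts inc p = encodedTail {Zs = F} refl [] p
  encode-tail {m ∷ rem} [] L hi ts inc p = ⊥-elim (Perm.¬x∷xs↭[] (↭-sym p))
  encode-tail {m ∷ rem} {H} (t ∷ F) L hi (q ∷ ts) (lts ∷ inc) p with first-head (q ∷ ts) (lts ∷ inc) p (here refl) (least-letter L (<⇒≤ ∘ hi))
  ... | W , V≡ with extract {P = _< a} W {concat (map V F)} {rem} {H} (λ x∈ → lo (recast (sym V≡) (there x∈))) (λ x∈ lt → <-asym lt (hi x∈))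
                     (Perm.drop-∷ (↭-trans (↭-reflexive (cong (_++ concat (map V F)) (sym V≡))) p))
    where
    a∉ : a ∉ V t
    a∉ a∈ with ∈-++⁻ (m ∷ rem) (Perm.∈-resp-↭ p (∈-++⁺ˡ a∈))
    ... | inj₁ r = <-irrefl refl (proj₂ (proj₂ L r))
    ... | inj₂ r = <-irrefl refl (hi r)
    lo : ∀ {x} → x ∈ V t → x < a
    lo = low-tree (ToTree.toTree (proj₁ q)) a∉ (recast (sym V≡) (here refl)) (proj₂ (proj₂ L (here refl)))
  ... | rem″ , e , e' with block-code q V≡ e
  ... | blockCode {r} {α} {cs} refl wf size code r↭ with encode-tail F (letters-remaining cs L code) hi ts inc (↭-trans e' (Perm.++⁺ʳ H (↭-sym r↭)))
  ... | encodedTail {ys} {Zs} refl v h = encodedTail {ys = blk r α cs ∷ ys} {Zs} refl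
          ((wf , size , subst (λ k → IsCode k cs) (sym (length-remaining cs {rem} code)) code , cong suc (sym (length-remaining cs {rem} code))) ∷ v) h

  record EncodedLeft (ε' : ℕ) (rem hs : List ℕ) (F : Forest) : Set where
    constructor encodedLeft
    field
      {W'}  : List ℕ
      {Fs}  : List (ℕ × ℕ)
      {b}   : ℕ
      {β}   : List ℕ
      {x}   : Skeleton
      {Zs}  : Forest
      isT   : IsTreeTriple G' (tt (1 ∷ W') Fs (b ∷ β) 1)
      split : F ≡ decodeLeft b (tt (1 ∷ W') Fs (b ∷ β) 1) rem x ++ Zs
      valid : Skeletons.Valid b (b≥1 isT) ε' (length rem) x
      high  : map up W' ++ concat (map V Zs) ↭ hs

  alone-triple : ∀ {W' Fs b β r} → 1 ≤ r → tt (map up (1 ∷ W')) (map up² Fs) (b ∷ β) r ≡ glueTriple (a ∷ []) (b ∷ []) (r ∸ 1) (tt (1 ∷ W') Fs (b ∷ β) 1)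
  alone-triple r≥1 rewrite sort-≡ {a ∷ []} ([] ∷ []) ↭-refl | suc-pred′ r≥1 = refl

  encode-alone : ∀ {ε' hs} F → (∀ {x} → x ∈ hs → a < x) → All (IsTreeTriple G) F → Increasing (heads F) →
                 concat (map V F) ↭ a ∷ hs → EncodedLeft ε' [] hs F
  encode-alone [] hi ts inc p = ⊥-elim (Perm.¬x∷xs↭[] (↭-sym p))
  encode-alone {ε'} {hs} (t@(tt Vs Es α r) ∷ F) hi (q@(d , (pos , s) , r≥1 , r≤) ∷ ts) inc p
    with first-head (q ∷ ts) inc p (here refl) (λ where
      (here refl) → ≤-refl
      (there y∈) → <⇒≤ (hi y∈))
  ... | W , refl with unglue (ToTree.toTree d) (here refl)
  ... | unglued {v ∷ vs} v≡ _ left _ = ⊥-elim (<-irrefl (sym (∷-injectiveˡ v≡)) (proj₂ (proj₂ (increasing-split (v ∷ vs) (Tree.increasing left))) (here refl) (here refl)))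
  ... | unglued {[]} {W'} {Ls} {Fs} v≡ e≡ left right with ∷-injective v≡ | Ls | Tree.sources left | ∷ʳ-injective [] (Tree.below left) (Tree.vertices left)
  ... | _ , refl | _ ∷ _ | e | refl , _ = case e of λ ()
  ... | _ , refl | [] | _ | _ with α | pos | s | r≤
  ... | [] | _ | () | _
  ... | b ∷ β | b≥1 ∷ pos′ | s′ | r≤′ = encodedLeft {b = b} {β} {alone (r ∸ 1)} {F}
        (FromTree.isDecSubtree right , (b≥1 ∷ pos′ , trans s′ (cong suc (length-map up W'))) , s≤s z≤n , b≥1)
        (cong (_∷ F) (trans (cong₂ (λ x y → tt x y (b ∷ β) r) (cong (_∷ map up W') (sym up-1)) e≡) (alone-triple {W' = W'} r≥1)))
        (Skeletons.vonly (subst (_≤ b) (sym (suc-pred′ r≥1)) r≤′) refl) (Perm.drop-∷ p)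

  -- The bound with `ε` has to be produced only while vertex 1 is the next head.
  EncodeGuard : ℕ → List ℕ → Set
  EncodeGuard ε' rem = ε' ≡ 0 ⊎ (ε' ≡ ε × headD 0 rem ≡ 1)

  -- If `a` follows `m` directly, it is the first larger letter and hence the parent of `m`, which
  -- needs the edge from `m` to `a`.
  second-letter : ∀ {m vs Ls z} → Tree G (m ∷ vs ++ a ∷ []) Ls → Greedy (m ∷ vs ++ a ∷ []) Ls (m ∷ []) (a ∷ z) → a ∷ z ↭ vs ++ a ∷ [] →
                  m < a → ¬ (1 ≤ ε × m ≡ 1)
  second-letter {m} {vs} {Ls} {z} left g p m<a (ε≥1 , refl)
    with Tree.parent left (here refl) (λ e → <-irrefl (trans e (sym (proj₂ (∷ʳ-injective (m ∷ vs) (Tree.below left) (Tree.vertices left))))) m<a)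
  ... | y , e∈ with Tree.edges left e∈ | Parents.parent≡parentIn left g p e∈
  ... | lt , y∈ , ed | y≡ with edge-elim {1} {y} ed lt
  ... | inj₂ (a≤1 , _) = <⇒≱ m<a a≤1
  ... | inj₁ (_ , _ , _ , ok) = ok (ε≥1 , refl , trans (sym y≡) (firstGt-here z m<a))

  encode-special : ∀ {ε' m rem hs t W F} → ε ≤ 1 → Letters (m ∷ rem) → EncodeGuard ε' (m ∷ rem) → (∀ {x} → x ∈ hs → a < x) →
    IsTreeTriple G t → All (IsTreeTriple G) F → Increasing (heads F) → V t ≡ m ∷ W → a ∈ V t →
    W ++ concat (map V F) ↭ rem ++ a ∷ hs → EncodedLeft ε' (m ∷ rem) hs (t ∷ F)
  encode-special {ε'} {m} {rem} {hs} {t@(tt _ Es α r)} {W} {F} ε≤1 L guard hi q@(d , (pos , s) , r≥1 , r≤) ts inc refl a∈ p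
    with unglue (ToTree.toTree d) a∈
  ... | unglued {[]} v≡ _ _ _ = ⊥-elim (<-irrefl (trans (∷-injectiveˡ v≡) up-1) (proj₂ (proj₂ L (here refl))))
  ... | unglued {v ∷ vs} {W'} {Ls} {Fs} v≡ e≡ left right with ∷-injective v≡
  ... | refl , refl with tree-reading left
  ... | w , g , w↭ with ∈-∃++ (Perm.∈-resp-↭ (↭-sym w↭) (∈-++⁺ʳ vs (here refl)))
  ... | u , z , refl with extract {P = _< a} vs {map up W' ++ concat (map V F)} {rem} {hs} vs<a (λ x∈ lt → <-asym lt (hi x∈)) perm₁
    where
    vs<a : ∀ {x} → x ∈ vs → x < a
    vs<a x∈ = proj₂ (proj₂ (increasing-split (m ∷ vs) (Tree.increasing left))) (there x∈) (here refl)
    perm₁ : vs ++ map up W' ++ concat (map V F) ↭ rem ++ hs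
    perm₁ = Perm.drop-mid vs rem (↭-trans (↭-reflexive (trans (sym (++-assoc vs (a ∷ map up W') _)) (cong (λ k → (vs ++ k ∷ map up W') ++ concat (map V F)) (sym up-1)))) p)
  ... | rem″ , e₁ , e₂ with extract {P = a <_} (map up W') {concat (map V F)} {hs} {rem″} W'>a rem″<a (↭-trans e₂ (Perm.++-comm rem″ hs))
    where
    W'>a : ∀ {x} → x ∈ map up W' → a < x
    W'>a x∈ with ∈-map⁻ up x∈ | Tree.increasing right
    ... | y , y∈ , refl | lts ∷ _ = subst (_< up y) up-1 (+-monoʳ-< A (All.lookup lts y∈))
    rem″<a : ∀ {x} → x ∈ rem″ → ¬ a < x
    rem″<a x∈ lt = <-asym lt (proj₂ (proj₂ L (there (Perm.∈-resp-↭ e₁ (∈-++⁺ʳ vs x∈)))))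
  ... | hs″ , f₁ , f₂ with word-exists (u ++ z) (↭-trans (Perm.++⁺ʳ rem″ uz↭) e₁)
    where
    uz↭ : u ++ z ↭ vs
    uz↭ = ↭-trans (Perm.drop-mid u vs w↭) (↭-reflexive (++-identityʳ vs))
  -- The position looked for is the number of vertices up to `a`, the k of the restriction; `γ` is
  -- the part that contains it.
  ... | cs , code , len , word≡ , r↭ with split-composition α (suc (length (m ∷ vs))) (s≤s z≤n)
              (subst (suc (length (m ∷ vs)) ≤_) (sym s) (s≤s (≤-trans (m≤m+n (suc (length vs)) (length (map up W'))) (≤-reflexive (trans (sym (+-suc (length vs) _)) (sym (length-++ vs)))))))
  ... | as , γ , bs , refl , lt , le with encode-tail F (letters-remaining cs L code) (λ x∈ → hi (Perm.∈-resp-↭ f₁ (∈-++⁺ʳ (map up W') x∈))) ts inc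
              (↭-trans f₂ (↭-trans (Perm.++-comm hs″ rem″) (Perm.++⁺ʳ hs″ (↭-sym r↭))))
  -- `length u` letters stand between `m` and `a`, so all the others in `rem` follow `a`; their
  -- number is the `t` of the skeleton.
  ... | encodedTail {ys} {Zs} refl vt hz = encodedLeft {b = b} {bs} {special (r ∸ 1) (γ ∷ reverse as) cs (length rem ∸ length u) ys} {Zs}
        isT′ (cong (_∷ (decodeTail (remaining cs rem) ys ++ Zs)) triple)
        (Skeletons.vspec ((Allₚ.++⁻ʳ as pos |> All.head) ∷ Perm.All-resp-↭ (↭-sym (Perm.↭-reverse as)) (Allₚ.++⁻ˡ as pos) , r<)
            (balance-≤ (+-mono-≤ (≤-reflexive b≡) lt) (solve 4 (λ i j k l → i :+ (l :+ j :+ (con 1 :+ (con 1 :+ k))) := j :+ (i :+ (con 1 :+ k) :+ (con 1 :+ l))) refl (sum as + γ ∸ suc (length vs)) γ (length vs) (sum as)))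
            (balance (cong₂ _+_ (sym b≡) (cong₂ _+_ (sum-reverse as) (sym length-vs))) (solve 6 (λ i j k l m n → i :+ j :+ (l :+ (con 1 :+ n) :+ (m :+ k)) := con 1 :+ (k :+ l) :+ (m :+ i :+ (j :+ n))) refl γ (sum (reverse as)) (length cs) (sum as + γ ∸ suc (length vs)) (sum as) (length vs)))
            (subst (λ k → IsCode k cs) (sym (length-remaining cs {rem} code)) code)
            (balance-slack (length z) (+-mono-≤ (≤-reflexive (length-remaining cs {rem} code)) (+-mono-≤ (≤-reflexive (sym len)) (+-mono-≤ (≤-reflexive (sym (length-++ u {z}))) (≤-reflexive (sym k≡))))) (solve 7 (λ i j k l m n o → i :+ (o :+ (k :+ (l :+ (j :+ m)))) :+ n := j :+ (k :+ i :+ (l :+ (m :+ n :+ o)))) refl (length (remaining cs rem)) (length rem ∸ length u) (length cs) (length (u ++ z)) (length u) (length z) (length rem))) t-bound vt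
            (cong suc (sym (length-remaining cs {rem} code))))
        (↭-trans (Perm.++⁺ˡ (map up W') hz) f₁)
    where
    _|>_ : ∀ {X Y : Set} → X → (X → Y) → Y
    x |> f = f x
    b : ℕ
    -- This is α_1 + ... + α_j - k + 1, since k is one more than the length subtracted.
    b = sum as + γ ∸ length (m ∷ vs)
    b≡ : b + length (m ∷ vs) ≡ sum as + γ
    b≡ = m∸n+n≡m (≤-trans (n≤1+n _) le)
    uz↭ : u ++ z ↭ vs
    uz↭ = ↭-trans (Perm.drop-mid u vs w↭) (↭-reflexive (++-identityʳ vs))
    length-vs : length cs ≡ length vs
    length-vs = trans len (Perm.↭-length uz↭)
    length-u : length u ≤ length rem
    length-u = ≤-trans (≤-trans (m≤m+n (length u) (length z)) (≤-reflexive (trans (sym (length-++ u)) (sym len)))) (≤-trans (m≤m+n _ _) (≤-reflexive (length-remaining cs {rem} code)))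
    k≡ : length rem ∸ length u + length u ≡ length rem
    k≡ = m∸n+n≡m length-u
    k≡′ : length rem ∸ (length rem ∸ length u) ≡ length u
    k≡′ = m∸[m∸n]≡n length-u
    size : sum as + (γ + sum bs) ≡ suc (length (vs ++ map up (1 ∷ W')))
    size = trans (sym (sum-++ as (γ ∷ bs))) s
    isT′ : IsTreeTriple G' (tt (1 ∷ W') Fs (b ∷ bs) 1)
    isT′ = FromTree.isDecSubtree right , (b>0 ∷ All.tail (Allₚ.++⁻ʳ as pos) ,
      balance (cong₂ _+_ size (cong₂ _+_ b≡ (cong₂ _+_ (length-++ vs {map up (1 ∷ W')}) (length-map up W')))) (solve 8 (λ i j k l m n o p → i :+ j :+ (con 1 :+ o :+ (l :+ m :+ (n :+ (con 1 :+ p) :+ k))) := con 1 :+ k :+ (l :+ (m :+ j) :+ (i :+ (con 1 :+ n) :+ (o :+ p)))) refl (sum as + γ ∸ suc (length vs)) (sum bs) (length W') (sum as) γ (length vs) (length (vs ++ up 1 ∷ map up W')) (length (map up W')))) , s≤s z≤n , b>0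
      where
      b>0 : 1 ≤ b
      b>0 = balance-≤ (+-mono-≤ (≤-reflexive (sym b≡)) le) (solve 4 (λ i j k l → con 1 :+ (i :+ (con 1 :+ l) :+ (j :+ k)) := i :+ (j :+ k :+ (con 1 :+ (con 1 :+ l)))) refl (sum as + γ ∸ suc (length vs)) (sum as) γ (length vs))
    r< : r ∸ 1 < firstPart (γ ∷ reverse as)
    r< = subst₂ _≤_ (sym (suc-pred′ r≥1)) (trans (sym (firstPart-reverse (as ++ γ ∷ bs))) (go as)) r≤
      where
      go : ∀ as → firstPart (reverse (as ++ γ ∷ bs)) ≡ firstPart (γ ∷ reverse as)
      go [] = firstPart-reverse (γ ∷ bs)
      go (x ∷ as) = trans (firstPart-reverse (x ∷ as ++ γ ∷ bs)) (sym (trans (cong firstPart (sym (reverse-++ (x ∷ as) (γ ∷ [])))) (firstPart-reverse (x ∷ as ++ γ ∷ []))))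
    insert≡ : insertAt (length rem ∸ (length rem ∸ length u)) a (word cs rem) ≡ u ++ a ∷ z
    insert≡ = trans (cong₂ (λ k l → insertAt k a l) k≡′ word≡) (insertAt-mid u z)
    sorted : sort (m ∷ u ++ a ∷ z) ≡ m ∷ vs ++ a ∷ []
    sorted = sort-≡ (Tree.increasing left) (↭-prep m w↭)
    triple : tt (m ∷ vs ++ map up (1 ∷ W')) Es (as ++ γ ∷ bs) r ≡
             glueTriple (specialWord m rem cs (length rem ∸ length u)) (γ ∷ reverse as) (r ∸ 1) (tt (1 ∷ W') Fs (b ∷ bs) 1)
    triple rewrite insert≡ | sorted | front-snoc (m ∷ vs) a | suc-pred′ r≥1 | e≡ =
      cong₂ (λ E α → tt (m ∷ vs ++ map up (1 ∷ W')) E α r) (cong (_++ map up² Fs) (trans (edges≡wordEdges left g w↭) (cong (map (λ v → v , parentIn (m ∷ u ++ a ∷ z) v)) (front-snoc (m ∷ vs) a))))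
        (sym (trans (cong (_++ bs) (trans (unfold-reverse γ (reverse as)) (cong (_++ γ ∷ []) (reverse-involutive as)))) (++-assoc as (γ ∷ []) bs)))
    -- An empty `u` would make `a` the parent of 1, along the removed edge.
    u-nonempty : 1 ≤ ε → m ≡ 1 → 1 ≤ length u
    u-nonempty ε≥1 m≡1 = go u refl
      where
      go : ∀ u' → u ≡ u' → 1 ≤ length u'
      go (_ ∷ _) _ = s≤s z≤n
      go [] e = ⊥-elim (second-letter left (subst (λ l → Greedy (m ∷ vs ++ a ∷ []) Ls (m ∷ []) (l ++ a ∷ z)) e g)
                  (subst (λ l → l ++ a ∷ z ↭ vs ++ a ∷ []) e w↭) (proj₂ (proj₂ L (here refl))) (ε≥1 , m≡1))
    t-bound : ε' + (length rem ∸ length u) ≤ length cs + length (remaining cs rem)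
    t-bound = [ (λ e → ≤-trans (+-monoˡ-≤ (length rem ∸ length u) (≤-reflexive e))
                        (≤-trans (m∸n≤m (length rem) (length u)) (≤-reflexive (sym (length-remaining cs {rem} code))))) ,
                (λ (e , m≡1) → ≤-trans (+-monoˡ-≤ (length rem ∸ length u) (≤-trans (≤-reflexive e) (bounded m≡1)))
                        (≤-trans (≤-reflexive (trans (+-comm (length u) _) k≡)) (≤-reflexive (sym (length-remaining cs {rem} code))))) ]′ guard
      where
      bounded : m ≡ 1 → ε ≤ length u
      bounded m≡1 with 1 ≤? ε
      ... | yes ε≥1 = ≤-trans ε≤1 (u-nonempty ε≥1 m≡1)
      ... | no ε≱1 = ≤-trans (≤-pred (≰⇒> ε≱1)) z≤n

  encode-left : ∀ {ε' rem hs} F → ε ≤ 1 → Letters rem → EncodeGuard ε' rem → (∀ {x} → x ∈ hs → a < x) → All (IsTreeTriple G) F →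
                Increasing (heads F) → concat (map V F) ↭ rem ++ a ∷ hs → EncodedLeft ε' rem hs F
  encode-left {rem = []} F ε≤1 L guard hi ts inc p = encode-alone F hi ts inc p
  encode-left {rem = m ∷ rem} [] ε≤1 L guard hi ts inc p = ⊥-elim (Perm.¬x∷xs↭[] (↭-sym p))
  encode-left {ε'} {m ∷ rem} {hs} (t ∷ F) ε≤1 L guard hi (q ∷ ts) (lts ∷ inc) p
    with first-head (q ∷ ts) (lts ∷ inc) p (here refl) (least-letter L (λ where
      (here refl) → ≤-refl
      (there y∈) → <⇒≤ (hi y∈)))
  ... | W , V≡ with memB a (V t) in a∈?
  ... | true = encode-special ε≤1 L guard hi q ts inc V≡ (memB-elim (V t) a∈?)
                 (Perm.drop-∷ (↭-trans (↭-reflexive (cong (_++ concat (map V F)) (sym V≡))) p))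
  ... | false with extract {P = _< a} W {concat (map V F)} {rem} {a ∷ hs} (λ x∈ → lo (recast (sym V≡) (there x∈))) (λ where
                      (here refl) lt → <-irrefl refl lt
                      (there x∈) lt → <-asym lt (hi x∈))
                     (Perm.drop-∷ (↭-trans (↭-reflexive (cong (_++ concat (map V F)) (sym V≡))) p))
    where
    lo : ∀ {x} → x ∈ V t → x < a
    lo = low-tree (ToTree.toTree (proj₁ q)) (λ a∈ → true≢false (memB-intro a∈) a∈?) (recast (sym V≡) (here refl)) (proj₂ (proj₂ L (here refl)))
  ... | rem″ , e , e' with block-code q V≡ e
  ... | blockCode {r} {α@(_ ∷ _)} {cs} refl wf size code r↭ with encode-left {0} F ε≤1 (letters-remaining cs L code) (inj₁ refl) hi ts inc (↭-trans e' (Perm.++⁺ʳ (a ∷ hs) (↭-sym r↭)))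
  ... | encodedLeft {b = b} {x = x} isT refl v h = encodedLeft {x = before r α cs x} isT refl
          (Skeletons.vcons wf size (subst (λ k → IsCode k cs) (sym (length-remaining cs {rem} code)) code) v (cong suc (sym (length-remaining cs {rem} code)))) h

  record Encoded (F : Forest) : Set where
    constructor encoded
    field
      {W'} : List ℕ
      {Fs} : List (ℕ × ℕ)
      {b}  : ℕ
      {β}  : List ℕ
      {Rs} : Forest
      {x}  : Skeleton
      right : SimpleFT G' (tt (1 ∷ W') Fs (b ∷ β) 1 ∷ Rs)
      valid : WithRight.Valid right ε A x
      simple : firstR x ≡ 0
      forest : decode x (tt (1 ∷ W') Fs (b ∷ β) 1 ∷ Rs) ≡ F

  encode : ∀ {F} → ε ≤ 1 → 1 ≤ A → SimpleFT G F → Encoded F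
  encode {F} ε≤1 A≥1 ((ts , p , l) , simple) with encode-left F ε≤1 all-letters (inj₂ (refl , cong (headD 0) (interval-cons A≥1))) hi ts inc perm
    where
    inc : Increasing (heads F)
    inc = Linkedₚ.Linked⇒AllPairs <-trans l
    perm : concat (map V F) ↭ applyUpTo suc A ++ a ∷ map up (applyUpTo (2 +_) (n G' ∸ 1))
    perm = ↭-trans p (↭-reflexive (trans (sym (interval-split A (n G'))) (cong (applyUpTo suc A ++_)
             (trans (cong (map up) (interval-cons n≥1)) (cong (_∷ map up (applyUpTo (2 +_) (n G' ∸ 1))) up-1)))))
    hi : ∀ {x} → x ∈ map up (applyUpTo (2 +_) (n G' ∸ 1)) → a < x
    hi x∈ with ∈-map⁻ up x∈
    ... | y , y∈ , refl = subst (_< up y) up-1 (+-monoʳ-< A (All.lookup (interval-tail n≥1) y∈))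
  ... | encodedLeft {W'} {Fs} {b} {β} {x} {Zs} isT refl v high = encoded {x = x} right valid
          (root (subst (λ k → Skeletons.Valid b (b≥1 isT) ε k x) refl v) simple)
          (cong (decodeLeft b R₁ (applyUpTo suc A) x ++_) raised)
    where
    R₁ = tt (1 ∷ W') Fs (b ∷ β) 1
    L = decodeLeft b R₁ (applyUpTo suc A) x
    k = n G' ∸ 1
    hs = map up (applyUpTo (2 +_) k)
    Zs-valid : All (IsTreeTriple G) Zs
    Zs-valid = Allₚ.++⁻ʳ L ts
    Zs-increasing : Increasing (heads Zs)
    Zs-increasing = proj₁ (proj₂ (increasing-split (heads L) (subst Increasing (map-++ (λ t → headD 0 (V t)) L Zs) (Linkedₚ.Linked⇒AllPairs <-trans l))))
    high∈ : ∀ {t x} → t ∈ Zs → x ∈ V t → ∃ λ y → x ≡ up y × 1 < y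
    high∈ t∈ x∈ with ∈-map⁻ up (Perm.∈-resp-↭ high (∈-++⁺ʳ (map up W') (tree-∈ t∈ x∈)))
    ... | y , y∈ , e = y , e , All.lookup (interval-tail n≥1) y∈
    Zs-high : ∀ {t} → t ∈ Zs → ∀ {x} → x ∈ V t → a ≤ x
    Zs-high t∈ x∈ with high∈ t∈ x∈
    ... | y , refl , lt = ≤-trans (≤-reflexive (sym up-1)) (+-monoʳ-≤ A (<⇒≤ lt))
    raised : map raise (map lower Zs) ≡ Zs
    raised = go Zs Zs-valid Zs-high
      where
      go : ∀ Zs → All (IsTreeTriple G) Zs → (∀ {t} → t ∈ Zs → ∀ {x} → x ∈ V t → a ≤ x) → map raise (map lower Zs) ≡ Zs
      go [] _ _ = refl
      go (t ∷ Zs) (q ∷ qs) h = cong₂ _∷_ (raise-lower {t} q (h (here refl))) (go Zs qs (h ∘ there))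
    lowered : All (IsTreeTriple G') (map lower Zs)
    lowered = Allₚ.map⁺ (All.tabulate (λ {t} t∈ → lower-valid {t} (All.lookup Zs-valid t∈) (Zs-high t∈)))
    heads-up : map up (heads (map lower Zs)) ≡ heads Zs
    heads-up = trans (sym (heads-raise lowered)) (cong heads raised)
    down-increasing : ∀ {xs} → Increasing (map up xs) → Increasing xs
    down-increasing = AllPairs.map (λ {x} {y} → +-cancelˡ-< A x y) ∘ AllPairsₚ.map⁻
    verts-up : map up (concat (map V (map lower Zs))) ≡ concat (map V Zs)
    verts-up = trans (sym (verts-raise (map lower Zs))) (cong (λ F → concat (map V F)) raised)
    right : SimpleFT G' (R₁ ∷ map lower Zs)
    right = (isT ∷ lowered , perm , Linkedₚ.AllPairs⇒Linked (All.tabulate above-one ∷ down-increasing (subst Increasing (sym heads-up) Zs-increasing))) , refl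
      where
      perm : (1 ∷ W') ++ concat (map V (map lower Zs)) ↭ applyUpTo suc (n G')
      perm = ↭-trans (↭-prep 1 (subst₂ _↭_ (map-down-up _) (map-down-up _) (Perm.map⁺ (_∸ A)
               (↭-trans (↭-reflexive (trans (map-++ up W' _) (cong (map up W' ++_) verts-up))) high))))
               (↭-reflexive (sym (interval-cons n≥1)))
      above-one : ∀ {h} → h ∈ heads (map lower Zs) → 1 < h
      above-one {h} h∈ with ∈-map⁻ (λ t → headD 0 (V t)) (recast heads-up (∈-map⁺ up h∈))
      ... | t , t∈ , e with tree-head (ToTree.toTree (proj₁ (All.lookup Zs-valid t∈)))
      ... | x , U , Vt≡ with high∈ t∈ (recast (sym Vt≡) (here refl))
      ... | y , refl , lt = subst (1 <_) (up-injective (trans (cong (headD 0) (sym Vt≡)) (sym e))) lt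
    valid : WithRight.Valid right ε A x
    valid = subst (λ k → Skeletons.Valid b (b≥1 isT) ε k x) (length-applyUpTo suc A) v
    root : ∀ {ε' rem x Z} → Skeletons.Valid b (b≥1 isT) ε' (length rem) x → Simple (decodeLeft b R₁ rem x ++ Z) → firstR x ≡ 0
    root {rem = []} (Skeletons.vonly _ _) refl = refl
    root {rem = _ ∷ _} (Skeletons.vspec _ _ _ _ _ _ _ _) refl = refl
    root {rem = _ ∷ _} (Skeletons.vcons _ _ _ _ _) refl = refl

  -- Restriction and injectivity of decoding

  preOf : List ℕ → Skeleton → Forest
  preOf (m ∷ rem) (before r α cs x) = wordTriple (m ∷ word cs rem) α r ∷ preOf (remaining cs rem) x
  preOf _         _                = []

  specialOf : ℕ → TreeTriple → List ℕ → Skeleton → TreeTriple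
  specialOf b R rem       (alone r)            = glueTriple (a ∷ []) (b ∷ []) r R
  specialOf b R (m ∷ rem) (special r α cs t ys) = glueTriple (specialWord m rem cs t) α r R
  specialOf b R (m ∷ rem) (before r α cs x)     = specialOf b R (remaining cs rem) x
  specialOf b R []        _                    = emptyT

  postOf : List ℕ → Skeleton → Forest
  postOf (m ∷ rem) (special r α cs t ys) = decodeTail (remaining cs rem) ys
  postOf (m ∷ rem) (before r α cs x)     = postOf (remaining cs rem) x
  postOf _         _                    = []

  module GlueWord {σ} (u : Unique σ) (a∈ : a ∈ σ) (bd : ∀ {x} → x ∈ σ → 1 ≤ x × x ≤ a) where
    vs : List ℕ
    vs = front (sort σ)

    private
      σ∈ : ∀ {x} → x ∈ sort σ → x ∈ σ
      σ∈ = Perm.∈-resp-↭ (sort-↭ σ)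

    sort≡ : sort σ ≡ vs ++ a ∷ []
    sort≡ = front-max (sort-increasing u) (Perm.∈-resp-↭ (↭-sym (sort-↭ σ)) a∈) (proj₂ ∘ bd ∘ σ∈)

    vs<a : ∀ {x} → x ∈ vs → x < a
    vs<a x∈ = proj₂ (proj₂ (increasing-split vs (subst Increasing sort≡ (sort-increasing u)))) x∈ (here refl)

    vs∈ : ∀ {x} → x ∈ vs → x ∈ σ
    vs∈ x∈ = σ∈ (recast (sym sort≡) (∈-++⁺ˡ x∈))

    length-vs : suc (length vs) ≡ length σ
    length-vs = trans (sym (trans (cong length sort≡) (trans (length-++ vs) (+-comm _ 1)))) (Perm.↭-length (sort-↭ σ))

    module _ {W' : List ℕ} {Fs : List (ℕ × ℕ)} {b : ℕ} {β : List ℕ} {r : ℕ} (right : Tree G' (1 ∷ W') Fs) (b≥1 : 1 ≤ b) (g : ℕ) (l : List ℕ) (bg : b ≤ g) (size : sum (g ∷ l) ≡ length vs + b) where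
      private
        R = tt (1 ∷ W') Fs (b ∷ β) 1
        t = glueTriple σ (g ∷ l) r R

        up≥ : ∀ {x} → x ∈ 1 ∷ W' → a ≤ up x
        up≥ (here refl) = ≤-reflexive (sym up-1)
        up≥ (there x∈) with Tree.increasing right
        ... | lts ∷ _ = ≤-trans (≤-reflexive (sym up-1)) (+-monoʳ-≤ A (<⇒≤ (All.lookup lts x∈)))

        up> : ∀ {x} → x ∈ W' → a < up x
        up> {x} x∈ with Tree.increasing right
        ... | lts ∷ _ = subst (_< up x) up-1 (+-monoʳ-< A (All.lookup lts x∈))

      kOf≡ : kOf a t ≡ suc (length vs)
      kOf≡ = trans (cong length (trans (filterᵇ-++ p vs (up 1 ∷ map up W')) (cong₂ _++_
               (filter-full p vs (λ x∈ → ∧-intro (≤ᵇ-intro (proj₁ (bd (vs∈ x∈)))) (≤ᵇ-intro (<⇒≤ (vs<a x∈)))))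
               (trans (cong (λ k → filterᵇ p (k ∷ map up W')) up-1) tail))))
             (trans (length-++ vs) (+-comm _ 1))
        where
        p : ℕ → Bool
        p x = (1 ≤ᵇ x) ∧ (x ≤ᵇ a)
        rest : filterᵇ p (map up W') ≡ []
        rest = filter-empty p (map up W') λ {x} x∈ → case ∈-map⁻ up x∈ of λ where
          (y , y∈ , refl) → not-true⇒false λ q → <⇒≱ (up> y∈) (≤ᵇ-true (proj₂ (∧-true {1 ≤ᵇ up y} q)))
        tail : filterᵇ p (a ∷ map up W') ≡ a ∷ []
        tail rewrite ≤ᵇ-intro {a} {a} ≤-refl = cong (a ∷_) rest

      private
        as = reverse l
        α≡ : reverse (g ∷ l) ++ β ≡ as ++ g ∷ β
        α≡ = trans (cong (_++ β) (unfold-reverse g l)) (++-assoc as (g ∷ []) β)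
        sum-as : g + sum as ≡ length vs + b
        sum-as = trans (cong (g +_) (sum-reverse l)) size
        lt : sum as < suc (length vs)
        lt = balance-≤ (+-mono-≤ (≤-reflexive sum-as) bg) (solve 4 (λ i j k l → con 1 :+ i :+ (j :+ l :+ k) := con 1 :+ j :+ (k :+ i :+ l)) refl (sum (reverse l)) (length (front (sort σ))) g b)
        le : suc (length vs) ≤ sum as + g
        le = balance-≤ (+-mono-≤ (≤-reflexive (sym sum-as)) b≥1) (solve 4 (λ i j k l → con 1 :+ i :+ (k :+ j :+ l) := j :+ k :+ (i :+ l :+ con 1)) refl (length (front (sort σ))) (sum (reverse l)) g b)

      seg≡ : segT a t ≡ suc (length as)
      seg≡ = trans (cong₂ segIdx kOf≡ α≡) (segIdx-split _ as g β lt le)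

      -- The word contributes only vertices and lower ends of edges below `a`, apart from `a`
      -- itself, and the filters remove them. The part containing `a` is cut down to `b`, as
      -- `sum (g ∷ l)` exceeds the number of vertices below `a` by `b`.
      restrict-glue : shiftT (a ∸ 1) (restrictT a t) ≡ R
      restrict-glue = trans (cong (λ X → tt (map (_∸ A) (filterᵇ (a ≤ᵇ_) (V t))) (map down² (filterᵇ q (Ed t))) X 1) rest)
        (cong₂ (λ X Y → tt X Y (b ∷ β) 1)
          (trans (cong (map (_∸ A)) (trans (filterᵇ-++ (a ≤ᵇ_) vs (map up (1 ∷ W'))) (cong₂ _++_ (filter-empty (a ≤ᵇ_) vs (λ x∈ → ≤ᵇ-false (vs<a x∈)))
            (filter-full (a ≤ᵇ_) (map up (1 ∷ W')) λ x∈ → case ∈-map⁻ up x∈ of λ where (y , y∈ , refl) → ≤ᵇ-intro (up≥ y∈))))) (map-down-up (1 ∷ W')))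
          (trans (cong (map down²) (trans (filterᵇ-++ q (wordEdges σ (sort σ)) (map up² Fs)) (cong₂ _++_
            (filter-empty q (wordEdges σ (sort σ)) λ e∈ → case ∈-map⁻ (λ v → v , parentIn σ v) e∈ of λ where
              (v , v∈ , refl) → cong (_∧ (a ≤ᵇ parentIn σ v)) (≤ᵇ-false (vs<a v∈)))
            (filter-full q (map up² Fs) λ e∈ → case ∈-map⁻ up² e∈ of λ where
              ((x , y) , f∈ , refl) → ∧-intro (≤ᵇ-intro (up≥ (Tree.source∈ right f∈))) (≤ᵇ-intro (up≥ (proj₁ (proj₂ (Tree.edges right f∈)))))))))
            (map-down²-up² Fs)))
        where
        q : ℕ × ℕ → Bool
        q e = (a ≤ᵇ proj₁ e) ∧ (a ≤ᵇ proj₂ e)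
        rest : restAlpha (kOf a t) (reverse (g ∷ l) ++ β) ≡ b ∷ β
        rest = trans (cong₂ restAlpha kOf≡ α≡) (trans (restAlpha-split _ as g β lt le)
          (cong (_∷ β) (trans (cong (λ k → k ∸ suc (length vs) + 1) (trans (+-comm (sum as) g) sum-as)) (value b≥1))))
          where
          value : ∀ {b} → 1 ≤ b → length vs + b ∸ suc (length vs) + 1 ≡ b
          value {suc b} _ = trans (cong (λ k → k ∸ suc (length vs) + 1) (+-suc (length vs) b)) (trans (cong (_+ 1) (m+n∸m≡n (length vs) b)) (+-comm b 1))

  code-cast : ∀ {m rem cs n} → suc (length rem) ≡ suc (length cs + n) → IsCode (length cs + n) cs → Letters (m ∷ rem) →
              IsCode (length rem) cs × n ≡ length (remaining cs rem)
  code-cast {m} {rem} {cs} e code L = code' , +-cancelˡ-≡ (length cs) _ _ (trans (sym (suc-injective e)) (sym (length-remaining cs {rem} code')))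
    where
    code' = subst (λ k → IsCode k cs) (sym (suc-injective e)) code

  unique-special : ∀ {m rem cs t} → Letters (m ∷ rem) → IsCode (length rem) cs →
    Unique (specialWord m rem cs t) × a ∈ specialWord m rem cs t × (∀ {x} → x ∈ specialWord m rem cs t → 1 ≤ x × x ≤ a)
  unique-special {m} {rem} {cs} {t} L code = unique-↭ (↭-sym σ↭) ((All.tabulate λ x∈ e → <-irrefl (sym e) (bound x∈)) ∷ uniq) ,
      Perm.∈-resp-↭ (↭-sym σ↭) (here refl) , λ x∈ → bd (Perm.∈-resp-↭ σ↭ x∈)
    where
    open FirstBlock L cs code
    σ↭ : specialWord m rem cs t ↭ a ∷ m ∷ word cs rem
    σ↭ = ↭-trans (↭-prep m (insertAt-↭ (length rem ∸ t) a (word cs rem))) (↭-swap m a ↭-refl)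
    uniq : Unique (m ∷ word cs rem)
    uniq = All.tabulate (λ x∈ e → <-irrefl e (above (word∈ x∈))) ∷ word-unique
    bd : ∀ {x} → x ∈ a ∷ m ∷ word cs rem → 1 ≤ x × x ≤ a
    bd (here refl) = s≤s z≤n , ≤-refl
    bd (there (here refl)) = proj₁ (proj₂ L (here refl)) , <⇒≤ (bound (here refl))
    bd (there (there x∈)) = proj₁ (proj₂ L (there (word∈ x∈))) , <⇒≤ (bound (there x∈))

  tail-meets : ∀ {rem ys} → Letters rem → ValidTail (length rem) ys → ∀ {s} → s ∈ decodeTail rem ys → meets a s ≡ true
  tail-meets {m ∷ rem} L (_∷_ {cs = cs} _ _) (here refl) =
    any-intro _ (Perm.∈-resp-↭ (↭-sym (sort-↭ (m ∷ word cs rem))) (here refl)) (∧-intro (≤ᵇ-intro (proj₁ (proj₂ L (here refl)))) (≤ᵇ-intro (<⇒≤ (proj₂ (proj₂ L (here refl))))))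
  tail-meets {m ∷ rem} L (_∷_ {cs = cs} {ys} (wf , s , code , e) v) (there s∈) with code-cast {cs = cs} e code L
  ... | code' , refl = tail-meets (letters-remaining cs L code') v s∈

  tail-injective : ∀ {rem ys zs} → Letters rem → ValidTail (length rem) ys → ValidTail (length rem) zs →
                   decodeTail rem ys ≡ decodeTail rem zs → tailWord rem ys ≡ tailWord rem zs → ys ≡ zs
  tail-injective {[]} L [] [] _ _ = refl
  tail-injective {m ∷ rem} L (_∷_ {r = r} {α} {cs} {ys} (wf , s , code , e) v) (_∷_ {r = r'} {α'} {cs'} {zs} (wf' , s' , code' , e') v') F≡ w≡
    with ∷-injective F≡
  ... | t≡ , F≡' with reverse-injective {x = α} {α'} (cong TreeTriple.α t≡) | suc-injective (cong TreeTriple.r t≡)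
  ... | refl | refl with prefix-unique (word cs rem) (word cs' rem) (trans (length-word cs rem) (trans (suc-injective (trans (sym s) s')) (sym (length-word cs' rem)))) (∷-injectiveʳ w≡)
  ... | word≡ , w≡' with code-cast {cs = cs} e code L | code-cast {cs = cs'} e' code' L
  ... | c₁ , refl | c₂ , refl with word-injective cs cs' (increasing⇒unique (AllPairs.tail (proj₁ L))) c₁ c₂ word≡
  ... | refl = cong (blk r α cs ∷_) (tail-injective (letters-remaining cs L c₁) v v' F≡' w≡')

  module WithRightForest {W' Fs b β Rs} (ft : SimpleFT G' (tt (1 ∷ W') Fs (b ∷ β) 1 ∷ Rs)) where
    open WithRight ft public

    private
      right : Tree G' (1 ∷ W') Fs
      right = ToTree.toTree (proj₁ isT)

    pre-avoids : ∀ {ε' rem x} → Letters rem → Valid ε' (length rem) x → ∀ {s} → s ∈ preOf rem x → a ∉ V s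
    pre-avoids {rem = m ∷ rem} L (vcons {cs = cs} wf s code v e) s∈ a∈ with code-cast {cs = cs} e code L
    pre-avoids {rem = m ∷ rem} L (vcons {cs = cs} wf s code v e) (here refl) a∈ | code' , refl =
      <-irrefl refl (FirstBlock.bound L cs code' (Perm.∈-resp-↭ (sort-↭ (m ∷ word cs rem)) a∈))
    pre-avoids {rem = m ∷ rem} L (vcons {cs = cs} wf s code v e) (there s∈) a∈ | code' , refl = pre-avoids (letters-remaining cs L code') v s∈ a∈

    special∋ : ∀ {ε' rem x} → Letters rem → Valid ε' (length rem) x → a ∈ V (specialOf b R₁ rem x)
    special∋ {rem = rem} L (vonly _ _) = ∈-++⁺ʳ (front (sort (a ∷ []))) (here (sym up-1))
    special∋ {rem = m ∷ rem} L (vspec {cs = cs} {t} _ _ _ _ _ _ _ _) = ∈-++⁺ʳ (front (sort (specialWord m rem cs t))) (here (sym up-1))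
    special∋ {rem = m ∷ rem} L (vcons {cs = cs} wf s code v e) with code-cast {cs = cs} e code L
    ... | code' , refl = special∋ (letters-remaining cs L code') v

    post-meets : ∀ {ε' rem x} → Letters rem → Valid ε' (length rem) x → ∀ {s} → s ∈ postOf rem x → meets a s ≡ true
    post-meets {rem = []} L (vonly _ _) ()
    post-meets {rem = m ∷ rem} L (vspec {cs = cs} _ _ _ code _ _ v e) s∈ with code-cast {cs = cs} e code L
    ... | code' , refl = tail-meets (letters-remaining cs L code') v s∈
    post-meets {rem = m ∷ rem} L (vcons {cs = cs} wf s code v e) s∈ with code-cast {cs = cs} e code L
    ... | code' , refl = post-meets (letters-remaining cs L code') v s∈

    left-split : ∀ {ε' rem x} → Letters rem → Valid ε' (length rem) x → decodeLeft b R₁ rem x ≡ preOf rem x ++ specialOf b R₁ rem x ∷ postOf rem x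
    left-split {rem = []} L (vonly _ _) = refl
    left-split {rem = m ∷ rem} L (vspec _ _ _ _ _ _ _ _) = refl
    left-split {rem = m ∷ rem} L (vcons {r = r} {d} {l} {cs} wf s code v e) with code-cast {cs = cs} e code L
    ... | code' , refl = cong (wordTriple (m ∷ word cs rem) (d ∷ l) r ∷_) (left-split (letters-remaining cs L code') v)

    special-part : ∀ {ε' rem x} → Letters rem → Valid ε' (length rem) x →
      shiftT (a ∸ 1) (restrictT a (specialOf b R₁ rem x)) ≡ R₁ × 1 ≤ segT a (specialOf b R₁ rem x)
    special-part {rem = []} L (vonly {r} _ _) = restrict-glue {β = β} {r} right b>0 b [] ≤-refl size , ≤-trans (s≤s z≤n) (≤-reflexive (sym (seg≡ {β = β} {r} right b>0 b [] ≤-refl size)))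
      where
      only-a : ∀ {x} → x ∈ a ∷ [] → 1 ≤ x × x ≤ a
      only-a (here refl) = s≤s z≤n , ≤-refl
      open GlueWord {a ∷ []} ([] ∷ []) (here refl) only-a
      size : b + 0 ≡ length vs + b
      size = trans (+-identityʳ b) (cong (_+ b) (sym (suc-injective length-vs)))
    special-part {rem = m ∷ rem} L (vspec {r = r} {g} {l} {cs} {t} _ bg s code _ _ _ e) with code-cast {cs = cs} e code L
    ... | code' , _ with unique-special {cs = cs} {t} L code'
    ... | u , a∈ , bd = restrict-glue {β = β} {r} right b>0 g l bg size , ≤-trans (s≤s z≤n) (≤-reflexive (sym (seg≡ {β = β} {r} right b>0 g l bg size)))
      where
      open GlueWord u a∈ bd
      size : sum (g ∷ l) ≡ length vs + b
      size = balance (cong₂ _+_ s (cong₂ _+_ (sym length-vs) (cong₂ _+_ (sym (Perm.↭-length (insertAt-↭ (length rem ∸ t) a (word cs rem)))) (sym (length-word cs rem))))) (solve 7 (λ i j k l m n o → i :+ j :+ (con 1 :+ (o :+ l) :+ (con 1 :+ k :+ (m :+ n))) := k :+ l :+ (i :+ j :+ (con 1 :+ m :+ (con 1 :+ n :+ o)))) refl g (sum l) (length (front (sort (m ∷ insertAt (length rem ∸ t) a (word cs rem))))) b (length (insertAt (length rem ∸ t) a (word cs rem))) (length (word cs rem)) (length cs))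
    special-part {rem = m ∷ rem} L (vcons {cs = cs} wf s code v e) with code-cast {cs = cs} e code L
    ... | code' , refl = special-part (letters-remaining cs L code') v

    Z-avoids : ∀ {s} → s ∈ map raise Rs → meets a s ≡ false
    Z-avoids s∈ with ∈-map⁻ raise s∈
    ... | t , t∈ , refl = any-false _ (map up (V t)) λ x∈ → case ∈-map⁻ up x∈ of λ where
        (y , y∈ , refl) → not-true⇒false λ q → <⇒≱ (subst (_< up y) up-1 (+-monoʳ-< A (>1 t∈ y∈))) (≤ᵇ-true (proj₂ (∧-true {1 ≤ᵇ up y} q)))
      where
      >1 : ∀ {t y} → t ∈ Rs → y ∈ V t → 1 < y
      >1 {t} t∈ y∈ with tree-head (ToTree.toTree (proj₁ (All.lookup isTs t∈))) | Tree.increasing (ToTree.toTree (proj₁ (All.lookup isTs t∈)))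
      ... | h , U , Vt≡ | inc with subst Increasing Vt≡ inc | recast Vt≡ y∈
      ... | lts ∷ _ | here refl = subst (1 <_) (cong (headD 0) Vt≡) (All.lookup (proj₁ right-heads) (∈-map⁺ (λ t → headD 0 (V t)) t∈))
      ... | lts ∷ _ | there y∈U = <-trans (subst (1 <_) (cong (headD 0) Vt≡) (All.lookup (proj₁ right-heads) (∈-map⁺ (λ t → headD 0 (V t)) t∈))) (All.lookup lts y∈U)

    module _ {x} (v : Valid ε A x) where
      v′ : Valid ε (length (applyUpTo suc A)) x
      v′ = subst (λ k → Valid ε k x) (sym (length-applyUpTo {A = ℕ} suc A)) v

      pre post : Forest
      pre = preOf (applyUpTo suc A) x
      post = postOf (applyUpTo suc A) x
      special-tree : TreeTriple
      special-tree = specialOf b R₁ (applyUpTo suc A) x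

      open Located a {pre} {special-tree} {post} {map raise Rs} (pre-avoids {rem = applyUpTo suc A} {x} all-letters v′) (special∋ {rem = applyUpTo suc A} {x} all-letters v′) (post-meets {rem = applyUpTo suc A} {x} all-letters v′) Z-avoids public

      decode-split : decode x (R₁ ∷ Rs) ≡ F
      decode-split = trans (cong (_++ map raise Rs) (left-split all-letters v′)) (++-assoc pre _ _)

      restrict-decode : restrict a (decode x (R₁ ∷ Rs)) ≡ R₁ ∷ Rs
      restrict-decode = trans (cong (restrict a) decode-split) (trans restrict≡ (cong₂ _∷_ (proj₁ (special-part all-letters v′))
        (trans (sym (map-∘ Rs)) (trans (map-cong unraise Rs) (map-id Rs)))))
        where
        unraise : ∀ t → shiftT (a ∸ 1) (raise t) ≡ t
        unraise t = cong₂ (λ X Y → tt X Y (TreeTriple.α t) (TreeTriple.r t)) (map-down-up (V t)) (map-down²-up² (Ed t))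

    -- The compositions fix the length of each word, so the concatenated reading words can be cut
    -- into those of the single trees, and a word determines its code. In the tree containing `a`
    -- the place of `a` gives `t`.
    left-injective : ∀ {ε' rem x y} → Letters rem → Valid ε' (length rem) x → Valid ε' (length rem) y →
                     decodeLeft b R₁ rem x ≡ decodeLeft b R₁ rem y → leftWord rem x ≡ leftWord rem y → x ≡ y
    left-injective {rem = []} L (vonly _ _) (vonly _ _) F≡ _ = cong alone (suc-injective (cong TreeTriple.r (∷-injectiveˡ F≡)))
    left-injective {ε'} {m ∷ rem} L (vspec {r = r} {g} {l} {cs} {t} {ys} _ bg s code n≤t t≤ v e) (vspec {r = r'} {g'} {l'} {cs'} {t'} {ys'} _ bg' s' code' n≤t' t≤' v' e') F≡ w≡
      with ∷-injective F≡
    ... | t≡ , F≡' with reverse-injective {x = g ∷ l} {g' ∷ l'} (++-cancelʳ β _ _ (cong TreeTriple.α t≡)) | suc-injective (cong TreeTriple.r t≡)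
    ... | refl | refl with suc-injective (+-cancelʳ-≡ b _ _ (trans (sym s) s'))
    ... | len with code-cast {cs = cs} e code L | code-cast {cs = cs'} e' code' L
    ... | c₁ , refl | c₂ , refl with prefix-unique (specialWord m rem cs t) (specialWord m rem cs' t')
            (cong suc (trans (Perm.↭-length (insertAt-↭ (length rem ∸ t) a (word cs rem))) (trans (cong suc (trans (length-word cs rem) (trans len (sym (length-word cs' rem))))) (sym (Perm.↭-length (insertAt-↭ (length rem ∸ t') a (word cs' rem))))))) w≡
    ... | word≡ , w≡' with insertAt-injective {a} (length rem ∸ t) (length rem ∸ t') (word cs rem) (word cs' rem) (k≤ cs c₁ n≤t) (k≤ cs' c₂ n≤t') (a∉ cs c₁) (a∉ cs' c₂) (∷-injectiveʳ word≡)
      where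
      a∉ : ∀ cs → IsCode (length rem) cs → a ∉ word cs rem
      a∉ cs c a∈ = <-irrefl refl (FirstBlock.bound L cs c (there a∈))
      k≤ : ∀ cs {t} → IsCode (length rem) cs → length (remaining cs rem) ≤ t → length rem ∸ t ≤ length (word cs rem)
      k≤ cs {t} c le = ≤-trans (∸-monoʳ-≤ (length rem) le) (≤-reflexive (trans (cong (_∸ length (remaining cs rem)) (sym (length-remaining cs {rem} c)))
                         (trans (m+n∸n≡m (length cs) (length (remaining cs rem))) (sym (length-word cs rem)))))
    ... | k≡ , word≡' with word-injective cs cs' (increasing⇒unique (AllPairs.tail (proj₁ L))) c₁ c₂ word≡'
    ... | refl with ∸-cancelˡ-≡ (t-bound {ε'} {t} t≤) (t-bound {ε'} {t'} t≤') k≡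
      where
      t-bound : ∀ {ε' t} → ε' + t ≤ length cs + length (remaining cs rem) → t ≤ length rem
      t-bound {ε'} {t} le = ≤-trans (m≤n+m t ε') (≤-trans le (≤-reflexive (length-remaining cs {rem} c₁)))
    ... | refl = cong (special r (g ∷ l) cs t) (tail-injective (letters-remaining cs L c₁) v v' F≡' w≡')
    left-injective {rem = m ∷ rem} L (vcons {r = r} {d} {l} {cs} wf s code v e) (vcons {r = r'} {d'} {l'} {cs'} wf' s' code' v' e') F≡ w≡
      with ∷-injective F≡
    ... | t≡ , F≡' with reverse-injective {x = d ∷ l} {d' ∷ l'} (cong TreeTriple.α t≡) | suc-injective (cong TreeTriple.r t≡)
    ... | refl | refl with prefix-unique (word cs rem) (word cs' rem) (trans (length-word cs rem) (trans (suc-injective (trans (sym s) s')) (sym (length-word cs' rem)))) (∷-injectiveʳ w≡)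
    ... | word≡ , w≡' with code-cast {cs = cs} e code L | code-cast {cs = cs'} e' code' L
    ... | c₁ , refl | c₂ , refl with word-injective cs cs' (increasing⇒unique (AllPairs.tail (proj₁ L))) c₁ c₂ word≡
    ... | refl = cong (before r (d ∷ l) cs) (left-injective (letters-remaining cs L c₁) v v' F≡' w≡')
    -- A tree that contains `a` cannot equal one that avoids it.
    left-injective {rem = m ∷ rem} L v@(vspec _ _ _ _ _ _ _ _) v'@(vcons {cs = cs} _ _ code _ e) F≡ w≡ =
      ⊥-elim (pre-avoids L v' (here refl) (recast (cong V (∷-injectiveˡ F≡)) (special∋ L v)))
    left-injective {rem = m ∷ rem} L v'@(vcons {cs = cs} _ _ code _ e) v@(vspec _ _ _ _ _ _ _ _) F≡ w≡ =
      ⊥-elim (pre-avoids L v' (here refl) (recast (cong V (sym (∷-injectiveˡ F≡))) (special∋ L v)))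

    decode-injective : ∀ {x y} → Valid ε A x → Valid ε A y → decode x (R₁ ∷ Rs) ≡ decode y (R₁ ∷ Rs) → x ≡ y
    decode-injective {x} {y} v w e = left-injective all-letters (v′ v) (v′ w) F≡
        -- `leftWord` is recovered from the forest as the letters up to `a` in its reading words.
        (trans (sym (Facts.lowList (left-facts v))) (trans (cong (λ F → filterᵇ (_≤ᵇ a) (concat (map listT F))) F≡) (Facts.lowList (left-facts w))))
      where
      F≡ = ++-cancelʳ (map raise Rs) _ _ e

  -- Weight, type and sign of decoded forests

  private
    inverts : ℕ → ℕ → Bool
    inverts x y = (y <ᵇ x) ∧ E G y x

    inverts-elim : ∀ {x y} → inverts x y ≡ true → y < x × E G y x ≡ true
    inverts-elim {x} {y} q with ∧-true {y <ᵇ x} q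
    ... | p , e = <ᵇ-true p , e

  -- Adjacent letters lie on the same side of `a`. Although `a` is kept in both lists, it meets only
  -- smaller letters in one and only larger letters in the other, so each inversion is counted once.
  inv-split : ∀ ω → invG G ω ≡ invG G (filterᵇ (_≤ᵇ a) ω) + invG G (filterᵇ (a ≤ᵇ_) ω)
  inv-split [] = refl
  inv-split (x ∷ ω) with <-cmp x a
  ... | tri< x<a _ _ = trans
    (trans (cong₂ _+_ (sym (filter-absorb (inverts x) (_≤ᵇ a) ω λ _ q → ≤ᵇ-intro (<⇒≤ (<-trans (proj₁ (inverts-elim q)) x<a)))) (inv-split ω))
      (sym (+-assoc (length (filterᵇ (inverts x) (filterᵇ (_≤ᵇ a) ω))) _ _)))
    (sym (cong₂ (λ l h → invG G l + invG G h) (filter-yes (_≤ᵇ a) {x} ω (≤ᵇ-intro (<⇒≤ x<a))) (filter-no (a ≤ᵇ_) {x} ω (≤ᵇ-false x<a))))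
  ... | tri≈ _ refl _ = trans
    (trans (cong₂ _+_ (sym (filter-absorb (inverts a) (_≤ᵇ a) ω λ {y} _ q → ≤ᵇ-intro {y} {a} (<⇒≤ (proj₁ (inverts-elim {a} {y} q))))) (inv-split ω))
      (trans (sym (+-assoc (length (filterᵇ (inverts a) (filterᵇ (_≤ᵇ a) ω))) _ _))
        (cong (λ k → length (filterᵇ (inverts a) (filterᵇ (_≤ᵇ a) ω)) + invG G (filterᵇ (_≤ᵇ a) ω) + (k + invG G (filterᵇ (a ≤ᵇ_) ω))) (sym no-inversion))))
    (sym (cong₂ (λ l h → invG G l + invG G h) (filter-yes (_≤ᵇ a) {a} ω (≤ᵇ-intro {a} ≤-refl)) (filter-yes (a ≤ᵇ_) {a} ω (≤ᵇ-intro {a} ≤-refl))))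
    where
    no-inversion : length (filterᵇ (inverts a) (filterᵇ (a ≤ᵇ_) ω)) ≡ 0
    no-inversion = cong length (filter-empty (inverts a) (filterᵇ (a ≤ᵇ_) ω) λ {y} y∈ → not-true⇒false λ q →
      <⇒≱ (proj₁ (inverts-elim {a} {y} q)) (≤ᵇ-true (proj₂ (filter-elim (a ≤ᵇ_) ω y∈))))
  ... | tri> _ _ x>a = trans
    (trans (cong₂ _+_ (sym (filter-absorb (inverts x) (a ≤ᵇ_) ω λ {y} _ q → ≤ᵇ-intro (high y q))) (inv-split ω))
      (rotate (length (filterᵇ (inverts x) (filterᵇ (a ≤ᵇ_) ω))) (invG G (filterᵇ (_≤ᵇ a) ω)) (invG G (filterᵇ (a ≤ᵇ_) ω))))
    (sym (cong₂ (λ l h → invG G l + invG G h) (filter-no (_≤ᵇ a) {x} ω (≤ᵇ-false x>a)) (filter-yes (a ≤ᵇ_) {x} ω (≤ᵇ-intro (<⇒≤ x>a)))))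
    where
    rotate : ∀ i j k → i + (j + k) ≡ j + (i + k)
    rotate i j k = solve 3 (λ i j k → i :+ (j :+ k) := j :+ (i :+ k)) refl i j k
    high : ∀ y → inverts x y ≡ true → a ≤ y
    high y q with inverts-elim q
    ... | lt , e with edge-elim {y} {x} e lt
    ... | inj₁ (_ , _ , x≤a , _) = ⊥-elim (<⇒≱ x>a x≤a)
    ... | inj₂ (y≥a , _) = y≥a

  inv-up : ∀ l → (∀ {y} → y ∈ l → 1 ≤ y) → invG G (map up l) ≡ invG G' l
  inv-up [] _ = refl
  inv-up (x ∷ l) ≥1 = cong₂ _+_ (filter-map (inverts (up x)) (λ y → (y <ᵇ x) ∧ E G' y x) up l (λ {y} y∈ → bool-ext (to y (≥1 (there y∈))) (from y)))
                        (inv-up l (≥1 ∘ there))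
    where
    to : ∀ y → 1 ≤ y → inverts (up x) (up y) ≡ true → (y <ᵇ x) ∧ E G' y x ≡ true
    to y y≥1 q with inverts-elim q
    ... | lt , e with edge-elim {up y} {up x} e lt
    ... | inj₁ (uy<a , _) = absurd (balance-≤ (+-mono-≤ uy<a y≥1) (solve 2 (λ i j → con 1 :+ (con 1 :+ i :+ j) := con 0 :+ (con 1 :+ (i :+ j) :+ con 1)) refl A y))
    ... | inj₂ (_ , e') = ∧-intro (<ᵇ-intro (+-cancelˡ-< A y x lt)) (subst₂ (λ i j → E G' i j ≡ true) (down-up y) (down-up x) e')
    from : ∀ y → (y <ᵇ x) ∧ E G' y x ≡ true → inverts (up x) (up y) ≡ true
    from y q with ∧-true {y <ᵇ x} q
    ... | lt , e = ∧-intro (<ᵇ-intro (+-monoʳ-< A (<ᵇ-true lt))) (high-edge e)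

  -- `x < a` is adjacent to every smaller letter, so its inversions are the smaller letters still to
  -- come; their number is the Lehmer digit.
  count-split : ∀ {x p q ω} → ω ↭ p ++ q → 1 ≤ x → x < a → (∀ {y} → y ∈ p → 1 ≤ y × y < x) → (∀ {y} → y ∈ q → x ≤ y) →
                length (filterᵇ (inverts x) ω) ≡ length p
  count-split {x} {p} {q} {ω} perm x≥1 x<a small large = trans (filterᵇ-↭ (inverts x) perm) (trans (cong length (filterᵇ-++ (inverts x) p q))
    (trans (cong length (cong₂ _++_ (filter-full (inverts x) p full) (filter-empty (inverts x) q empty))) (cong length (++-identityʳ p))))
    where
    full : ∀ {y} → y ∈ p → inverts x y ≡ true
    full y∈ with small y∈
    ... | y≥1 , y<x = ∧-intro (<ᵇ-intro y<x) (low-edge y≥1 y<x (<⇒≤ x<a) (λ (_ , _ , x≡a) → <-irrefl x≡a x<a))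
    empty : ∀ {y} → y ∈ q → inverts x y ≡ false
    empty y∈ = not-true⇒false λ e → <⇒≱ (proj₁ (inverts-elim e)) (large y∈)

  inv-word : ∀ {rem H τ} cs → Letters rem → IsCode (length rem) cs → (∀ {y} → y ∈ H → a ≤ y) → τ ↭ remaining cs rem ++ H →
             invG G (word cs rem ++ τ) ≡ sum cs + invG G τ
  inv-word [] L code hi p = refl
  inv-word {rem} {H} {τ} (c ∷ cs) L code hi perm with first-letter {rem} code
  ... | p , x , q , refl , refl , e₁ , e₂ , code' rewrite e₁ | e₂ =
    trans (cong₂ _+_ (count-split {p = p} {q ++ H}
        (↭-trans (Perm.++⁺ˡ (word cs (p ++ q)) perm) (↭-trans (↭-reflexive (sym (++-assoc (word cs (p ++ q)) _ H)))
          (↭-trans (Perm.++⁺ʳ H (word-↭ cs code')) (↭-reflexive (++-assoc p q H)))))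
        (proj₁ (bd (∈-insert p))) (proj₂ (bd (∈-insert p))) (λ y∈ → proj₁ (bd (∈-++⁺ˡ y∈)) , proj₂ (proj₂ pieces) y∈ (here refl))
        (λ y∈ → [ (λ y∈q → after y∈q) , (λ y∈H → ≤-trans (<⇒≤ (proj₂ (bd (∈-insert p)))) (hi y∈H)) ]′ (∈-++⁻ q y∈)))
      (inv-word cs (increasing-delete p (proj₁ L) , λ y∈ → bd ([ ∈-++⁺ˡ , (λ r → ∈-++⁺ʳ p (there r)) ]′ (∈-++⁻ p y∈))) code' hi perm))
      (sym (+-assoc (length p) (sum cs) (invG G τ)))
    where
    bd = proj₂ L
    pieces = increasing-split p (proj₁ L)
    after : ∀ {y} → y ∈ q → x ≤ y
    after y∈ with proj₁ (proj₂ pieces)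
    ... | lts ∷ _ = <⇒≤ (All.lookup lts y∈)

  -- The first letter of a tree is the least one available and counts as a digit 0.
  inv-block : ∀ {m rem H τ} cs → Letters (m ∷ rem) → IsCode (length rem) cs → (∀ {y} → y ∈ H → a ≤ y) → τ ↭ remaining cs rem ++ H →
              invG G (m ∷ word cs rem ++ τ) ≡ sum cs + invG G τ
  inv-block cs L code hi perm = inv-word (0 ∷ cs) L (z≤n , code) hi perm

  tailWord-↭ : ∀ {rem ys} → Letters rem → ValidTail (length rem) ys → tailWord rem ys ↭ rem
  tailWord-↭ {[]} L [] = ↭-refl
  tailWord-↭ {m ∷ rem} L (_∷_ {cs = cs} (wf , s , code , e) v) with code-cast {cs = cs} e code L
  ... | code' , refl = ↭-prep m (↭-trans (Perm.++⁺ˡ (word cs rem) (tailWord-↭ (letters-remaining cs L code') v)) (word-↭ cs code'))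

  inv-tail : ∀ {rem ys} → Letters rem → ValidTail (length rem) ys → invG G (tailWord rem ys) + rSum (decodeTail rem ys) ≡ tailWeight ys
  inv-tail {[]} L [] = refl
  inv-tail {m ∷ rem} L (_∷_ {r = r} {α} {cs} {ys} (wf , s , code , e) v) with code-cast {cs = cs} e code L
  ... | code' , refl = trans (cong (_+ (r + rSum (decodeTail rem₁ ys))) (inv-block {τ = τ} cs L code' (λ ()) (↭-trans (tailWord-↭ L₁ v) (↭-reflexive (sym (++-identityʳ rem₁))))))
      (regroup (sum cs) (invG G τ) r (rSum (decodeTail rem₁ ys)) (inv-tail L₁ v))
    where
    rem₁ = remaining cs rem
    τ = tailWord rem₁ ys
    L₁ = letters-remaining cs L code'
    regroup : ∀ s i r q {w} → i + q ≡ w → s + i + (r + q) ≡ r + s + w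
    regroup s i r q {w} e = balance e (solve 5 (λ i j k l m → i :+ j :+ (k :+ l) :+ m := k :+ i :+ m :+ (j :+ l)) refl s i r q w)

  raise-listT : ∀ {t} → IsTreeTriple G' t → listT (raise t) ≡ map up (listT t)
  raise-listT {tt Vs Es α r} (d , _) with tree-head (ToTree.toTree d)
  ... | m , U , refl with tree-reading (ToTree.toTree d)
  ... | w , g , p = trans (listT-greedy {α = α} {r} (up-increasing (Tree.increasing (ToTree.toTree d))) (greedy-up g) (Perm.map⁺ up p))
        (cong (map up) (sym (listT-greedy {α = α} {r} (Tree.increasing (ToTree.toTree d)) g p)))

  raise-listTs : ∀ {F} → All (IsTreeTriple G') F → concat (map listT (map raise F)) ≡ map up (concat (map listT F))
  raise-listTs [] = refl
  raise-listTs {t ∷ F} (q ∷ qs) = trans (cong₂ _++_ (raise-listT q) (raise-listTs qs)) (sym (map-++ up (listT t) _))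

  module DecodeStatistics {W' Fs b β Rs} (ft : SimpleFT G' (tt (1 ∷ W') Fs (b ∷ β) 1 ∷ Rs)) where
    open WithRightForest ft public

    leftWord-↭ : ∀ {ε' rem x} → Letters rem → Valid ε' (length rem) x → leftWord rem x ↭ rem ++ a ∷ []
    leftWord-↭ {rem = []} L (vonly _ _) = ↭-refl
    leftWord-↭ {rem = m ∷ rem} L (vspec {cs = cs} {t} {ys} _ _ _ code _ _ v e) with code-cast {cs = cs} e code L
    ... | code' , refl = ↭-prep m (↭-trans (Perm.++⁺ (insertAt-↭ (length rem ∸ t) a (word cs rem)) (tailWord-↭ (letters-remaining cs L code') v))
            (↭-trans (↭-prep a (word-↭ cs code')) (Perm.++-comm (a ∷ []) rem)))
    leftWord-↭ {rem = m ∷ rem} L (vcons {cs = cs} wf s code v e) with code-cast {cs = cs} e code L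
    ... | code' , refl = ↭-prep m (↭-trans (Perm.++⁺ˡ (word cs rem) (leftWord-↭ (letters-remaining cs L code') v))
            (↭-trans (↭-reflexive (sym (++-assoc (word cs rem) _ _))) (Perm.++⁺ʳ (a ∷ []) (word-↭ cs code'))))

    inv-left : ∀ {ε' rem x} → Letters rem → Valid ε' (length rem) x →
               invG G (leftWord rem x) + rSum (decodeLeft b R₁ rem x) ≡ skeletonWeight x
    inv-left {rem = []} L (vonly {r} _ _) = +-identityʳ r
    inv-left {ε'} {m ∷ rem} L (vspec {r = r} {g} {l} {cs} {t} {ys} _ _ _ code n≤t t≤ v e) with code-cast {cs = cs} e code L
    -- The code is cut at the place of `a`: the digits in `c₁` precede it, those in `c₂` follow.
    ... | code' , refl with split-at (length rem ∸ t) cs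
             (≤-trans (∸-monoʳ-≤ (length rem) n≤t) (≤-reflexive (trans (cong (_∸ length (remaining cs rem)) (sym (length-remaining cs {rem} code'))) (m+n∸n≡m (length cs) (length (remaining cs rem))))))
    ... | c₁ , c₂ , refl , len = trans (cong (λ w → invG G (m ∷ w ++ τ) + (r + rSum (decodeTail rem₂ ys))) inserted)
          (trans (cong (λ w → invG G (m ∷ w) + (r + rSum (decodeTail rem₂ ys))) (++-assoc (word c₁ rem) (a ∷ word c₂ rem₁) τ))
          (trans (cong (_+ (r + rSum (decodeTail rem₂ ys))) (trans (inv-block {τ = a ∷ word c₂ rem₁ ++ τ} c₁ L code₁ (λ where (here refl) → ≤-refl) (↭-trans (↭-prep a X↭) (Perm.++-comm (a ∷ []) rem₁)))
              (cong (sum c₁ +_) (cong₂ _+_ count-a (inv-word {H = []} {τ} c₂ L₁ code₂ (λ ()) (↭-trans τ↭ (↭-reflexive (sym (++-identityʳ _)))))))))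
            (regroup (sum c₁) t (sum c₂) (invG G τ) r (rSum (decodeTail rem₂ ys)) (inv-tail L₂ v) (sum-++ c₁ c₂))))
      where
      rem₁ = remaining c₁ rem
      rem₂ = remaining (c₁ ++ c₂) rem
      τ = tailWord rem₂ ys
      L₂ = letters-remaining (c₁ ++ c₂) L code'
      t≤rem : t ≤ length rem
      t≤rem = ≤-trans (m≤n+m t ε') (≤-trans t≤ (≤-reflexive (length-remaining (c₁ ++ c₂) {rem} code')))
      prefix : ∀ {k} c₁ {c₂} → IsCode k (c₁ ++ c₂) → IsCode k c₁
      prefix [] _ = _
      prefix {suc k} (c ∷ c₁) (p , q) = p , prefix c₁ q
      code₁ : IsCode (length rem) c₁
      code₁ = prefix c₁ code'
      code₂ : IsCode (length rem₁) c₂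
      code₂ = proj₂ (code-++⁻ c₁ (subst (λ k → IsCode k (c₁ ++ c₂)) (sym (length-remaining c₁ {rem} code₁)) code'))
      L₁ : Letters rem₁
      L₁ = letters-remaining c₁ L code₁
      inserted : insertAt (length rem ∸ t) a (word (c₁ ++ c₂) rem) ≡ word c₁ rem ++ a ∷ word c₂ rem₁
      inserted = trans (cong₂ (λ k w → insertAt k a w) (trans (sym len) (sym (length-word c₁ rem))) (word-++ c₁ c₂ rem)) (insertAt-mid (word c₁ rem) (word c₂ rem₁))
      τ↭ : τ ↭ remaining c₂ rem₁
      τ↭ = ↭-trans (tailWord-↭ L₂ v) (↭-reflexive (remaining-++ c₁ c₂ rem))
      X↭ : word c₂ rem₁ ++ τ ↭ rem₁
      X↭ = ↭-trans (Perm.++⁺ˡ (word c₂ rem₁) τ↭) (word-↭ c₂ code₂)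
      -- The letters after `a` are larger than `m`, hence not 1, so all of them are adjacent to `a`
      -- even if the edge {1,a} is missing.
      count-a : length (filterᵇ (inverts a) (word c₂ rem₁ ++ τ)) ≡ t
      count-a = trans (filterᵇ-↭ (inverts a) X↭) (trans (cong length (filter-full (inverts a) rem₁ full)) rem₁-length)
        where
        rem₁-length : length rem₁ ≡ t
        rem₁-length = balance (cong₂ _+_ (length-remaining c₁ {rem} code₁) (cong₂ _+_ (sym len) (sym (m∸n+n≡m t≤rem)))) (solve 5 (λ i j k l m → i :+ (m :+ (k :+ (l :+ j))) := j :+ (k :+ i :+ (l :+ m))) refl (length (remaining c₁ rem)) t (length c₁) (length rem ∸ t) (length rem))
        full : ∀ {y} → y ∈ rem₁ → inverts a y ≡ true
        full {y} y∈ with proj₂ L₁ y∈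
        ... | y≥1 , y<a = ∧-intro (<ᵇ-intro y<a) (low-edge y≥1 y<a ≤-refl λ (_ , y≡1 , _) →
                <-irrefl (sym y≡1) (≤-trans (s≤s (proj₁ (proj₂ L (here refl)))) (FirstBlock.above L c₁ code₁ (FirstBlock.remaining∈ L c₁ code₁ y∈))))
      regroup : ∀ s₁ t s₂ i r q {w s} → i + q ≡ w → s ≡ s₁ + s₂ → s₁ + (t + (s₂ + i)) + (r + q) ≡ r + s + t + w
      regroup s₁ t s₂ i r q {w} {s} e e' = balance (cong₂ _+_ e (sym e')) (solve 8 (λ i j k l m n o p → i :+ (j :+ (k :+ l)) :+ (m :+ n) :+ (p :+ o) := m :+ o :+ j :+ p :+ (l :+ n :+ (i :+ k))) refl s₁ t s₂ i r q s w)
    inv-left {rem = m ∷ rem} L (vcons {r = r} {d} {l} {cs} {x} wf s code v e) with code-cast {cs = cs} e code L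
    ... | code' , refl = trans (cong (_+ (r + rSum (decodeLeft b R₁ rem₁ x))) (inv-block {τ = leftWord rem₁ x} cs L code' (λ where (here refl) → ≤-refl) (leftWord-↭ L₁ v)))
        (regroup (sum cs) (invG G (leftWord rem₁ x)) r (rSum (decodeLeft b R₁ rem₁ x)) (inv-left L₁ v))
      where
      rem₁ = remaining cs rem
      L₁ = letters-remaining cs L code'
      regroup : ∀ s i r q {w} → i + q ≡ w → s + i + (r + q) ≡ r + s + w
      regroup s i r q {w} e = balance e (solve 5 (λ i j k l m → i :+ j :+ (k :+ l) :+ m := k :+ i :+ m :+ (j :+ l)) refl s i r q w)

    tail-parts : ∀ {rem ys} → Letters rem → ValidTail (length rem) ys → partList (decodeTail rem ys) ↭ partsOf ys × cutSum (decodeTail rem ys) ≡ tailCuts ys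
    tail-parts {[]} L [] = ↭-refl , refl
    tail-parts {m ∷ rem} L (_∷_ {α = α} {cs} (wf , s , code , e) v) with code-cast {cs = cs} e code L
    ... | code' , refl with tail-parts (letters-remaining cs L code') v
    ... | p , c = Perm.++⁺ (Perm.↭-reverse α) p , cong₂ (λ i j → (i ∸ 1) + j) (length-reverse α) c

    -- The first part `b` of the restriction is already contained in a part of the skeleton; each of
    -- the other parts `β` adds one further cut.
    left-parts : ∀ {ε' rem x} → Letters rem → Valid ε' (length rem) x →
      partList (decodeLeft b R₁ rem x) ↭ skeletonParts x ++ β × cutSum (decodeLeft b R₁ rem x) ≡ skeletonCuts x + length β
    left-parts {rem = []} L (vonly _ _) = ↭-reflexive (++-identityʳ (b ∷ β)) , +-identityʳ (length β)
    left-parts {rem = m ∷ rem} L (vspec {r = r} {g} {l} {cs} {t} {ys} _ _ _ code _ _ v e) with code-cast {cs = cs} e code L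
    ... | code' , refl with tail-parts (letters-remaining cs L code') v
    ... | p , c = ↭-trans (↭-reflexive (++-assoc (reverse (g ∷ l)) β _)) (↭-trans (Perm.++⁺ (Perm.↭-reverse (g ∷ l)) (↭-trans (Perm.++⁺ˡ β p) (Perm.++-comm β (partsOf ys))))
          (↭-reflexive (sym (++-assoc (g ∷ l) (partsOf ys) β)))) ,
        glued (cong (_∸ 1) (trans (length-++ (reverse (g ∷ l)) {β}) (cong (_+ length β) (length-reverse (g ∷ l))))) c
      where
      glued : ∀ {i j} → i ≡ length l + length β → j ≡ tailCuts ys → i + j ≡ length l + tailCuts ys + length β
      glued {i} {j} p q = balance (cong₂ _+_ p q) (solve 5 (λ i j k l m → i :+ j :+ (k :+ m :+ l) := k :+ l :+ m :+ (i :+ j)) refl i j (length l) (tailCuts ys) (length β))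
    left-parts {rem = m ∷ rem} L (vcons {d = d} {l} {cs} {x} wf s code v e) with code-cast {cs = cs} e code L
    ... | code' , refl with left-parts (letters-remaining cs L code') v
    ... | p , c = ↭-trans (Perm.++⁺ (Perm.↭-reverse (d ∷ l)) p) (↭-reflexive (sym (++-assoc (d ∷ l) (skeletonParts x) β))) ,
        trans (cong₂ (λ i j → (i ∸ 1) + j) (length-reverse (d ∷ l)) c) (sym (+-assoc (length l) (skeletonCuts x) (length β)))

    module _ {x} (v : Valid ε A x) where
      private
        L = decodeLeft b R₁ (applyUpTo suc A) x

      parts-decode : partList (decode x (R₁ ∷ Rs)) ↭ skeletonParts x ++ β ++ partList Rs
      parts-decode = ↭-trans (↭-reflexive (concat-map-++ α L (map raise Rs)))
        (↭-trans (Perm.++⁺ (proj₁ (left-parts all-letters (v′ v))) (↭-reflexive (cong concat (sym (map-∘ Rs))))) (↭-reflexive (++-assoc (skeletonParts x) β _)))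

      cuts-decode : cutSum (decode x (R₁ ∷ Rs)) ≡ skeletonCuts x + cutSum (R₁ ∷ Rs)
      cuts-decode = trans (map-sum-++ (λ t → length (α t) ∸ 1) L (map raise Rs))
        (trans (cong₂ _+_ (proj₂ (left-parts all-letters (v′ v))) (cong sum (sym (map-∘ Rs)))) (+-assoc (skeletonCuts x) (length β) _))

      α11-decode : α11 (decode x (R₁ ∷ Rs)) ≡ skeletonFirst x
      α11-decode = go all-letters (v′ v)
        where
        go : ∀ {ε' rem x} → Letters rem → Valid ε' (length rem) x → α11 (decodeLeft b R₁ rem x ++ map raise Rs) ≡ skeletonFirst x
        go {rem = []} L (vonly _ _) = refl
        go {rem = m ∷ rem} L (vspec {g = g} {l} (_ , r<) _ _ _ _ _ _ _) = headD-reverse (g ∷ l) {β} (≤-trans (s≤s z≤n) r<)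
        go {rem = m ∷ rem} L (vcons {d = d} {l} (_ , r<) _ _ _ _) = trans (cong (headD 0) (sym (++-identityʳ (reverse (d ∷ l))))) (headD-reverse (d ∷ l) (≤-trans (s≤s z≤n) r<))

      weight-decode : weight G (decode x (R₁ ∷ Rs)) ≡ skeletonWeight x + weight G' (R₁ ∷ Rs)
      weight-decode = trans (cong₂ _+_ (trans (inv-split ω) (cong₂ _+_ (cong (invG G) low) (trans (cong (invG G) high) (inv-up _ letters≥1)))) rs)
        (regroup (invG G (leftWord (applyUpTo suc A) x)) (invG G' (concat (map listT (R₁ ∷ Rs)))) (rSum L) (rSum Rs) (inv-left all-letters (v′ v)))
        where
        open Facts (left-facts v)
        ω = concat (map listT (decode x (R₁ ∷ Rs)))
        ω≡ : ω ≡ concat (map listT L) ++ map up (concat (map listT Rs))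
        ω≡ = trans (concat-map-++ listT L (map raise Rs)) (cong (concat (map listT L) ++_) (raise-listTs isTs))
        letter : ∀ {F y} → All (IsTreeTriple G') F → y ∈ concat (map listT F) → y ∈ concat (map V F)
        letter {t ∷ F} (q ∷ qs) y∈ with ∈-++⁻ (listT t) y∈
        ... | inj₁ p = ∈-++⁺ˡ (listT-∈ q p)
        ... | inj₂ p = ∈-++⁺ʳ (V t) (letter qs p)
        letters≥1 : ∀ {y} → y ∈ concat (map listT (R₁ ∷ Rs)) → 1 ≤ y
        letters≥1 y∈ = proj₁ (interval-∈ (n G') (Perm.∈-resp-↭ (proj₁ (proj₂ (proj₁ ft))) (letter (proj₁ (proj₁ ft)) y∈)))
        uniq : Unique (concat (map V (R₁ ∷ Rs)))
        uniq = unique-↭ (↭-sym (proj₁ (proj₂ (proj₁ ft)))) (increasing⇒unique (interval-increasing (n G')))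
        Rs>a : ∀ {y} → y ∈ map up (concat (map listT Rs)) → a < y
        Rs>a y∈ with ∈-map⁻ up y∈
        ... | z , z∈ , refl = subst (_< up z) up-1 (+-monoʳ-< A (≤∧≢⇒< (letters≥1 (∈-++⁺ʳ (listT R₁) z∈)) λ e →
                proj₂ (proj₂ (unique-++⁻ (V R₁) uniq)) (here refl) (subst (_∈ concat (map V Rs)) (sym e) (letter isTs z∈))))
        low : filterᵇ (_≤ᵇ a) ω ≡ leftWord (applyUpTo suc A) x
        low = trans (cong (filterᵇ (_≤ᵇ a)) ω≡) (trans (filterᵇ-++ (_≤ᵇ a) (concat (map listT L)) _)
          (trans (cong₂ _++_ lowList (filter-empty (_≤ᵇ a) _ (λ y∈ → ≤ᵇ-false (Rs>a y∈)))) (++-identityʳ _)))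
        high : filterᵇ (a ≤ᵇ_) ω ≡ map up (concat (map listT (R₁ ∷ Rs)))
        high = trans (cong (filterᵇ (a ≤ᵇ_)) ω≡) (trans (filterᵇ-++ (a ≤ᵇ_) (concat (map listT L)) _)
          (trans (cong₂ _++_ highList (filter-full (a ≤ᵇ_) _ (λ y∈ → ≤ᵇ-intro (<⇒≤ (Rs>a y∈))))) (sym (map-++ up (listT R₁) _))))
        rs : rSum (decode x (R₁ ∷ Rs)) ≡ rSum L + rSum Rs
        rs = trans (map-sum-++ (λ t → r t ∸ 1) L (map raise Rs)) (cong (λ l → rSum L + sum l) (sym (map-∘ Rs)))
        regroup : ∀ i j p q {w} → i + p ≡ w → i + j + (p + q) ≡ w + (j + q)
        regroup i j p q {w} e = balance e (solve 5 (λ i j k l m → i :+ j :+ (k :+ l) :+ m := m :+ (j :+ l) :+ (i :+ k)) refl i j p q w)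

-- Fixed points

total-atom : ∀ F → Atom F → totalLength F ≡ length F
total-atom [] [] = refl
total-atom (t ∷ F) (p ∷ ps) = cong₂ _+_ p (total-atom F ps)

segIdx-single : ∀ k g → segIdx k (g ∷ []) ≡ 1
segIdx-single k g with k ≤ᵇ g
... | true = refl
... | false = refl

length-reverse-one : ∀ (g : ℕ) l β → length (reverse (g ∷ l) ++ β) ≡ 1 → l ≡ [] × β ≡ []
length-reverse-one g l β e = empty l (balance-slack (length β) (≤-reflexive e') (solve 2 (λ i j → i :+ con 1 :+ j := con 0 :+ (con 1 :+ (i :+ j))) refl (length l) (length β))) , empty β (balance-slack (length l) (≤-reflexive e') (solve 2 (λ i j → i :+ con 1 :+ j := con 0 :+ (con 1 :+ (j :+ i))) refl (length β) (length l)))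
  where
  e' : suc (length l) + length β ≡ 1
  e' = trans (cong (_+ length β) (sym (length-reverse (g ∷ l)))) (trans (sym (length-++ (reverse (g ∷ l)))) e)
  empty : ∀ (l : List ℕ) → length l ≤ 0 → l ≡ []
  empty [] _ = refl

module Fixedness (G' : Graph) (range : ∀ i j → E G' i j ≡ true → (1 ≤ i × i ≤ n G') × (1 ≤ j × j ≤ n G')) (n≥1 : 1 ≤ n G') (A' ε : ℕ) where
  open Sum G' range n≥1 (suc A') ε public

  A : ℕ
  A = suc A'

  module _ {W' Fs b β Rs} (ft : SimpleFT G' (tt (1 ∷ W') Fs (b ∷ β) 1 ∷ Rs)) {x} (v : WithRight.Valid ft ε A x) where
    open DecodeStatistics ft

    private
      R = R₁ ∷ Rs
      F₀ = decode x R

    -- The condition on fixed points with its indices resolved. Numbers of trees replace numbers of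
    -- parts in seg, since the forest is an atom.
    record Reading : Set where
      constructor reading
      field
        atom-pre     : Atom (pre v)
        atom-special : length (α (special-tree v)) ≡ 1
        atom-post    : Atom (post v)
        atom-rest    : Atom Rs
        seg≤2        : segT a (special-tree v) + length (pre v) + length (post v) ≤ 2
        without-1    : memB 1 (V (special-tree v)) ≡ false → a ∸ ε ≤ r (special-tree v)
        with-1       : memB 1 (V (special-tree v)) ≡ true → a ≤ length (V (special-tree v))

    getT-decode : getT F₀ (idxOf a F₀) ≡ special-tree v
    getT-decode = trans (cong (λ F → getT F (idxOf a F)) (decode-split v)) (getT≡ v)

    segF-decode : segF a F₀ ≡ segT a (special-tree v) + totalLength (pre v) + totalLength (post v)
    segF-decode = trans (cong (segF a) (decode-split v)) (segF≡ v)

    atoms-raise : ∀ {F} → Atom F → Atom (map raise F)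
    atoms-raise = Allₚ.map⁺

    reading⇒cond : ∀ {φ'} → φ' R ≡ R → Reading → FixedCond a ε φ' F₀
    reading⇒cond {φ'} e (reading p s q rs seg wo wi) =
      subst Atom (sym (decode-split v)) (Allₚ.++⁺ p (s ∷ Allₚ.++⁺ q (atoms-raise rs))) ,
      trans (cong φ' (restrict-decode v)) (trans e (sym (restrict-decode v))) ,
      subst (_≤ 2) (sym (trans segF-decode (cong₂ (λ i j → segT a (special-tree v) + i + j) (total-atom _ p) (total-atom _ q)))) seg ,
      subst (λ t → memB 1 (V t) ≡ false → a ∸ ε ≤ r t) (sym getT-decode) wo ,
      subst (λ t → memB 1 (V t) ≡ true → a ≤ length (V t)) (sym getT-decode) wi

    cond⇒reading : ∀ {φ'} → FixedCond a ε φ' F₀ → φ' R ≡ R × Reading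
    cond⇒reading {φ'} (at , e , seg , wo , wi) with Allₚ.++⁻ (pre v) (subst Atom (decode-split v) at)
    ... | p , s ∷ qz with Allₚ.++⁻ (post v) qz
    ... | q , z = trans (cong φ' (sym (restrict-decode v))) (trans e (restrict-decode v)) ,
          reading p s q (Allₚ.map⁻ z)
            (subst (_≤ 2) (trans segF-decode (cong₂ (λ i j → segT a (special-tree v) + i + j) (total-atom _ p) (total-atom _ q))) seg)
            (subst (λ t → memB 1 (V t) ≡ false → a ∸ ε ≤ r t) getT-decode wo)
            (subst (λ t → memB 1 (V t) ≡ true → a ≤ length (V t)) getT-decode wi)

  module _ {W' Fs b β Rs} (ft : SimpleFT G' (tt (1 ∷ W') Fs (b ∷ β) 1 ∷ Rs)) where
    open DecodeStatistics ft

    private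
      rem₀ = applyUpTo (2 +_) A'

      -- Vertex 1 lies in the first tree, so the two alternatives of the condition, whether or not 1
      -- is in the tree of `a`, correspond to the shapes `PA` and `PB`.
      1∈first : ∀ {x} (v : Valid ε A x) {t F} → decode x (R₁ ∷ Rs) ≡ t ∷ F → 1 ∈ V t
      1∈first {x} v {t} {F} e with subst (IsForestTriple G) e (decode-forest v)
      ... | ts , p , l with first-head ts (Linkedₚ.Linked⇒AllPairs <-trans l) p (here refl) (λ y∈ → proj₁ (interval-∈ (n G) y∈))
      ... | U , Vt≡ = recast (sym Vt≡) (here refl)

      1∉later : ∀ {x} (v : Valid ε A x) {t F s} → decode x (R₁ ∷ Rs) ≡ t ∷ F → s ∈ F → 1 ∉ V s
      1∉later {x} v {t} {F} e s∈ 1∈ with subst (IsForestTriple G) e (decode-forest v)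
      ... | ts , p , l = proj₂ (proj₂ (unique-++⁻ (V t) (unique-↭ (↭-sym p) (increasing⇒unique (interval-increasing (n G)))))) (1∈first v e) (tree-∈ s∈ 1∈)

      special-length : ∀ {r g l cs t ys} (v : Valid ε A (special r (g ∷ l) cs t ys)) → β ≡ [] → l ≡ [] → length (V (special-tree v)) ≡ g
      special-length {g = g} v refl refl with subst (All (IsTreeTriple G)) (left-split all-letters (v′ v)) (Facts.trees (left-facts v))
      ... | (_ , (_ , s) , _) ∷ _ = trans (sym s) (+-identityʳ g)

      reduced-tail : ∀ {rem ys c es} → Reduced ys c es → Atom (decodeTail rem ys) × length (decodeTail rem ys) ≤ 1
      reduced-tail {[]} none = [] , z≤n
      reduced-tail {_ ∷ _} none = [] , z≤n
      reduced-tail {[]} (one _) = [] , z≤n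
      reduced-tail {_ ∷ rem} (one {cs = cs} _) with remaining cs rem
      ... | [] = refl ∷ [] , s≤s z≤n
      ... | _ ∷ _ = refl ∷ [] , s≤s z≤n

      -- With `c = 0` the tree of `a` is the only one meeting the remaining letters, and `t` is one
      -- less than its r.
      inner : ∀ {rem y c' t es} → Valid 0 (length rem) y → Out y 0 c' t es →
              α (specialOf b R₁ rem y) ≡ c' ∷ β × r (specialOf b R₁ rem y) ≡ suc t × preOf rem y ≡ [] × postOf rem y ≡ []
      inner {[]} (vonly _ _) lone = refl , refl , refl , refl
      inner {m ∷ rem} (vonly _ ()) lone
      inner {[]} (vspec _ _ _ _ _ _ _ ()) (keep _ _ _ _)
      inner {m ∷ rem} (vspec {cs = cs} _ _ _ _ _ _ _ _) (keep none _ _ _) with remaining cs rem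
      ... | [] = refl , refl , refl , refl
      ... | _ ∷ _ = refl , refl , refl , refl
      inner v (swap _ _ () _)
      inner v (first _ _ () _ _)

    fixed⇒reading : ∀ {x} (v : Valid ε A x) → Atom (R₁ ∷ Rs) → FixedSkeleton ε x → Reading ft v
    fixed⇒reading v@(vspec {r = r} {g} {cs = cs} {t} {ys} wf bg s code nt t≤ vt e) (β1 ∷ rs) (_ , _ , _ , formA {c = c} red _ , fixA cb)
      with length-reverse-one b [] β β1 | reduced-tail {remaining cs rem₀} red | reduced-size vt red
    ... | _ , refl | at , len | refl , _ = reading [] refl at rs
        (+-mono-≤ (≤-reflexive (cong (_+ 0) (segIdx-single (kOf a (special-tree v)) g))) len)
        (λ q → true≢false (memB-intro (1∈first v refl)) q)
        -- |V(T_i)| is `1 + length cs + b` and `a - 1` is `1 + length cs + c`, so `c < b` amounts to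
        -- |V(T_i)| ≥ a.
        (λ _ → subst (a ≤_) (sym (special-length v refl refl)) (balance-≤ (+-mono-≤ (≤-reflexive e) (+-mono-≤ (≤-reflexive (sym s)) cb)) (solve 5 (λ i j k l m → con 1 :+ (con 1 :+ i) :+ (con 1 :+ (k :+ m) :+ (j :+ con 0 :+ l)) := j :+ (con 1 :+ i :+ (con 1 :+ (k :+ l) :+ (con 1 :+ m)))) refl A' g (length cs) b c)))
    fixed⇒reading v@(vcons {r = r} {d} {cs = cs} {y} wf s code vy e) (β1 ∷ rs) (_ , _ , ds , fm@(formB {t = t} o _) , fixB le)
      with length-reverse-one b [] β β1 | code-cast {1} {rem₀} {cs} (trans (cong suc (length-applyUpTo (2 +_) A')) e) code all-letters
    ... | _ , refl | code' , refl with inner {remaining cs rem₀} vy o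
    ... | α≡ , r≡ , pre≡ , post≡ = reading (refl ∷ subst Atom (sym pre≡) []) (cong length α≡) (subst Atom (sym post≡) []) rs
        (≤-reflexive (cong₂ _+_ (cong₂ _+_ (trans (cong (segIdx (kOf a (special-tree v))) α≡) (segIdx-single (kOf a (special-tree v)) _)) (cong (suc ∘ length) pre≡)) (cong length post≡)))
        -- r_i is `t + 1`, and `fixB` says `a - 1 ≤ ε + t`.
        (λ _ → subst (a ∸ ε ≤_) (sym r≡) (m≤n+o⇒m∸n≤o a ε (≤-trans (s≤s (≤-trans (≤-reflexive (ValidForm.size (proj₁ (form-valid v fm)))) le)) (≤-reflexive (sym (+-suc ε t))))))
        (λ q → ⊥-elim (1∉later v refl special∈ (memB-elim (V (special-tree v)) q)))
      where
      special∈ : special-tree v ∈ decodeLeft b R₁ (remaining cs rem₀) y ++ map raise Rs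
      special∈ = ∈-++⁺ˡ (subst (special-tree v ∈_) (sym (left-split (letters-remaining cs all-letters code') vy)) (∈-++⁺ʳ (preOf (remaining cs rem₀) y) (here refl)))

    private
      tail-empty : ∀ {rem ys} → ValidTail (length rem) ys → length (decodeTail rem ys) ≤ 0 → ys ≡ []
      tail-empty {[]} [] _ = refl
      tail-empty {_ ∷ _} (_ ∷ _) ()

      tail-reduced : ∀ {rem ys} → ValidTail (length rem) ys → Atom (decodeTail rem ys) → length (decodeTail rem ys) ≤ 1 → Letters (1 ∷ rem) → ∃ λ c → ∃ λ es → Reduced ys c es
      tail-reduced {[]} [] _ _ _ = _ , _ , none
      tail-reduced {m ∷ rem} (_∷_ {α = α} {cs} (wf , s , code , e) v) (at ∷ ats) le L with code-cast {cs = cs} e code (AllPairs.tail (proj₁ L) , proj₂ L ∘ there)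
      tail-reduced {m ∷ rem} (_∷_ {α = []} {cs} (wf , () , code , e) v) (at ∷ ats) le L | _
      tail-reduced {m ∷ rem} (_∷_ {α = c ∷ l} {cs} {ys = ys} (wf , s , code , e) v) (at ∷ ats) le L | code' , refl
        with length-reverse-one c l [] (trans (cong length (++-identityʳ (reverse (c ∷ l)))) at) | tail-empty {remaining cs rem} v (≤-pred le)
      ... | refl , _ | refl = _ , _ , one (trans (sym (+-identityʳ c)) s)

      outer : ∀ {rem y} → Letters rem → Valid 0 (length rem) y → length (α (specialOf b R₁ rem y)) ≡ 1 → length (preOf rem y) ≤ 0 →
              length (postOf rem y) ≤ 0 → ∃ λ c' → ∃ λ t → ∃ λ es → Out y 0 c' t es
      outer {[]} L (vonly _ _) _ _ _ = _ , _ , _ , lone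
      outer {m ∷ rem} L (vspec {g = g} {l} {cs} _ _ _ code _ _ v e) at _ none' with length-reverse-one g l β at | code-cast {cs = cs} e code L
      ... | refl , _ | _ , refl with tail-empty {remaining cs rem} v none'
      ... | refl = _ , _ , _ , keep none b>0 z≤n refl

    reading⇒fixed : ∀ {x} (v : Valid ε A x) → Reading ft v → FixedSkeleton ε x
    reading⇒fixed v@(vspec {n} {r} {g} {l} {cs} {t} {ys} wf bg s code nt t≤ vt e) (reading _ at1 atp _ seg _ wi)
      with length-reverse-one g l β at1 | code-cast {1} {rem₀} {cs} (trans (cong suc (length-applyUpTo (2 +_) A')) e) code all-letters
    ... | refl , β≡ | code' , refl with tail-reduced {remaining cs rem₀} vt atp
              -- The segment index of the tree of `a` is at least 1, so seg ≤ 2 leaves room for one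
              -- further tree.
              (≤-pred (≤-trans (+-monoˡ-≤ _ (≤-trans (proj₂ (special-part all-letters (v′ v))) (≤-reflexive (sym (+-identityʳ _))))) seg))
              (remaining-cons , λ where
                (here refl) → s≤s z≤n , s≤s (s≤s z≤n)
                (there y∈) → proj₂ (letters-remaining cs all-letters code') y∈)
      where
      remaining-cons : Increasing (1 ∷ remaining cs rem₀)
      remaining-cons = All.tabulate (λ y∈ → FirstBlock.above all-letters cs code' (FirstBlock.remaining∈ all-letters cs code' y∈)) ∷ proj₁ (letters-remaining cs all-letters code')
    ... | c , es , red with reduced-size vt red
    ... | c≡ , _ = _ , _ , _ , formA red refl ,
            fixA (balance-≤ (+-mono-≤ (subst (a ≤_) (special-length v β≡ refl) (wi (memB-intro (1∈first v refl)))) (+-mono-≤ (≤-reflexive s) (+-mono-≤ (≤-reflexive (sym e)) (≤-reflexive (sym c≡))))) (solve 6 (λ i j k l m n → con 1 :+ i :+ (l :+ (con 1 :+ (m :+ j) :+ (con 1 :+ k :+ n))) := j :+ (con 1 :+ (con 1 :+ k) :+ (l :+ con 0 :+ (con 1 :+ (m :+ n) :+ i)))) refl c b A' g (length cs) (length (remaining cs (applyUpTo (2 +_) A')))))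
    reading⇒fixed v@(vcons {n} {r} {d} {l} {cs} {y} wf s code vy e) (reading (at0 ∷ atp) at1 _ _ seg wo _)
      with length-reverse-one d l [] (trans (cong length (++-identityʳ (reverse (d ∷ l)))) at0) | code-cast {1} {rem₀} {cs} (trans (cong suc (length-applyUpTo (2 +_) A')) e) code all-letters
    ... | refl , _ | code' , refl = finish (outer L₁ vy at1 no-pre no-post)
      where
      rem₁ = remaining cs rem₀
      L₁ = letters-remaining cs all-letters code'
      seg≥1 : 1 ≤ segT a (special-tree v)
      seg≥1 = proj₂ (special-part L₁ vy)
      no-pre : length (preOf rem₁ y) ≤ 0
      no-pre = small (segT a (special-tree v)) _ _ seg≥1 seg
        where
        small : ∀ i j k → 1 ≤ i → i + suc j + k ≤ 2 → j ≤ 0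
        small i j k p q = balance-slack k (+-mono-≤ p q) (solve 3 (λ i j k → i :+ (j :+ con 2) :+ k := con 0 :+ (con 1 :+ (j :+ (con 1 :+ i) :+ k))) refl j i k)
      no-post : length (postOf rem₁ y) ≤ 0
      no-post = small (segT a (special-tree v)) (length (preOf rem₁ y)) _ seg≥1 seg
        where
        small : ∀ i j k → 1 ≤ i → i + suc j + k ≤ 2 → k ≤ 0
        small i j k p q = balance-slack j (+-mono-≤ p q) (solve 3 (λ i j k → i :+ (j :+ con 2) :+ k := con 0 :+ (con 1 :+ (j :+ (con 1 :+ k) :+ i))) refl k i j)
      special∈ : special-tree v ∈ decodeLeft b R₁ rem₁ y ++ map raise Rs
      special∈ = ∈-++⁺ˡ (subst (special-tree v ∈_) (sym (left-split L₁ vy)) (∈-++⁺ʳ (preOf rem₁ y) (here refl)))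
      bound : a ∸ ε ≤ TreeTriple.r (special-tree v)
      bound = wo (memB-false (1∉later v refl special∈))
      a≤ : a ≤ ε + TreeTriple.r (special-tree v)
      a≤ = ≤-trans (m≤n+m∸n a ε) (+-monoʳ-≤ ε bound)
      fix : ∀ {c' t es} → Out y 0 c' t es → TreeTriple.r (special-tree v) ≡ suc t → FixedSkeleton ε (before r (d ∷ []) cs y)
      fix {t = t} o r≡ = _ , _ , _ , formB o refl , fixB (≤-trans (≤-reflexive (sym (ValidForm.size (proj₁ (form-valid v (formB o refl))))))
          (≤-pred (≤-trans a≤ (≤-reflexive (trans (cong (ε +_) r≡) (+-suc ε t))))))
      finish : (∃ λ c' → ∃ λ t → ∃ λ es → Out y 0 c' t es) → FixedSkeleton ε (before r (d ∷ []) cs y)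
      finish (_ , _ , _ , o) = fix o (proj₁ (proj₂ (inner {remaining cs rem₀} vy o)))

-- The involution

-- Paths are not searched: the description by a parent function is a finite check equivalent to all
-- the axioms.
isDecSubtree? : ∀ G Vs Es → Dec (IsDecSubtree G Vs Es)
isDecSubtree? G Vs Es = map′ to from
    ((1 ≤? length Vs) ×-dec AllPairs.allPairs? _<?_ Vs ×-dec ≡-dec _≟_ (map proj₁ Es) (front Vs) ×-dec
     All.all? (λ e → (proj₁ e <? proj₂ e) ×-dec (proj₂ e ∈? Vs) ×-dec (E G (proj₁ e) (proj₂ e) Data.Bool.≟ true)) Es)
  where
  Checks : Set
  Checks = 1 ≤ length Vs × Increasing Vs × map proj₁ Es ≡ front Vs × All (λ e → proj₁ e < proj₂ e × proj₂ e ∈ Vs × E G (proj₁ e) (proj₂ e) ≡ true) Es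
  to : Checks → IsDecSubtree G Vs Es
  to (ne , inc , s , es) with snoc-view Vs ne
  ... | vs , m , e = FromTree.isDecSubtree (tree e (trans s (trans (cong front e) (front-snoc vs m))) inc (All.lookup es))
  from : IsDecSubtree G Vs Es → Checks
  from d = IsDecSubtree.nonempty d , increasing , trans sources (sym (trans (cong front vertices) (front-snoc below top))) , All.tabulate edges
    where open Tree (ToTree.toTree d)

nondecreasing-↭ : ∀ {xs ys} → AllPairs _≤_ xs → AllPairs _≤_ ys → xs ↭ ys → xs ≡ ys
nondecreasing-↭ {[]} {ys} _ _ p = sym (Perm.↭-empty-inv (↭-sym p))
nondecreasing-↭ {x ∷ xs} {[]} _ _ p = ⊥-elim (Perm.¬x∷xs↭[] p)
nondecreasing-↭ {x ∷ xs} {y ∷ ys} (q ∷ qs) (r ∷ rs) p with ≤-antisym (least q (Perm.∈-resp-↭ (↭-sym p) (here refl))) (least r (Perm.∈-resp-↭ p (here refl)))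
  where
  least : ∀ {a b bs} → All (b ≤_) bs → a ∈ b ∷ bs → b ≤ a
  least _ (here refl) = ≤-refl
  least q (there a∈) = All.lookup q a∈
... | refl = cong (x ∷_) (nondecreasing-↭ qs rs (Perm.drop-∷ p))

sort-cong : ∀ {xs ys} → xs ↭ ys → sort xs ≡ sort ys
sort-cong {xs} {ys} p = nondecreasing-↭ (Linkedₚ.Linked⇒AllPairs ≤-trans (sort-↗ xs)) (Linkedₚ.Linked⇒AllPairs ≤-trans (sort-↗ ys))
  (↭-trans (sort-↭ xs) (↭-trans p (↭-sym (sort-↭ ys))))

sort-reflects : ∀ {xs ys} → sort xs ≡ sort ys → xs ↭ ys
sort-reflects {xs} {ys} e = ↭-trans (↭-sym (sort-↭ xs)) (↭-trans (↭-reflexive e) (sort-↭ ys))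

simpleFT? : ∀ G F → Dec (SimpleFT G F)
simpleFT? G F = (All.all? isTreeTriple? F ×-dec map′ sort-reflects sort-cong (≡-dec _≟_ (sort (concat (map V F))) (sort (applyUpTo suc (n G))))
                 ×-dec Linked.linked? _<?_ (heads F)) ×-dec simple? F
  where
  isTreeTriple? : ∀ t → Dec (IsTreeTriple G t)
  isTreeTriple? t = isDecSubtree? G (V t) (Ed t) ×-dec (All.all? (1 ≤?_) (α t) ×-dec (sum (α t) ≟ length (V t))) ×-dec ((1 ≤? r t) ×-dec (r t ≤? headD 0 (α t)))
  simple? : ∀ F → Dec (Simple F)
  simple? [] = yes unit
  simple? (t ∷ F) = r t ≟ 1

_≟ₜ_ : DecidableEquality TreeTriple
tt V₁ E₁ α₁ r₁ ≟ₜ tt V₂ E₂ α₂ r₂ = map′ (λ where (refl , refl , refl , refl) → refl) (λ where refl → refl , refl , refl , refl)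
  (≡-dec _≟_ V₁ V₂ ×-dec ≡-dec (Productₚ.≡-dec _≟_ _≟_) E₁ E₂ ×-dec ≡-dec _≟_ α₁ α₂ ×-dec (r₁ ≟ r₂))

_≟F_ : DecidableEquality Forest
_≟F_ = ≡-dec _≟ₜ_

sgn-flip : ∀ {i j} → Flip i j → ∀ k → sgn (j + k) ≡ - sgn (i + k)
sgn-flip (inj₁ refl) k = refl
sgn-flip (inj₂ refl) k = sym (neg-involutive _)

sgn-shift : ∀ k {i j} → sgn j ≡ - sgn i → sgn (k + j) ≡ - sgn (k + i)
sgn-shift zero e = e
sgn-shift (suc k) e = cong -_ (sgn-shift k e)

module Construction (G' : Graph) (nuig : IsNUIG G') (n≥1 : 1 ≤ n G') (φ' : Forest → Forest) (nice : NiceInvolution G' φ')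
  (A' ε : ℕ) (ε≤1 : ε ≤ 1) where
  open Fixedness G' (IsNUIG.range nuig) n≥1 A' ε
  private module N = NiceInvolution nice

  -- `Skeletons` takes a proof of `1 ≤ b`, which stems from the forest on the right; validity has to
  -- be carried from one such proof to another.
  cast-valid : ∀ {b p q m x} → Skeletons.Valid b p ε m x → Skeletons.Valid b q ε m x
  cast-valid {b} {p} {q} {m} {x} = subst (λ p → Skeletons.Valid b p ε m x) (≤-irrelevant p q)

  cast-match : ∀ {b p q x y} → Skeletons.Match b p ε x y → Skeletons.Match b q ε x y
  cast-match {b} {p} {q} {x} {y} = subst (λ p → Skeletons.Match b p ε x y) (≤-irrelevant p q)

  match-firstR : ∀ {b p ε' x y} → Skeletons.Match b p ε' x y → firstR x ≡ firstR y
  match-firstR (Skeletons.tail _) = refl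
  match-firstR (Skeletons.rest _) = refl
  match-firstR {b} {p} (Skeletons.form f g _) = trans (form-firstR f) (sym (form-firstR g))
    where
    form-firstR : ∀ {x r P ds} → Skeletons.Form b p x r P ds → firstR x ≡ r
    form-firstR (Skeletons.formA _ _) = refl
    form-firstR (Skeletons.formB _ _) = refl

  -- The graph of the involution. It is shown to be symmetric and single-valued, which makes `φ` an
  -- involution without any computation; each constructor keeps both forests in decoded form, where
  -- their statistics can be compared.
  data Move (F F' : Forest) : Set where
    onRight : ∀ {W₁ Fs₁ W₂ Fs₂ b β₁ β₂ Rs₁ Rs₂ x}
      (ft₁ : SimpleFT G' (tt (1 ∷ W₁) Fs₁ (b ∷ β₁) 1 ∷ Rs₁)) (ft₂ : SimpleFT G' (tt (1 ∷ W₂) Fs₂ (b ∷ β₂) 1 ∷ Rs₂))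
      (v : WithRight.Valid ft₁ ε A x) → firstR x ≡ 0 →
      φ' (tt (1 ∷ W₁) Fs₁ (b ∷ β₁) 1 ∷ Rs₁) ≡ tt (1 ∷ W₂) Fs₂ (b ∷ β₂) 1 ∷ Rs₂ →
      tt (1 ∷ W₁) Fs₁ (b ∷ β₁) 1 ∷ Rs₁ ≢ tt (1 ∷ W₂) Fs₂ (b ∷ β₂) 1 ∷ Rs₂ →
      F ≡ decode x (tt (1 ∷ W₁) Fs₁ (b ∷ β₁) 1 ∷ Rs₁) → F' ≡ decode x (tt (1 ∷ W₂) Fs₂ (b ∷ β₂) 1 ∷ Rs₂) → Move F F'
    onLeft : ∀ {W' Fs b β Rs x y} (ft : SimpleFT G' (tt (1 ∷ W') Fs (b ∷ β) 1 ∷ Rs))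
      (v : WithRight.Valid ft ε A x) (w : WithRight.Valid ft ε A y) → firstR x ≡ 0 →
      φ' (tt (1 ∷ W') Fs (b ∷ β) 1 ∷ Rs) ≡ tt (1 ∷ W') Fs (b ∷ β) 1 ∷ Rs → WithRight.Match ft ε x y →
      F ≡ decode x (tt (1 ∷ W') Fs (b ∷ β) 1 ∷ Rs) → F' ≡ decode y (tt (1 ∷ W') Fs (b ∷ β) 1 ∷ Rs) → Move F F'
    stay : ∀ {W' Fs b β Rs x} (ft : SimpleFT G' (tt (1 ∷ W') Fs (b ∷ β) 1 ∷ Rs))
      (v : WithRight.Valid ft ε A x) → firstR x ≡ 0 →
      φ' (tt (1 ∷ W') Fs (b ∷ β) 1 ∷ Rs) ≡ tt (1 ∷ W') Fs (b ∷ β) 1 ∷ Rs → WithRight.FixedSkeleton ft ε x →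
      F ≡ decode x (tt (1 ∷ W') Fs (b ∷ β) 1 ∷ Rs) → F' ≡ F → Move F F'

  alone-invalid : ∀ {b p ε' m r} → Skeletons.Valid b p ε' (suc m) (alone r) → ⊥
  alone-invalid (Skeletons.vonly _ ())

  move : ∀ {F} → SimpleFT G F → ∃ (Move F)
  move {F} s with encode ε≤1 (s≤s z≤n) s
  ... | encoded {W'} {Fs} {b} {β} {Rs} {x} ft v x0 F≡ with φ' (tt (1 ∷ W') Fs (b ∷ β) 1 ∷ Rs) ≟F (tt (1 ∷ W') Fs (b ∷ β) 1 ∷ Rs)
  ... | yes fixed with WithRight.match-total ft ε≤1 v
  ...   | inj₁ (_ , refl) = ⊥-elim (alone-invalid v)
  ...   | inj₂ (inj₁ fx) = F , stay ft v x0 fixed fx (sym F≡) refl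
  ...   | inj₂ (inj₂ (y , m , w)) = _ , onLeft ft v w x0 fixed m (sym F≡) refl
  move {F} s | encoded {W'} {Fs} {b} {β} {Rs} {x} ft v x0 F≡ | no moved
    with φ' (tt (1 ∷ W') Fs (b ∷ β) 1 ∷ Rs) in e | N.closed _ ft | N.pres-α11 _ ft
  -- `φ'` preserves the first part, so its image starts with the same `b` and the skeleton remains
  -- valid over it.
  ... | R' | ft' | b≡ with head-view n≥1 ft'
  ... | headView refl with b≡
  ... | refl = _ , onRight ft ft' v x0 e (λ q → moved (sym q)) (sym F≡) refl

  φ : Forest → Forest
  φ F with simpleFT? G F
  ... | yes s = proj₁ (move s)
  ... | no _  = F

  φ-move : ∀ {F} → SimpleFT G F → Move F (φ F)
  φ-move {F} s with simpleFT? G F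
  ... | yes s' = proj₂ (move s')
  ... | no ¬s = ⊥-elim (¬s s)

  move-sym : ∀ {F F'} → Move F F' → Move F' F
  move-sym (onRight ft₁ ft₂ v x0 e ne p q) = onRight ft₂ ft₁ (cast-valid v) x0 (trans (cong φ' (sym e)) (N.invol _ ft₁)) (ne ∘ sym) q p
  move-sym (onLeft ft v w x0 e m p q) = onLeft ft w v (trans (sym (match-firstR m)) x0) e (WithRight.match-sym ft m) q p
  move-sym (stay ft v x0 e fx p q) = stay ft v x0 e fx (trans q p) (sym q)

  -- The forest on the right is read off as the restriction of the decoded one.
  same-right : ∀ {W₁ Fs₁ b₁ β₁ Rs₁ W₂ Fs₂ b₂ β₂ Rs₂ x y}
    (ft₁ : SimpleFT G' (tt (1 ∷ W₁) Fs₁ (b₁ ∷ β₁) 1 ∷ Rs₁)) (ft₂ : SimpleFT G' (tt (1 ∷ W₂) Fs₂ (b₂ ∷ β₂) 1 ∷ Rs₂)) →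
    WithRight.Valid ft₁ ε A x → WithRight.Valid ft₂ ε A y →
    decode x (tt (1 ∷ W₁) Fs₁ (b₁ ∷ β₁) 1 ∷ Rs₁) ≡ decode y (tt (1 ∷ W₂) Fs₂ (b₂ ∷ β₂) 1 ∷ Rs₂) →
    tt (1 ∷ W₁) Fs₁ (b₁ ∷ β₁) 1 ∷ Rs₁ ≡ tt (1 ∷ W₂) Fs₂ (b₂ ∷ β₂) 1 ∷ Rs₂
  same-right ft₁ ft₂ v w e = trans (sym (WithRightForest.restrict-decode ft₁ v)) (trans (cong (restrict a) e) (WithRightForest.restrict-decode ft₂ w))

  move-unique : ∀ {F F₁ F₂} → Move F F₁ → Move F F₂ → F₁ ≡ F₂
  move-unique (onRight ft₁ ft₂ v x0 e ne p q) (onRight ft₁' ft₂' v' x0' e' ne' p' q') with same-right ft₁ ft₁' v v' (trans (sym p) p')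
  ... | refl with WithRightForest.decode-injective ft₁ v (cast-valid v') (trans (sym p) p') | trans (sym e) e'
  ... | refl | refl = trans q (sym q')
  move-unique (onRight ft₁ ft₂ v x0 e ne p q) (onLeft ft v' w x0' e' m p' q') with same-right ft₁ ft v v' (trans (sym p) p')
  ... | refl = ⊥-elim (ne (trans (sym e') e))
  move-unique (onRight ft₁ ft₂ v x0 e ne p q) (stay ft v' x0' e' fx p' q') with same-right ft₁ ft v v' (trans (sym p) p')
  ... | refl = ⊥-elim (ne (trans (sym e') e))
  move-unique (onLeft ft v' w x0' e' m p' q') (onRight ft₁ ft₂ v x0 e ne p q) with same-right ft₁ ft v v' (trans (sym p) p')
  ... | refl = ⊥-elim (ne (trans (sym e') e))
  move-unique (stay ft v' x0' e' fx p' q') (onRight ft₁ ft₂ v x0 e ne p q) with same-right ft₁ ft v v' (trans (sym p) p')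
  ... | refl = ⊥-elim (ne (trans (sym e') e))
  move-unique (onLeft ft v w x0 e m p q) (onLeft ft' v' w' x0' e' m' p' q') with same-right ft ft' v v' (trans (sym p) p')
  ... | refl with WithRightForest.decode-injective ft v (cast-valid v') (trans (sym p) p')
  ... | refl with WithRight.match-unique ft w (cast-valid w') m (cast-match m')
  ... | refl = trans q (sym q')
  move-unique (onLeft ft v w x0 e m p q) (stay ft' v' x0' e' fx p' q') with same-right ft ft' v v' (trans (sym p) p')
  ... | refl with WithRightForest.decode-injective ft v (cast-valid v') (trans (sym p) p')
  ... | refl = ⊥-elim (WithRight.fixed-skeleton-unmatched ft' fx (cast-match m))
  move-unique (stay ft' v' x0' e' fx p' q') (onLeft ft v w x0 e m p q) with same-right ft ft' v v' (trans (sym p) p')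
  ... | refl with WithRightForest.decode-injective ft v (cast-valid v') (trans (sym p) p')
  ... | refl = ⊥-elim (WithRight.fixed-skeleton-unmatched ft' fx (cast-match m))
  move-unique (stay _ _ _ _ _ _ q) (stay _ _ _ _ _ _ q') = trans q (sym q')

  private
    Flip-irrefl : ∀ {i} → Flip i i → ⊥
    Flip-irrefl (inj₁ ())
    Flip-irrefl (inj₂ ())

  record Preserved (F F' : Forest) : Set where
    constructor preserved
    field
      simple  : SimpleFT G F'
      type≡   : type F' ≡ type F
      weight≡ : weight G F' ≡ weight G F
      α11≡    : α11 F' ≡ α11 F

  move-preserves : ∀ {F F'} → SimpleFT G F → Move F F' → Preserved F F'
  move-preserves s (stay ft v x0 e fx p refl) = preserved s refl refl refl
  move-preserves s (onLeft {W'} {Fs} {b} {β} {Rs} {x} {y} ft v w x0 e m refl refl) with WithRight.match-stats ft m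
  ... | stats _ parts wt , first≡ = preserved (WithRight.decode-valid ft w (trans (sym (match-firstR m)) x0))
        (sort-cong (↭-trans (S.parts-decode w) (↭-trans (Perm.++⁺ʳ (β ++ partList Rs) (↭-sym parts)) (↭-sym (S.parts-decode v)))))
        (trans (S.weight-decode w) (trans (cong (_+ weight G' (tt (1 ∷ W') Fs (b ∷ β) 1 ∷ Rs)) (sym wt)) (sym (S.weight-decode v))))
        (trans (S.α11-decode w) (trans (sym first≡) (sym (S.α11-decode v))))
    where module S = DecodeStatistics ft
  move-preserves s (onRight {W₁} {Fs₁} {W₂} {Fs₂} {b} {β₁} {β₂} {Rs₁} {Rs₂} {x} ft₁ ft₂ v x0 e ne refl refl) = preserved (WithRight.decode-valid ft₂ v₂ x0)
      (sort-cong (↭-trans (S₂.parts-decode v₂) (↭-trans (Perm.++⁺ (↭-reflexive (cong (λ p → Skeletons.skeletonParts b p x) irr)) rest↭) (↭-sym (S₁.parts-decode v)))))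
      (trans (S₂.weight-decode v₂) (trans (cong₂ _+_ (cong (λ p → Skeletons.skeletonWeight b p x) irr) wt) (sym (S₁.weight-decode v))))
      (trans (S₂.α11-decode v₂) (trans (cong (λ p → Skeletons.skeletonFirst b p x) irr) (sym (S₁.α11-decode v))))
    where
    module S₁ = DecodeStatistics ft₁
    module S₂ = DecodeStatistics ft₂
    v₂ : WithRight.Valid ft₂ ε A x
    v₂ = cast-valid v
    irr : WithRight.b>0 ft₂ ≡ WithRight.b>0 ft₁
    irr = ≤-irrelevant (WithRight.b>0 ft₂) (WithRight.b>0 ft₁)
    -- Both lists of parts begin with the same `b`, which cancels.
    rest↭ : β₂ ++ partList Rs₂ ↭ β₁ ++ partList Rs₁
    rest↭ = Perm.drop-∷ (sort-reflects (trans (cong type (sym e)) (N.pres-type _ ft₁)))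
    wt : weight G' (tt (1 ∷ W₂) Fs₂ (b ∷ β₂) 1 ∷ Rs₂) ≡ weight G' (tt (1 ∷ W₁) Fs₁ (b ∷ β₁) 1 ∷ Rs₁)
    wt = trans (cong (weight G') (sym e)) (N.pres-weight _ ft₁)

  move-sign : ∀ {F F'} → Move F F' → F' ≢ F → sign F' ≡ - sign F
  move-sign (stay _ _ _ _ _ _ q) ne = ⊥-elim (ne q)
  move-sign (onLeft {W'} {Fs} {b} {β} {Rs} {x} {y} ft v w x0 e m refl refl) _ with WithRight.match-stats ft m
  ... | stats f _ _ , _ = trans (cong sgn (S.cuts-decode w)) (trans (sgn-flip f (cutSum (tt (1 ∷ W') Fs (b ∷ β) 1 ∷ Rs))) (cong (λ k → - sgn k) (sym (S.cuts-decode v))))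
    where module S = DecodeStatistics ft
  move-sign (onRight {W₁} {Fs₁} {W₂} {Fs₂} {b} {β₁} {β₂} {Rs₁} {Rs₂} {x} ft₁ ft₂ v x0 e ne refl refl) _ =
    trans (cong sgn (trans (S₂.cuts-decode v₂) (cong (λ p → Skeletons.skeletonCuts b p x + cutSum R₂) (≤-irrelevant (WithRight.b>0 ft₂) (WithRight.b>0 ft₁)))))
      (trans (sgn-shift (S₁.skeletonCuts x) {cutSum R₁} {cutSum R₂} (trans (cong sign (sym e)) (N.sign-rev _ ft₁ (λ q → ne (trans (sym q) e)))))
        (cong (λ k → - sgn k) (sym (S₁.cuts-decode v))))
    where
    module S₁ = DecodeStatistics ft₁
    module S₂ = DecodeStatistics ft₂
    R₁ = tt (1 ∷ W₁) Fs₁ (b ∷ β₁) 1 ∷ Rs₁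
    R₂ = tt (1 ∷ W₂) Fs₂ (b ∷ β₂) 1 ∷ Rs₂
    v₂ : WithRight.Valid ft₂ ε A x
    v₂ = cast-valid v

  fixed⇒cond : ∀ {F F'} → Move F F' → F' ≡ F → FixedCond a ε φ' F
  fixed⇒cond (onRight ft₁ ft₂ v x0 e ne refl refl) q = ⊥-elim (ne (same-right ft₁ ft₂ v (cast-valid v) (sym q)))
  fixed⇒cond (onLeft ft v w x0 e m refl refl) q with WithRightForest.decode-injective ft v w (sym q)
  -- A match changes the number of cuts by one, so it cannot relate a skeleton to itself.
  ... | refl with WithRight.match-stats ft m
  ... | stats f _ _ , _ = ⊥-elim (Flip-irrefl f)
  fixed⇒cond (stay ft v x0 e fx refl _) _ = reading⇒cond ft v {φ'} e (fixed⇒reading ft v (N.fixed-atom _ ft e) fx)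

  cond⇒fixed : ∀ {F F'} → Move F F' → FixedCond a ε φ' F → F' ≡ F
  cond⇒fixed (onRight ft₁ ft₂ v x0 e ne refl refl) c = ⊥-elim (ne (trans (sym (proj₁ (cond⇒reading ft₁ v {φ'} c))) e))
  cond⇒fixed (onLeft ft v w x0 e m refl refl) c = ⊥-elim (WithRight.fixed-skeleton-unmatched ft (reading⇒fixed ft v (proj₂ (cond⇒reading ft v {φ'} c))) m)
  cond⇒fixed (stay _ _ _ _ _ _ q) _ = q

  φ-nice : NiceInvolution G φ
  φ-nice = record
    { closed      = λ F s → Preserved.simple (kept s)
    ; invol       = λ F s → move-unique (φ-move (Preserved.simple (kept s))) (move-sym (φ-move s))
    ; pres-type   = λ F s → Preserved.type≡ (kept s)
    ; pres-weight = λ F s → Preserved.weight≡ (kept s)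
    ; pres-α11    = λ F s → Preserved.α11≡ (kept s)
    ; fixed-atom  = λ F s e → proj₁ (fixed⇒cond (φ-move s) e)
    ; sign-rev    = λ F s ne → move-sign (φ-move s) ne
    }
    where
    kept : ∀ {F} → SimpleFT G F → Preserved F (φ F)
    kept s = move-preserves s (φ-move s)

theorem4p10 : (G' : Graph) → IsNUIG G' → 1 ≤ n G' →
    (φ' : Forest → Forest) → NiceInvolution G' φ' →
    (a ε : ℕ) → 2 ≤ a → ε ≤ 1 →
    Σ (Forest → Forest) (λ φ → NiceInvolution (K a ε ⊕ G') φ
    × ((F : Forest) → SimpleFT (K a ε ⊕ G') F →
    (φ F ≡ F → FixedCond a ε φ' F) × (FixedCond a ε φ' F → φ F ≡ F)))
theorem4p10 G' nuig n≥1 φ' nice (suc (suc A')) ε (s≤s (s≤s z≤n)) ε≤1 =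
  φ , φ-nice , λ F s → fixed⇒cond (φ-move s) , cond⇒fixed (φ-move s)
  where open Construction G' nuig n≥1 φ' nice A' ε ε≤1
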